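{- For all integers $n\geq 0$ and $m\geq 0$, $$B_{5,13}\left(5^{6m}n+\frac{2\cdot 5^{6m}-2}{3}\right)\equiv 8^m B_{5,13}(n)\pmod{13},$$ and, for each $k\in\{1,5\}$, $$B_{5,13}\left(5^{6m+6}n+\frac{(3k+1)\cdot 5^{6m+5}-2}{3}\right)\equiv 0\pmod{13}.$$
   Context: For integers $l,m>1$, an $l$-regular partition is a partition none of whose parts is divisible by $l$. A $(l,m)$-regular bipartition of $n$ is a pair of partitions $(\lambda,\mu)$ such that the sum of all parts of $\lambda$ and $\mu$ is $n$, $\lambda$ is $l$-regular and $\mu$ is $m$-regular. $B_{l,m}(n)$ denotes the number of $(l,m)$-regular bipartitions of $n$; equivalently $\sum_{n\ge 0}B_{l,m}(n)q^n=\frac{f_lf_m}{f_1^2}$, where $f_k=\prod_{j\ge1}(1-q^{jk})$. -}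

module Defs where

open import Data.List.Base using (List; []; _∷_; length; filter; upTo; cartesianProduct; cartesianProductWith)
open import Data.List.Membership.Propositional using (_∈_)
open import Data.List.Membership.Propositional.Properties
  using (∈-filter⁺; ∈-filter⁻; ∈-cartesianProduct⁺; ∈-cartesianProductWith⁺; ∈-cartesianProductWith⁻; ∈-upTo⁺)
open import Data.List.Properties using (∷-injective)
open import Data.List.Relation.Unary.All as All using (All; []; _∷_)
open import Data.List.Relation.Unary.AllPairs using ([]; _∷_)
open import Data.List.Relation.Unary.Any using (here; there)
open import Data.List.Relation.Unary.Linked using (Linked; linked?)
open import Data.List.Relation.Unary.Unique.Propositional using (Unique)
import Data.List.Relation.Unary.Unique.Propositional.Properties as Unique
open import Data.Nat.Base
open import Data.Nat.Divisibility using (_∣_; _∣?_)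
open import Data.Nat.DivMod using (_/_; _%_; m≡m%n+[m/n]*n; m*n/n≡m; [m+kn]%n≡m%n)
open import Data.Nat.ListAction using (sum)
open import Data.Nat.Properties
open import Data.Nat.Tactic.RingSolver using (solve-∀)
open import Data.Product.Base using (_×_; _,_; proj₂)
open import Function.Bundles using (_⇔_; mk⇔)
open import Relation.Binary.PropositionalEquality
open import Relation.Nullary.Decidable using (Dec; _×-dec_; ¬?)
open import Relation.Nullary.Negation using (¬_)

IsPartition : List ℕ → Set
IsPartition ps = Linked _≥_ ps × All (0 <_) ps

Regular : ℕ → List ℕ → Set
Regular l = All (λ p → ¬ l ∣ p)

IsRegularBipartition : ℕ → ℕ → ℕ → List ℕ × List ℕ → Set
IsRegularBipartition l m n (ps , qs) =
  (IsPartition ps × Regular l ps) ×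
  (IsPartition qs × Regular m qs) ×
  sum ps + sum qs ≡ n

isPartition? : ∀ ps → Dec (IsPartition ps)
isPartition? ps = linked? _≥?_ ps ×-dec All.all? (0 <?_) ps

regular? : ∀ l ps → Dec (Regular l ps)
regular? l = All.all? (λ p → ¬? (l ∣? p))

isRegularBipartition? : ∀ l m n pq → Dec (IsRegularBipartition l m n pq)
isRegularBipartition? l m n (ps , qs) =
  (isPartition? ps ×-dec regular? l ps) ×-dec
  (isPartition? qs ×-dec regular? m qs) ×-dec
  (sum ps + sum qs ≟ n)

-- All lists of length at most k with entries at most n.
boundedLists : ℕ → ℕ → List (List ℕ)
boundedLists n zero    = [] ∷ []
boundedLists n (suc k) = [] ∷ cartesianProductWith _∷_ (upTo (suc n)) (boundedLists n k)

-- Each component of a bipartition of n has at most n parts, all at most n, so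
-- searching the bounded lists finds every bipartition exactly once; see
-- ∈-regularBipartitions and regularBipartitions-unique.
regularBipartitions : ℕ → ℕ → ℕ → List (List ℕ × List ℕ)
regularBipartitions l m n =
  filter (isRegularBipartition? l m n)
         (cartesianProduct (boundedLists n n) (boundedLists n n))

B : ℕ → ℕ → ℕ → ℕ
B l m n = length (regularBipartitions l m n)

∈-boundedLists : ∀ {n} k {ps} → All (0 <_) ps → sum ps ≤ n → sum ps ≤ k →
                 ps ∈ boundedLists n k
∈-boundedLists zero    {[]}         _           _   _   = here refl
∈-boundedLists (suc k) {[]}         _           _   _   = here refl
∈-boundedLists _       {zero ∷ _}   (() ∷ _)
∈-boundedLists zero    {suc p ∷ ps} _           _   ()
∈-boundedLists (suc k) {suc p ∷ ps} (_ ∷ ps>0) s≤n s≤k =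
  there (∈-cartesianProductWith⁺ _∷_
    (∈-upTo⁺ (s≤s (≤-trans (m≤m+n (suc p) (sum ps)) s≤n)))
    (∈-boundedLists k ps>0
      (≤-trans (m≤n+m (sum ps) (suc p)) s≤n)
      (≤-trans (m≤n+m (sum ps) p) (s≤s⁻¹ s≤k))))

boundedLists-unique : ∀ n k → Unique (boundedLists n k)
boundedLists-unique n zero    = [] ∷ []
boundedLists-unique n (suc k) =
  All.tabulate nonempty ∷
  Unique.cartesianProductWith⁺ _∷_ ∷-injective (Unique.upTo⁺ (suc n)) (boundedLists-unique n k)
  where
  nonempty : ∀ {ps} → ps ∈ cartesianProductWith _∷_ (upTo (suc n)) (boundedLists n k) → [] ≢ ps
  nonempty ps∈ refl with ∈-cartesianProductWith⁻ _∷_ (upTo (suc n)) (boundedLists n k) ps∈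
  ... | _ , _ , _ , _ , ()

∈-regularBipartitions : ∀ l m n {pq} →
  pq ∈ regularBipartitions l m n ⇔ IsRegularBipartition l m n pq
∈-regularBipartitions l m n =
  mk⇔ (λ pq∈ → proj₂ (∈-filter⁻ (isRegularBipartition? l m n)
                         {xs = cartesianProduct (boundedLists n n) (boundedLists n n)} pq∈))
      complete
  where
  complete : ∀ {pq} → IsRegularBipartition l m n pq → pq ∈ regularBipartitions l m n
  complete {ps , qs} h@(((_ , ps>0) , _) , ((_ , qs>0) , _) , refl) =
    ∈-filter⁺ (isRegularBipartition? l m n)
      (∈-cartesianProduct⁺ (∈-boundedLists n ps>0 ps≤n ps≤n) (∈-boundedLists n qs>0 qs≤n qs≤n))
      h
    where
    ps≤n : sum ps ≤ n
    ps≤n = m≤m+n (sum ps) (sum qs)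
    qs≤n : sum qs ≤ n
    qs≤n = m≤n+m (sum qs) (sum ps)

regularBipartitions-unique : ∀ l m n → Unique (regularBipartitions l m n)
regularBipartitions-unique l m n =
  Unique.filter⁺ (isRegularBipartition? l m n)
    (Unique.cartesianProduct⁺ (boundedLists-unique n n) (boundedLists-unique n n))

infix 4 _≡_[mod_]

_≡_[mod_] : ℕ → ℕ → (d : ℕ) .{{_ : NonZero d}} → Set
a ≡ b [mod d ] = a % d ≡ b % d

-- (x ∸ 2) / 3 is the exact quotient whenever x ≡ 2 (mod 3); the two instances
-- below show that neither ∸ nor / loses anything in the arguments of B.
exact : ∀ x → x % 3 ≡ 2 → 3 * ((x ∸ 2) / 3) + 2 ≡ x
exact x h = begin
  3 * ((x ∸ 2) / 3) + 2            ≡⟨ cong (λ y → 3 * ((y ∸ 2) / 3) + 2) x≡ ⟩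
  3 * ((x / 3 * 3) / 3) + 2        ≡⟨ cong (λ y → 3 * y + 2) (m*n/n≡m (x / 3) 3) ⟩
  3 * (x / 3) + 2                  ≡⟨ +-comm (3 * (x / 3)) 2 ⟩
  2 + 3 * (x / 3)                  ≡⟨ cong (2 +_) (*-comm 3 (x / 3)) ⟩
  2 + x / 3 * 3                    ≡⟨ x≡ ⟨
  x                                ∎
  where
  open ≡-Reasoning
  x≡ : x ≡ 2 + x / 3 * 3
  x≡ = trans (m≡m%n+[m/n]*n x 3) (cong (_+ x / 3 * 3) h)

2·5^[6m]%3≡2 : ∀ m → (2 * 5 ^ (6 * m)) % 3 ≡ 2
2·5^[6m]%3≡2 zero    = refl
2·5^[6m]%3≡2 (suc m) = begin
  (2 * 5 ^ (6 * suc m)) % 3                       ≡⟨ cong (λ e → (2 * 5 ^ e) % 3) (*-suc 6 m) ⟩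
  (2 * 5 ^ (6 + 6 * m)) % 3                       ≡⟨ cong (λ y → (2 * y) % 3) (^-distribˡ-+-* 5 6 (6 * m)) ⟩
  (2 * (15625 * 5 ^ (6 * m))) % 3                 ≡⟨ cong (_% 3) (expand (5 ^ (6 * m))) ⟩
  (2 * 5 ^ (6 * m) + 10416 * 5 ^ (6 * m) * 3) % 3 ≡⟨ [m+kn]%n≡m%n (2 * 5 ^ (6 * m)) (10416 * 5 ^ (6 * m)) 3 ⟩
  (2 * 5 ^ (6 * m)) % 3                           ≡⟨ 2·5^[6m]%3≡2 m ⟩
  2                                               ∎
  where
  open ≡-Reasoning
  expand : ∀ y → 2 * (15625 * y) ≡ 2 * y + 10416 * y * 3
  expand y = begin
    2 * (15625 * y)           ≡⟨ *-assoc 2 15625 y ⟨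
    31250 * y                 ≡⟨ *-distribʳ-+ y 2 31248 ⟩
    2 * y + 31248 * y         ≡⟨ cong (2 * y +_) (*-assoc 3 10416 y) ⟩
    2 * y + 3 * (10416 * y)   ≡⟨ cong (2 * y +_) (*-comm 3 (10416 * y)) ⟩
    2 * y + 10416 * y * 3     ∎

exact₁ : ∀ m → 3 * ((2 * 5 ^ (6 * m) ∸ 2) / 3) + 2 ≡ 2 * 5 ^ (6 * m)
exact₁ m = exact (2 * 5 ^ (6 * m)) (2·5^[6m]%3≡2 m)

exact₂ : ∀ m k →
  3 * (((3 * k + 1) * 5 ^ (6 * m + 5) ∸ 2) / 3) + 2 ≡ (3 * k + 1) * 5 ^ (6 * m + 5)
exact₂ m k = exact ((3 * k + 1) * 5 ^ (6 * m + 5)) (begin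
  ((3 * k + 1) * 5 ^ (6 * m + 5)) % 3      ≡⟨ cong (λ y → ((3 * k + 1) * y) % 3) (^-distribˡ-+-* 5 (6 * m) 5) ⟩
  ((3 * k + 1) * (5 ^ (6 * m) * 3125)) % 3 ≡⟨ cong (_% 3) (expand k (5 ^ (6 * m))) ⟩
  (2 * 5 ^ (6 * m) + (k * (5 ^ (6 * m) * 3125) + 5 ^ (6 * m) * 1041) * 3) % 3
    ≡⟨ [m+kn]%n≡m%n (2 * 5 ^ (6 * m)) (k * (5 ^ (6 * m) * 3125) + 5 ^ (6 * m) * 1041) 3 ⟩
  (2 * 5 ^ (6 * m)) % 3                    ≡⟨ 2·5^[6m]%3≡2 m ⟩
  2                                        ∎)
  where
  open ≡-Reasoning
  rearrange : ∀ k y c → (3 * k + 1) * (y * (2 + c * 3)) ≡ 2 * y + (k * (y * (2 + c * 3)) + y * c) * 3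
  rearrange = solve-∀
  expand : ∀ k y → (3 * k + 1) * (y * 3125) ≡ 2 * y + (k * (y * 3125) + y * 1041) * 3
  expand k y = rearrange k y 1041

{-# OPTIONS --safe #-}
-- Write f = Π (1 − qⁿ) and fₖ = f(qᵏ). Modulo 13 the generating function f₅ f₁₃ / f² of B 5 13 is f₅ f¹¹,
-- since f¹³ ≡ f₁₃. The exponents of f avoid the classes 3 and 4 modulo 5, and those of f³ the classes 2 and 4,
-- by the identities of Euler and Jacobi; hence f = E₀ + E₁ + E₂ with E₁ = −q f₂₅ and E₀E₂ = −E₁². So f
-- satisfies a quintic equation whose coefficients are constants times powers of E₁, except for the norm
-- E₀⁵ + 11 E₁⁵ + E₂⁵, which is f₅⁶ / f₂₅ by comparison of logarithmic derivatives. The quintic gives a recurrence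
-- for the part of fᵏ with exponents k (mod 5), and with it the operators Σ aₙ qⁿ ↦ Σ a₅ₙ₊ᵣ qⁿ for r = 1, 3
-- become explicit 3 × 3 integer matrices on eta quotients. Applied alternately to f₅ f¹¹, they give
-- modulo 13 the series 5 q² f f₅¹¹ after five steps, whose exponents avoid the classes 0 and 1 modulo 5, and
-- 8 f₅ f¹¹ after six.
module Submission where

open import Defs
open import Data.Nat.Base using (ℕ; _+_; _*_; _∸_; _^_)
open import Data.Nat.DivMod using (_/_)
open import Data.Product.Base using (_×_)
open import Data.Sum.Base using (_⊎_)
open import Relation.Binary.PropositionalEquality using (_≡_)

open import Algebra.Bundles using (CommutativeRing)
import Algebra.Solver.Ring as RingSolver
open import Algebra.Solver.Ring.AlmostCommutativeRing using (fromCommutativeRing; _-Raw-AlmostCommutative⟶_)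
open import Data.Bool.Base using (if_then_else_)
open import Data.Empty using (⊥; ⊥-elim)
open import Data.Integer.Base as ℤ using (ℤ; +_; -[1+_]; 0ℤ; 1ℤ; -1ℤ)
import Data.Integer.Properties as ℤ
open import Data.Integer.Tactic.RingSolver using (solve-∀)
open import Data.List.Base using (List; []; _∷_; _++_; length; filter; map; cartesianProduct)
open import Data.List.Membership.Propositional using (_∈_)
open import Data.List.Membership.Propositional.Properties
  using (∈-filter⁺; ∈-filter⁻; ∈-++⁺ˡ; ∈-++⁺ʳ; ∈-++⁻; ∈-map⁺; ∈-map⁻; ∈-cartesianProduct⁺; ∈-cartesianProduct⁻)
import Data.List.Membership.Propositional.Properties.WithK as WithK
open import Data.List.Properties using (length-++; length-map; ∷-injectiveʳ)
open import Data.List.Relation.Binary.BagAndSetEquality using (∼bag⇒↭)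
open import Data.List.Relation.Binary.Permutation.Propositional.Properties using (↭-length)
open import Data.List.Relation.Unary.All as All using (All; []; _∷_)
open import Data.List.Relation.Unary.AllPairs using ([]; _∷_)
open import Data.List.Relation.Unary.Any using (here)
open import Data.List.Relation.Unary.Linked using (Linked; []; [-]; _∷_)
open import Data.List.Relation.Unary.Unique.Propositional using (Unique)
import Data.List.Relation.Unary.Unique.Propositional.Properties as Unique
open import Data.Maybe.Base as Maybe using (Maybe)
open import Data.Nat.Base as ℕ using (zero; suc; _≤_; _<_; z≤n; s≤s; NonZero)
open import Data.Nat.Divisibility
  using (_∣_; _∣?_; divides; n∣m*n; m∣m*n; ∣-trans; ∣m+n∣m⇒∣n; ∣⇒≤; m%n≡0⇒n∣m; n∣m⇒m%n≡0; *-cancelʳ-∣)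
open import Data.Nat.DivMod
  using (_%_; m≡m%n+[m/n]*n; [m+kn]%n≡m%n; m*n%n≡0; m*n/n≡m; m<n⇒m%n≡m; %-distribˡ-+; %-distribˡ-*; m%n<n; m%n%n≡m%n; m/n≤m)
open import Data.Nat.ListAction using (sum)
open import Data.Nat.Primality using (Prime; prime?; euclidsLemma)
import Data.Nat.Properties as ℕ
import Data.Nat.Tactic.RingSolver as ℕ-Solver
open import Data.Product.Base using (∃; ∃₂; _,_; proj₁; proj₂)
open import Data.Sum.Base using (inj₁; inj₂; [_,_]′)
open import Function.Base using (_∘_)
open import Function.Bundles using (mk⇔; module Equivalence)
open import Level using (0ℓ)
open import Relation.Binary.Bundles using (Setoid)
open import Relation.Binary.Definitions using (tri<; tri≈; tri>)
open import Relation.Binary.PropositionalEquality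
  using (_≢_; refl; sym; trans; cong; cong₂; subst; module ≡-Reasoning)
import Relation.Binary.Reasoning.Setoid as SetoidReasoning
open import Relation.Binary.Structures using (IsEquivalence)
open import Relation.Nullary.Decidable
  using (Dec; does; yes; no; dec-true; dec-false; dec⇒maybe; from-yes; _×-dec_)
open import Relation.Nullary.Negation using (¬_)


-- Formal power series over ℤ

-- Up to powers of q, f₅ f¹¹ and f¹³/f₅ become eta quotients after multiplication by q^(2/3) and
-- q^(1/3). The natural variables are therefore 3n + 2 and 3n + 1, and 3(5n + 1) + 2 = 5(3n + 1),
-- 3(5n + 3) + 1 = 5(3n + 2): this forces the residues 1 and 3 to alternate, each step contributing
-- one factor 5. With R the Rogers-Ramanujan continued fraction in q⁵, without its fractional power
-- of q, the parts E₀, E₁, E₂ are f₂₅ times 1/R, -q, -q²R, and the norm formula is Ramanujan's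
-- evaluation of 1/R⁵ - 11 - R⁵. Only series over ℤ are available, with cancellation of nonzero
-- integers and of series with constant coefficient 1. There are no roots of unity, so the norm is
-- not computed as a product of conjugates: it is found from a first-order differential equation,
-- whose arithmetic input is σ₁(5n) = 6σ₁(n) - 5σ₁(n/5). All identities are exact over ℤ. The
-- modulus 13 enters only through f¹³ ≡ f₁₃ and in the coordinates after five and six steps.

Series : Set
Series = ℕ → ℤ

infixr 5 _+≡_

_+≡_ : ∀ x {y z} → y ≡ z → x ℤ.+ y ≡ x ℤ.+ z
x +≡ e = cong (λ t → x ℤ.+ t) e

infix 4 _≈_

-- A record rather than a function type, so that unification can recover both series from the type
-- of a proof.
record _≈_ (a b : Series) : Set where
  constructor mk≈
  field at : ∀ n → a n ≡ b n

open _≈_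

tail : Series → Series
tail a n = a (suc n)

const : ℤ → Series
const c zero    = c
const c (suc _) = 0ℤ

infixl 6 _⊕_
infixl 7 _⊗_ _·_
infix  8 ⊖_

_⊕_ : Series → Series → Series
(a ⊕ b) n = a n ℤ.+ b n

⊖_ : Series → Series
(⊖ a) n = ℤ.- a n

_·_ : ℤ → Series → Series
(c · a) n = c ℤ.* a n

-- The Cauchy product read off from a = a₀ + q · `tail a`, which avoids finite sums over i + j = n.
_⊗_ : Series → Series → Series
(a ⊗ b) zero    = a 0 ℤ.* b 0
(a ⊗ b) (suc n) = a 0 ℤ.* b (suc n) ℤ.+ (tail a ⊗ b) n

≈-isEquivalence : IsEquivalence _≈_
≈-isEquivalence = record
  { refl  = mk≈ λ _ → refl
  ; sym   = λ p → mk≈ λ n → sym (at p n)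
  ; trans = λ p q → mk≈ λ n → trans (at p n) (at q n)
  }

-- Replaces the explicit convolution sum: arguments by degree or by residue class compare the
-- products with i + j = n one at a time.
⊗-local : ∀ n {a b a′ b′} →
          (∀ i j → i + j ≡ n → a i ℤ.* b j ≡ a′ i ℤ.* b′ j) →
          (a ⊗ b) n ≡ (a′ ⊗ b′) n
⊗-local zero    h = h 0 0 refl
⊗-local (suc n) h = cong₂ ℤ._+_ (h 0 (suc n) refl)
  (⊗-local n λ i j e → h (suc i) j (cong suc e))

⊗-cong : ∀ {a b a′ b′} → a ≈ a′ → b ≈ b′ → a ⊗ b ≈ a′ ⊗ b′
⊗-cong p q = mk≈ λ n → ⊗-local n λ i j _ → cong₂ ℤ._*_ (at p i) (at q j)

⊗-distribʳ : ∀ c a b n → ((a ⊕ b) ⊗ c) n ≡ (a ⊗ c) n ℤ.+ (b ⊗ c) n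
⊗-distribʳ c a b zero    = ℤ.*-distribʳ-+ (c 0) (a 0) (b 0)
⊗-distribʳ c a b (suc n) =
  trans ((a 0 ℤ.+ b 0) ℤ.* c (suc n) +≡ ⊗-distribʳ c (tail a) (tail b) n)
        (lem (a 0) (b 0) (c (suc n)) ((tail a ⊗ c) n) ((tail b ⊗ c) n))
  where
  lem : ∀ x y z s t → (x ℤ.+ y) ℤ.* z ℤ.+ (s ℤ.+ t) ≡ (x ℤ.* z ℤ.+ s) ℤ.+ (y ℤ.* z ℤ.+ t)
  lem = solve-∀

·-⊗ : ∀ c a b n → ((c · a) ⊗ b) n ≡ c ℤ.* (a ⊗ b) n
·-⊗ c a b zero    = ℤ.*-assoc c (a 0) (b 0)
·-⊗ c a b (suc n) =
  trans (c ℤ.* a 0 ℤ.* b (suc n) +≡ ·-⊗ c (tail a) b n)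
        (lem c (a 0) (b (suc n)) ((tail a ⊗ b) n))
  where
  lem : ∀ c x y s → c ℤ.* x ℤ.* y ℤ.+ c ℤ.* s ≡ c ℤ.* (x ℤ.* y ℤ.+ s)
  lem = solve-∀

-- The recursion on the right factor, mirror image of the defining one; commutativity results from
-- comparing the two.
⊗-sucʳ : ∀ n a b → (a ⊗ b) (suc n) ≡ (a ⊗ tail b) n ℤ.+ a (suc n) ℤ.* b 0
⊗-sucʳ zero    a b = refl
⊗-sucʳ (suc n) a b = trans (a 0 ℤ.* b (2 + n) +≡ ⊗-sucʳ n (tail a) b) (sym (ℤ.+-assoc (a 0 ℤ.* b (2 + n)) _ _))

⊗-comm : ∀ n a b → (a ⊗ b) n ≡ (b ⊗ a) n
⊗-comm zero    a b = ℤ.*-comm (a 0) (b 0)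
⊗-comm (suc n) a b = begin
  a 0 ℤ.* b (suc n) ℤ.+ (tail a ⊗ b) n  ≡⟨ cong₂ ℤ._+_ (ℤ.*-comm (a 0) _) (⊗-comm n (tail a) b) ⟩
  b (suc n) ℤ.* a 0 ℤ.+ (b ⊗ tail a) n  ≡⟨ ℤ.+-comm (b (suc n) ℤ.* a 0) _ ⟩
  (b ⊗ tail a) n ℤ.+ b (suc n) ℤ.* a 0  ≡⟨ ⊗-sucʳ n b a ⟨
  (b ⊗ a) (suc n)                       ∎
  where open ≡-Reasoning

⊗-assoc : ∀ n a b c → ((a ⊗ b) ⊗ c) n ≡ (a ⊗ (b ⊗ c)) n
⊗-assoc zero    a b c = ℤ.*-assoc (a 0) (b 0) (c 0)
⊗-assoc (suc n) a b c = begin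
  a 0 ℤ.* b 0 ℤ.* c (suc n) ℤ.+ (((a 0 · tail b) ⊕ (tail a ⊗ b)) ⊗ c) n
    ≡⟨ a 0 ℤ.* b 0 ℤ.* c (suc n) +≡ ⊗-distribʳ c (a 0 · tail b) (tail a ⊗ b) n ⟩
  a 0 ℤ.* b 0 ℤ.* c (suc n) ℤ.+ (((a 0 · tail b) ⊗ c) n ℤ.+ ((tail a ⊗ b) ⊗ c) n)
    ≡⟨ a 0 ℤ.* b 0 ℤ.* c (suc n) +≡ (cong₂ ℤ._+_ (·-⊗ (a 0) (tail b) c n) (⊗-assoc n (tail a) b c)) ⟩
  a 0 ℤ.* b 0 ℤ.* c (suc n) ℤ.+ (a 0 ℤ.* (tail b ⊗ c) n ℤ.+ (tail a ⊗ (b ⊗ c)) n)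
    ≡⟨ lem (a 0) (b 0) (c (suc n)) _ _ ⟩
  a 0 ℤ.* (b 0 ℤ.* c (suc n) ℤ.+ (tail b ⊗ c) n) ℤ.+ (tail a ⊗ (b ⊗ c)) n ∎
  where
  open ≡-Reasoning
  lem : ∀ x y z s t → x ℤ.* y ℤ.* z ℤ.+ (x ℤ.* s ℤ.+ t) ≡ x ℤ.* (y ℤ.* z ℤ.+ s) ℤ.+ t
  lem = solve-∀

const-⊗ : ∀ c a n → (const c ⊗ a) n ≡ c ℤ.* a n
const-⊗ c a zero    = refl
const-⊗ c a (suc n) = trans (c ℤ.* a (suc n) +≡ zero-⊗ n a) (ℤ.+-identityʳ _)
  where
  zero-⊗ : ∀ n a → (tail (const c) ⊗ a) n ≡ 0ℤ
  zero-⊗ zero    a = refl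
  zero-⊗ (suc n) a = trans (ℤ.+-identityˡ _) (zero-⊗ n a)

seriesRing : CommutativeRing 0ℓ 0ℓ
seriesRing = record
  { Carrier = Series ; _≈_ = _≈_ ; _+_ = _⊕_ ; _*_ = _⊗_ ; -_ = ⊖_
  ; 0# = const 0ℤ ; 1# = const 1ℤ
  ; isCommutativeRing = record
    { isRing = record
      { +-isAbelianGroup = record
        { isGroup = record
          { isMonoid = record
            { isSemigroup = record
              { isMagma = record
                { isEquivalence = ≈-isEquivalence
                ; ∙-cong = λ p q → mk≈ λ n → cong₂ ℤ._+_ (at p n) (at q n)
                }
              ; assoc = λ a b c → mk≈ λ n → ℤ.+-assoc (a n) (b n) (c n)
              }
            ; identity = (λ a → mk≈ (0ˡ a)) , λ a → mk≈ λ n → trans (ℤ.+-comm (a n) _) (0ˡ a n)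
            }
          ; inverse = (λ a → mk≈ λ n → trans (ℤ.+-inverseˡ (a n)) (sym (0-at n)))
                    , (λ a → mk≈ λ n → trans (ℤ.+-inverseʳ (a n)) (sym (0-at n)))
          ; ⁻¹-cong = λ p → mk≈ λ n → cong ℤ.-_ (at p n)
          }
        ; comm = λ a b → mk≈ λ n → ℤ.+-comm (a n) (b n)
        }
      ; *-cong = ⊗-cong
      ; *-assoc = λ a b c → mk≈ λ n → ⊗-assoc n a b c
      ; *-identity = (λ a → mk≈ (1ˡ a)) , λ a → mk≈ λ n → trans (⊗-comm n a _) (1ˡ a n)
      ; distrib = (λ c a b → mk≈ λ n → trans (⊗-comm n c (a ⊕ b)) (trans (⊗-distribʳ c a b n)
                               (cong₂ ℤ._+_ (⊗-comm n a c) (⊗-comm n b c))))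
                , (λ c a b → mk≈ (⊗-distribʳ c a b))
      }
    ; *-comm = λ a b → mk≈ λ n → ⊗-comm n a b
    }
  }
  where
  0-at : ∀ n → const 0ℤ n ≡ 0ℤ
  0-at zero    = refl
  0-at (suc _) = refl
  0ˡ : ∀ a n → const 0ℤ n ℤ.+ a n ≡ a n
  0ˡ a n rewrite 0-at n = ℤ.+-identityˡ (a n)
  1ˡ : ∀ a n → (const 1ℤ ⊗ a) n ≡ a n
  1ˡ a n = trans (const-⊗ 1ℤ a n) (ℤ.*-identityˡ (a n))

module S = CommutativeRing seriesRing

-- Lets the ring solver evaluate integer constants inside identities of series.
coefficients : CommutativeRing.rawRing ℤ.+-*-commutativeRing -Raw-AlmostCommutative⟶ fromCommutativeRing seriesRing
coefficients = record
  { ⟦_⟧    = const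
  ; +-homo = λ c d → mk≈ λ { zero → refl ; (suc _) → refl }
  ; *-homo = λ c d → mk≈ λ n → sym (trans (const-⊗ c (const d) n) (lem c d n))
  ; -‿homo = λ c → mk≈ λ { zero → refl ; (suc _) → refl }
  ; 0-homo = mk≈ λ _ → refl
  ; 1-homo = mk≈ λ _ → refl
  }
  where
  lem : ∀ c d n → c ℤ.* const d n ≡ const (c ℤ.* d) n
  lem c d zero    = refl
  lem c d (suc n) = ℤ.*-zeroʳ c

coeff≟ : ∀ c d → Maybe (const c ≈ const d)
coeff≟ c d = Maybe.map (λ { refl → mk≈ λ _ → refl }) (dec⇒maybe (c ℤ.≟ d))

module SeriesSolver = RingSolver (CommutativeRing.rawRing ℤ.+-*-commutativeRing) (fromCommutativeRing seriesRing)
    coefficients coeff≟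

open SeriesSolver using (solve; _:=_; _:+_; _:*_; _:-_; :-_; _:^_; con)
open import Algebra.Properties.Semiring.Exp S.semiring using (^-congˡ; ^-homo-*; ^-assocʳ) renaming (_^_ to infixr 8 _↑_)

module ≈-Reasoning = SetoidReasoning S.setoid

0s 1s : Series
0s = const 0ℤ
1s = const 1ℤ

0s-at : ∀ n → 0s n ≡ 0ℤ
0s-at zero    = refl
0s-at (suc _) = refl

⊗-local-0 : ∀ n {a b} → (∀ i j → i + j ≡ n → a i ℤ.* b j ≡ 0ℤ) → (a ⊗ b) n ≡ 0ℤ
⊗-local-0 n {a} {b} h =
  trans (⊗-local n {a} {b} {0s} {b} λ i j e → trans (h i j e) (sym (trans (cong (ℤ._* b j) (0s-at i)) (ℤ.*-zeroˡ (b j)))))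
        (trans (at (S.zeroˡ b) n) (0s-at n))

q : Series
q 1 = 1ℤ
q _ = 0ℤ

q-⊗-suc : ∀ a n → (q ⊗ a) (suc n) ≡ a n
q-⊗-suc a n = trans (ℤ.+-identityˡ _) (trans (at (⊗-cong tail-q (S.refl {a})) n) (at (S.*-identityˡ a) n))
  where
  tail-q : tail q ≈ 1s
  tail-q = mk≈ λ { zero → refl ; (suc _) → refl }

q^-⊗-at : ∀ k a n → (q ↑ k ⊗ a) (k + n) ≡ a n
q^-⊗-at zero    a n = at (S.*-identityˡ a) n
q^-⊗-at (suc k) a n = trans (at (S.*-assoc q (q ↑ k) a) (suc k + n)) (trans (q-⊗-suc (q ↑ k ⊗ a) (k + n)) (q^-⊗-at k a n))

q^-⊗-below : ∀ k a n → n < k → (q ↑ k ⊗ a) n ≡ 0ℤ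
q^-⊗-below (suc k) a zero    _         = trans (at (S.*-assoc q (q ↑ k) a) 0) refl
q^-⊗-below (suc k) a (suc n) (s≤s n<k) = trans (at (S.*-assoc q (q ↑ k) a) (suc n))
  (trans (q-⊗-suc (q ↑ k ⊗ a) n) (q^-⊗-below k a n n<k))

q^-off : ∀ k n → n ≢ k → (q ↑ k) n ≡ 0ℤ
q^-off k n n≢k with ℕ.<-cmp n k
... | tri< n<k _ _ = trans (sym (at (S.*-identityʳ (q ↑ k)) n)) (q^-⊗-below k 1s n n<k)
... | tri≈ _ e _ = ⊥-elim (n≢k e)
... | tri> _ _ k<n with ℕ.m≤n⇒∃[o]m+o≡n k<n
...   | o , refl = trans (sym (at (S.*-identityʳ (q ↑ k)) _)) (trans (cong (q ↑ k ⊗ 1s) (sym (ℕ.+-suc k o))) (q^-⊗-at k 1s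
    (suc o)))

-- Congruence modulo qᴹ⁺¹, limits and inverses

infix 4 _≈[_]_

record _≈[_]_ (a : Series) (M : ℕ) (b : Series) : Set where
  constructor mk≈[]
  field agree : ∀ n → n ≤ M → a n ≡ b n

open _≈[_]_

≈⇒≈[] : ∀ {M a b} → a ≈ b → a ≈[ M ] b
≈⇒≈[] p = mk≈[] λ n _ → at p n

≈[]⇒≈ : ∀ {a b} → (∀ M → a ≈[ M ] b) → a ≈ b
≈[]⇒≈ p = mk≈ λ n → agree (p n) n ℕ.≤-refl

≈[]-setoid : ℕ → Setoid _ _
≈[]-setoid M = record
  { _≈_ = _≈[ M ]_
  ; isEquivalence = record
    { refl  = mk≈[] λ _ _ → refl
    ; sym   = λ p → mk≈[] λ n n≤ → sym (agree p n n≤)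
    ; trans = λ p r → mk≈[] λ n n≤ → trans (agree p n n≤) (agree r n n≤)
    }
  }

module ≈[] {M} = Setoid (≈[]-setoid M)
module ≈[]-Reasoning M = SetoidReasoning (≈[]-setoid M)

≈[]-weaken : ∀ {M M′ a b} → M ≤ M′ → a ≈[ M′ ] b → a ≈[ M ] b
≈[]-weaken M≤ p = mk≈[] λ n n≤ → agree p n (ℕ.≤-trans n≤ M≤)

⊗-cong[] : ∀ {M a b a′ b′} → a ≈[ M ] a′ → b ≈[ M ] b′ → a ⊗ b ≈[ M ] a′ ⊗ b′
⊗-cong[] p r = mk≈[] λ n n≤ → ⊗-local n λ i j e → cong₂ ℤ._*_
  (agree p i (ℕ.≤-trans (ℕ.m≤m+n i j) (ℕ.≤-trans (ℕ.≤-reflexive e) n≤)))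
  (agree r j (ℕ.≤-trans (ℕ.m≤n+m j i) (ℕ.≤-trans (ℕ.≤-reflexive e) n≤)))

⊕-cong[] : ∀ {M a b a′ b′} → a ≈[ M ] a′ → b ≈[ M ] b′ → a ⊕ b ≈[ M ] a′ ⊕ b′
⊕-cong[] p r = mk≈[] λ n n≤ → cong₂ ℤ._+_ (agree p n n≤) (agree r n n≤)

⊖-cong[] : ∀ {M a a′} → a ≈[ M ] a′ → ⊖ a ≈[ M ] ⊖ a′
⊖-cong[] p = mk≈[] λ n n≤ → cong ℤ.-_ (agree p n n≤)

^-cong[] : ∀ {M a a′} k → a ≈[ M ] a′ → a ↑ k ≈[ M ] a′ ↑ k
^-cong[] zero    p = ≈[].refl
^-cong[] (suc k) p = ⊗-cong[] p (^-cong[] k p)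

q^-vanish : ∀ {M k} a → M < k → q ↑ k ⊗ a ≈[ M ] 0s
q^-vanish {k = k} a M<k = mk≈[] λ n n≤ → trans (q^-⊗-below k a n (ℕ.≤-<-trans n≤ M<k)) (sym (0s-at n))

q^-shift : ∀ {M a b} k → a ≈[ M ] b → q ↑ k ⊗ a ≈[ k + M ] q ↑ k ⊗ b
q^-shift {M} {a} {b} k p = mk≈[] go
  where
  go : ∀ n → n ≤ k + M → (q ↑ k ⊗ a) n ≡ (q ↑ k ⊗ b) n
  go n n≤ with ℕ.<-≤-connex n k
  ... | inj₁ n<k = trans (q^-⊗-below k a n n<k) (sym (q^-⊗-below k b n n<k))
  ... | inj₂ k≤n with ℕ.m≤n⇒∃[o]m+o≡n k≤n
  ...   | o , refl = trans (q^-⊗-at k a o) (trans (agree p o (ℕ.+-cancelˡ-≤ k o M n≤)) (sym (q^-⊗-at k b o)))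

-- The diagonal is the q-adic limit as soon as `s (suc m)` and `s m` agree up to qᵐ.
lim : (ℕ → Series) → Series
lim s n = s n n

lim-≈[] : ∀ s → (∀ m → s (suc m) ≈[ m ] s m) → ∀ m → lim s ≈[ m ] s m
lim-≈[] s stable m = mk≈[] λ n → go n m
  where
  go : ∀ n m → n ≤ m → s n n ≡ s m n
  go n m n≤m with ℕ.m≤n⇒m<n∨m≡n n≤m
  ... | inj₂ refl = refl
  go n (suc m) _ | inj₁ (s≤s n≤m) = trans (go n m n≤m) (sym (agree (stable m) n n≤m))

abstract
  -- The geometric series in u = 1 - a converges because u has no constant term. Abstract, so that
  -- only the equation of the inverse is visible later.
  inverse : ∀ a → a 0 ≡ 1ℤ → ∃ λ b → a ⊗ b ≈ 1s
  inverse a a0 = lim s , ≈[]⇒≈ λ M → ≈[].trans (⊗-cong[] ≈[].refl (lim-≈[] s stable M)) (approx M)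
    where
    u : Series
    u = 1s ⊕ ⊖ a
    u^-vanish : ∀ m → u ↑ suc m ≈[ m ] 0s
    u^-vanish m = mk≈[] λ n n≤ → trans (go (suc m) n (s≤s n≤)) (sym (0s-at n))
      where
      go : ∀ k n → n < k → (u ↑ k) n ≡ 0ℤ
      go (suc k) n n< = ⊗-local-0 n {u} {u ↑ k} terms
        where
        terms : ∀ i j → i + j ≡ n → u i ℤ.* (u ↑ k) j ≡ 0ℤ
        terms zero    j refl = trans (cong (λ t → (1ℤ ℤ.+ ℤ.- t) ℤ.* (u ↑ k) j) a0) (ℤ.*-zeroˡ ((u ↑ k) j))
        terms (suc i) j refl = trans (cong (u (suc i) ℤ.*_) (go k j (ℕ.≤-trans (s≤s (ℕ.m≤n+m j i)) (ℕ.s≤s⁻¹ n<))))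
                                     (ℤ.*-zeroʳ (u (suc i)))
    s : ℕ → Series
    s zero    = 1s
    s (suc m) = s m ⊕ u ↑ suc m
    telescope : ∀ m → a ⊗ s m ≈ 1s ⊕ ⊖ (u ↑ suc m)
    telescope zero = solve 1 (λ a → a :* con 1ℤ := con 1ℤ :+ :- ((con 1ℤ :+ :- a) :* con 1ℤ)) S.refl a
    telescope (suc m) = S.trans (S.distribˡ a (s m) (u ↑ suc m)) (S.trans (S.+-congʳ (telescope m))
      (solve 2 (λ a w → con 1ℤ :+ :- w :+ a :* w := con 1ℤ :+ :- ((con 1ℤ :+ :- a) :* w)) S.refl a (u ↑ suc m)))
    stable : ∀ m → s (suc m) ≈[ m ] s m
    stable m = ≈[].trans (⊕-cong[] (≈[].refl {x = s m}) (u^-vanish m)) (≈⇒≈[] (S.+-identityʳ (s m)))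
    approx : ∀ m → a ⊗ s m ≈[ m ] 1s
    approx m = ≈[].trans (≈⇒≈[] (telescope m))
      (≈[].trans (⊕-cong[] (≈[].refl {x = 1s}) (⊖-cong[] (u^-vanish m))) (≈⇒≈[] (solve 0 (con 1ℤ :+ :- con 0ℤ := con 1ℤ)
          S.refl)))

⊗-cancelˡ : ∀ a {b c} → a 0 ≡ 1ℤ → a ⊗ b ≈ a ⊗ c → b ≈ c
⊗-cancelˡ a {b} {c} a0 e = begin
  b              ≈⟨ unit b ⟩
  a⁻¹ ⊗ (a ⊗ b)  ≈⟨ S.*-congˡ e ⟩
  a⁻¹ ⊗ (a ⊗ c)  ≈⟨ unit c ⟨
  c              ∎
  where
  open ≈-Reasoning
  a⁻¹ = proj₁ (inverse a a0)
  unit : ∀ d → d ≈ a⁻¹ ⊗ (a ⊗ d)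
  unit d = begin
    d              ≈⟨ S.*-identityˡ d ⟨
    1s ⊗ d         ≈⟨ S.*-congʳ (proj₂ (inverse a a0)) ⟨
    (a ⊗ a⁻¹) ⊗ d  ≈⟨ solve 3 (λ a b d → a :* b :* d := b :* (a :* d)) S.refl a a⁻¹ d ⟩
    a⁻¹ ⊗ (a ⊗ d)  ∎

⊗-cancelˡ[] : ∀ {M} a {b c} → a 0 ≡ 1ℤ → a ⊗ b ≈[ M ] a ⊗ c → b ≈[ M ] c
⊗-cancelˡ[] {M} a {b} {c} a0 e = begin
  b              ≈⟨ unit b ⟩
  a⁻¹ ⊗ (a ⊗ b)  ≈⟨ ⊗-cong[] (≈[].refl {x = a⁻¹}) e ⟩
  a⁻¹ ⊗ (a ⊗ c)  ≈⟨ unit c ⟨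
  c              ∎
  where
  open ≈[]-Reasoning M
  a⁻¹ = proj₁ (inverse a a0)
  unit : ∀ d → d ≈[ M ] a⁻¹ ⊗ (a ⊗ d)
  unit d = ≈⇒≈[] (S.trans (S.sym (S.*-identityˡ d)) (S.trans (S.*-congʳ (S.sym (proj₂ (inverse a a0))))
    (solve 3 (λ a b d → a :* b :* d := b :* (a :* d)) S.refl a a⁻¹ d)))

-- Dilations, residue classes of exponents, and U

-- dil k a is a(q^k).
onMultiples : ℕ → ℤ → ℤ
onMultiples zero    c = c
onMultiples (suc _) _ = 0ℤ

dil : (k : ℕ) .{{_ : NonZero k}} → Series → Series
dil k a n = onMultiples (n % k) (a (n / k))

const-at : ∀ c n → n ≢ 0 → const c n ≡ 0ℤ
const-at c zero    h = ⊥-elim (h refl)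
const-at c (suc n) _ = refl

module _ (k : ℕ) .{{_ : NonZero k}} where

  k+n≢0 : ∀ n → k + n ≢ 0
  k+n≢0 n e = ℕ.≢-nonZero⁻¹ k (ℕ.m+n≡0⇒m≡0 k e)

  dil-hit : ∀ a m → dil k a (m * k) ≡ a m
  dil-hit a m = cong₂ (λ r e → onMultiples r (a e)) (m*n%n≡0 m k) (m*n/n≡m m k)

  dil-miss : ∀ a n → n % k ≢ 0 → dil k a n ≡ 0ℤ
  dil-miss a n n%k≢0 with n % k
  ... | zero  = ⊥-elim (n%k≢0 refl)
  ... | suc _ = refl

  by-residue : (P : ℕ → Set) → (∀ m → P (m * k)) → (∀ n → n % k ≢ 0 → P n) → ∀ n → P n
  by-residue P hit miss n with n % k ℕ.≟ 0
  ... | yes e = subst P (sym (trans (m≡m%n+[m/n]*n n k) (cong (ℕ._+ n / k * k) e))) (hit (n / k))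
  ... | no  h = miss n h

  -- The values at multiples of k and the zeros elsewhere determine a dilation, so each law for
  -- `dil` is checked on these two kinds of exponents.
  dil-unique : ∀ a b → (∀ m → b (m * k) ≡ a m) → (∀ n → n % k ≢ 0 → b n ≡ 0ℤ) → dil k a ≈ b
  dil-unique a b hit miss = mk≈ (by-residue _
    (λ m → trans (dil-hit a m) (sym (hit m)))
    (λ n h → trans (dil-miss a n h) (sym (miss n h))))

  dil-cong : ∀ {a b} → a ≈ b → dil k a ≈ dil k b
  dil-cong p = mk≈ λ n → cong (onMultiples (n % k)) (at p (n / k))

  dil-cong[] : ∀ {M a b} → a ≈[ M ] b → dil k a ≈[ M ] dil k b
  dil-cong[] {M} p = mk≈[] λ n n≤ → cong (onMultiples (n % k)) (agree p (n / k) (ℕ.≤-trans (n/k≤n n) n≤))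
    where
    n/k≤n : ∀ n → n / k ≤ n
    n/k≤n n = m/n≤m n k

  dil-⊕ : ∀ a b → dil k (a ⊕ b) ≈ dil k a ⊕ dil k b
  dil-⊕ a b = dil-unique _ _
    (λ m → cong₂ ℤ._+_ (dil-hit a m) (dil-hit b m))
    (λ n h → cong₂ ℤ._+_ (dil-miss a n h) (dil-miss b n h))

  dil-⊖ : ∀ a → dil k (⊖ a) ≈ ⊖ dil k a
  dil-⊖ a = dil-unique _ _
    (λ m → cong ℤ.-_ (dil-hit a m))
    (λ n h → cong ℤ.-_ (dil-miss a n h))

  dil-const : ∀ c → dil k (const c) ≈ const c
  dil-const c = dil-unique _ _ hit miss
    where
    hit : ∀ m → const c (m * k) ≡ const c m
    hit zero = refl
    hit (suc m) = const-at c (k + m * k) (k+n≢0 (m * k))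
    miss : ∀ n → n % k ≢ 0 → const c n ≡ 0ℤ
    miss zero    h = ⊥-elim (h (m*n%n≡0 0 k))
    miss (suc _) _ = refl

  dil-0 : ∀ a → dil k a 0 ≡ a 0
  dil-0 a = dil-hit a 0

  -- The counterpart of a = a₀ + q · `tail a` after dilation; it lets multiplicativity be proved
  -- along the recursion of `⊗`.
  dil-step : ∀ a → dil k a ≈ const (a 0) ⊕ q ↑ k ⊗ dil k (tail a)
  dil-step a = dil-unique _ _ hit miss
    where
    shifted : ∀ m → (q ↑ k ⊗ dil k (tail a)) (k + m) ≡ dil k (tail a) m
    shifted = q^-⊗-at k (dil k (tail a))
    0<k : 0 < k
    0<k = ℕ.n≢0⇒n>0 (ℕ.≢-nonZero⁻¹ k)
    hit : ∀ m → (const (a 0) ⊕ q ↑ k ⊗ dil k (tail a)) (m * k) ≡ a m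
    hit zero    = trans (cong₂ ℤ._+_ {x = a 0} refl (q^-⊗-below k (dil k (tail a)) 0 0<k)) (ℤ.+-identityʳ (a 0))
    hit (suc m) = trans (cong₂ ℤ._+_ (const-at (a 0) (k + m * k) (k+n≢0 (m * k))) (shifted (m * k)))
      (trans (ℤ.+-identityˡ _) (dil-hit (tail a) m))
    miss : ∀ n → n % k ≢ 0 → (const (a 0) ⊕ q ↑ k ⊗ dil k (tail a)) n ≡ 0ℤ
    miss n h = cong₂ ℤ._+_ (const-at (a 0) n λ { refl → h (m*n%n≡0 0 k) }) (second (ℕ.<-≤-connex n k))
      where
      second : n < k ⊎ k ≤ n → (q ↑ k ⊗ dil k (tail a)) n ≡ 0ℤ
      second (inj₁ n<k) = q^-⊗-below k (dil k (tail a)) n n<k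
      second (inj₂ k≤n) with ℕ.m≤n⇒∃[o]m+o≡n k≤n
      ... | o , refl = trans (shifted o) (dil-miss (tail a) o λ e → h (trans (cong (_% k) k+o) (trans ([m+kn]%n≡m%n o 1 k)
          e)))
        where
        k+o : k + o ≡ o + 1 * k
        k+o = trans (ℕ.+-comm k o) (cong (o ℕ.+_) (sym (ℕ.*-identityˡ k)))

  dil-⊗ : ∀ a b → dil k (a ⊗ b) ≈ dil k a ⊗ dil k b
  dil-⊗ a b = dil-unique _ _ (λ m → hit m a) miss
    where
    b′ = dil k b
    hit : ∀ m a → (dil k a ⊗ b′) (m * k) ≡ (a ⊗ b) m
    hit zero    a = cong₂ ℤ._*_ (dil-0 a) (dil-0 b)
    hit (suc m) a = begin
      (dil k a ⊗ b′) (k + m * k)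
        ≡⟨ at (S.trans (S.*-congʳ (dil-step a)) (S.trans (S.distribʳ b′ (const (a 0)) (q ↑ k ⊗ dil k (tail a)))
             (S.+-congˡ {x = const (a 0) ⊗ b′} (S.*-assoc (q ↑ k) (dil k (tail a)) b′)))) (k + m * k) ⟩
      (const (a 0) ⊗ b′) (k + m * k) ℤ.+ (q ↑ k ⊗ (dil k (tail a) ⊗ b′)) (k + m * k)
        ≡⟨ cong₂ ℤ._+_ (trans (const-⊗ (a 0) b′ (k + m * k)) (cong (λ t → a 0 ℤ.* t) (dil-hit b (suc m))))
                       (trans (q^-⊗-at k (dil k (tail a) ⊗ b′) (m * k)) (hit m (tail a))) ⟩
      a 0 ℤ.* b (suc m) ℤ.+ (tail a ⊗ b) m ∎
      where open ≡-Reasoning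
    miss : ∀ n → n % k ≢ 0 → (dil k a ⊗ b′) n ≡ 0ℤ
    miss n h = ⊗-local-0 n {dil k a} {b′} terms
      where
      terms : ∀ i j → i + j ≡ n → dil k a i ℤ.* b′ j ≡ 0ℤ
      terms i j refl with i % k ℕ.≟ 0 | j % k ℕ.≟ 0
      ... | no i≢ | _     = trans (cong (ℤ._* b′ j) (dil-miss a i i≢)) (ℤ.*-zeroˡ (b′ j))
      ... | yes _ | no j≢ = trans (cong (λ t → dil k a i ℤ.* t) (dil-miss b j j≢)) (ℤ.*-zeroʳ (dil k a i))
      ... | yes i≡ | yes j≡ = ⊥-elim (h (trans (%-distribˡ-+ i j k) (trans (cong₂ (λ s t → (s + t) % k) i≡ j≡) (m*n%n≡0 0
          k))))

  dil-^ : ∀ a j → dil k (a ↑ j) ≈ dil k a ↑ j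
  dil-^ a zero    = dil-const 1ℤ
  dil-^ a (suc j) = S.trans (dil-⊗ a (a ↑ j)) (S.*-congˡ (dil-^ a j))

  dil-q : dil k q ≈ q ↑ k
  dil-q = begin
    dil k q                         ≈⟨ dil-step q ⟩
    const 0ℤ ⊕ q ↑ k ⊗ dil k (tail q) ≈⟨ S.+-identityˡ _ ⟩
    q ↑ k ⊗ dil k (tail q)          ≈⟨ S.*-congˡ (S.trans (dil-cong tail-q) (dil-const 1ℤ)) ⟩
    q ↑ k ⊗ 1s                      ≈⟨ S.*-identityʳ _ ⟩
    q ↑ k                           ∎
    where
    open ≈-Reasoning
    tail-q : tail q ≈ 1s
    tail-q = mk≈ λ { zero → refl ; (suc _) → refl }

-- Euler's operator q d/dq.
θ : Series → Series
θ a n = + n ℤ.* a n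

θ-cong : ∀ {a b} → a ≈ b → θ a ≈ θ b
θ-cong p = mk≈ λ n → cong (λ t → + n ℤ.* t) (at p n)

θ-⊕ : ∀ a b → θ (a ⊕ b) ≈ θ a ⊕ θ b
θ-⊕ a b = mk≈ λ n → ℤ.*-distribˡ-+ (+ n) (a n) (b n)

θ-⊗ : ∀ a b → θ (a ⊗ b) ≈ θ a ⊗ b ⊕ a ⊗ θ b
θ-⊗ a b = mk≈ λ n → go n a b
  where
  lem₀ : ∀ x y → 0ℤ ℤ.* (x ℤ.* y) ≡ 0ℤ ℤ.* x ℤ.* y ℤ.+ x ℤ.* (0ℤ ℤ.* y)
  lem₀ = solve-∀
  lem : ∀ n x y s t u → t ℤ.+ u ≡ n ℤ.* s →
        (1ℤ ℤ.+ n) ℤ.* (x ℤ.* y ℤ.+ s) ≡ (0ℤ ℤ.* x ℤ.* y ℤ.+ (s ℤ.+ t)) ℤ.+ (x ℤ.* ((1ℤ ℤ.+ n) ℤ.* y) ℤ.+ u)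
  lem n x y s t u e = trans (lem₁ n x y s) (trans (cong (λ v → (1ℤ ℤ.+ n) ℤ.* (x ℤ.* y) ℤ.+ (s ℤ.+ v)) (sym e)) (lem₂ n x y
      s t u))
    where
    lem₁ : ∀ n x y s → (1ℤ ℤ.+ n) ℤ.* (x ℤ.* y ℤ.+ s) ≡ (1ℤ ℤ.+ n) ℤ.* (x ℤ.* y) ℤ.+ (s ℤ.+ n ℤ.* s)
    lem₁ = solve-∀
    lem₂ : ∀ n x y s t u → (1ℤ ℤ.+ n) ℤ.* (x ℤ.* y) ℤ.+ (s ℤ.+ (t ℤ.+ u)) ≡ (0ℤ ℤ.* x ℤ.* y ℤ.+ (s ℤ.+ t)) ℤ.+ (x ℤ.* ((1ℤ
        ℤ.+ n) ℤ.* y) ℤ.+ u)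
    lem₂ = solve-∀
  tail-θ : ∀ a → tail (θ a) ≈ tail a ⊕ θ (tail a)
  tail-θ a = mk≈ λ n → trans (ℤ.*-distribʳ-+ (a (suc n)) 1ℤ (+ n)) (cong (ℤ._+ + n ℤ.* a (suc n)) (ℤ.*-identityˡ (a (suc
      n))))
  go : ∀ n a b → + n ℤ.* (a ⊗ b) n ≡ (θ a ⊗ b) n ℤ.+ (a ⊗ θ b) n
  go zero    a b = lem₀ (a 0) (b 0)
  go (suc n) a b = trans (lem (+ n) (a 0) (b (suc n)) ((tail a ⊗ b) n) _ _ (sym (go n (tail a) b)))
    (cong (λ t → 0ℤ ℤ.* a 0 ℤ.* b (suc n) ℤ.+ t ℤ.+ (a ⊗ θ b) (suc n))
          (sym (trans (at (⊗-cong (tail-θ a) (S.refl {b})) n) (⊗-distribʳ b (tail a) (θ (tail a)) n))))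

θ-dil : ∀ k .{{_ : NonZero k}} a → θ (dil k a) ≈ const (+ k) ⊗ dil k (θ a)
θ-dil k a = mk≈ (by-residue k _ hit miss)
  where
  hit : ∀ m → θ (dil k a) (m * k) ≡ (const (+ k) ⊗ dil k (θ a)) (m * k)
  hit m = begin
    + (m * k) ℤ.* dil k a (m * k)  ≡⟨ cong₂ ℤ._*_ (trans (ℤ.pos-* m k) (ℤ.*-comm (+ m) (+ k))) (dil-hit k a m) ⟩
    + k ℤ.* + m ℤ.* a m                ≡⟨ ℤ.*-assoc (+ k) (+ m) (a m) ⟩
    + k ℤ.* (+ m ℤ.* a m)              ≡⟨ cong (λ t → + k ℤ.* t) (dil-hit k (θ a) m) ⟨
    + k ℤ.* dil k (θ a) (m * k)      ≡⟨ const-⊗ (+ k) (dil k (θ a)) (m * k) ⟨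
    (const (+ k) ⊗ dil k (θ a)) (m * k) ∎
    where open ≡-Reasoning
  miss : ∀ n → n % k ≢ 0 → θ (dil k a) n ≡ (const (+ k) ⊗ dil k (θ a)) n
  miss n h = trans (trans (cong (λ t → + n ℤ.* t) (dil-miss k a n h)) (ℤ.*-zeroʳ (+ n)))
    (sym (trans (const-⊗ (+ k) (dil k (θ a)) n) (trans (cong (λ t → + k ℤ.* t) (dil-miss k (θ a) n h)) (ℤ.*-zeroʳ (+ k)))))

-- Unlike `U`, this leaves the surviving exponents in place, so it is linear over the series in q⁵
-- and commutes with θ.
proj : ℕ → Series → Series
proj r a n = if does (n % 5 ℕ.≟ r) then a n else 0ℤ

proj-hit : ∀ {r n} a → n % 5 ≡ r → proj r a n ≡ a n
proj-hit {r} {n} a e rewrite dec-true (n % 5 ℕ.≟ r) e = refl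

proj-miss : ∀ {r n} a → n % 5 ≢ r → proj r a n ≡ 0ℤ
proj-miss {r} {n} a h rewrite dec-false (n % 5 ℕ.≟ r) h = refl

proj-ind : ∀ r (P : ℕ → Set) → (∀ n → n % 5 ≡ r → P n) → (∀ n → n % 5 ≢ r → P n) → ∀ n → P n
proj-ind r P hit miss n with n % 5 ℕ.≟ r
... | yes e = hit n e
... | no  h = miss n h

record OnClass (r : ℕ) (a : Series) : Set where
  constructor onClass
  field vanish : ∀ n → n % 5 ≢ r → a n ≡ 0ℤ

open OnClass

proj-unique : ∀ {r a b} → (∀ n → n % 5 ≡ r → a n ≡ b n) → OnClass r b → proj r a ≈ b
proj-unique {r} {a} h (onClass c) = mk≈ (proj-ind r _
  (λ n e → trans (proj-hit a e) (h n e))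
  (λ n e → trans (proj-miss a e) (sym (c n e))))

proj-cong : ∀ r {a b} → a ≈ b → proj r a ≈ proj r b
proj-cong r {a} {b} p = proj-unique (λ n e → trans (at p n) (sym (proj-hit b e))) (onClass λ n → proj-miss b)

proj-⊕ : ∀ r a b → proj r (a ⊕ b) ≈ proj r a ⊕ proj r b
proj-⊕ r a b = proj-unique (λ n e → sym (cong₂ ℤ._+_ (proj-hit {n = n} a e) (proj-hit {n = n} b e)))
  (onClass λ n h → cong₂ ℤ._+_ (proj-miss {n = n} a h) (proj-miss {n = n} b h))

proj-⊖ : ∀ r a → proj r (⊖ a) ≈ ⊖ proj r a
proj-⊖ r a = proj-unique (λ n e → sym (cong ℤ.-_ (proj-hit a e)))
  (onClass λ n h → cong ℤ.-_ (proj-miss a h))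

proj-θ : ∀ r a → proj r (θ a) ≈ θ (proj r a)
proj-θ r a = proj-unique (λ n e → sym (cong (λ t → + n ℤ.* t) (proj-hit a e)))
  (onClass λ n h → trans (cong (λ t → + n ℤ.* t) (proj-miss a h)) (ℤ.*-zeroʳ (+ n)))

proj-self : ∀ {r a} → OnClass r a → proj r a ≈ a
proj-self c = proj-unique (λ _ _ → refl) c

proj-other : ∀ {r s a} → OnClass s a → s ≢ r → proj r a ≈ 0s
proj-other (onClass c) s≢r = proj-unique (λ n e → trans (c n λ e′ → s≢r (trans (sym e′) e)) (sym (0s-at n))) (onClass λ n _
    → 0s-at n)

onClass-≈ : ∀ {r a b} → a ≈ b → OnClass r a → OnClass r b
onClass-≈ p (onClass c) = onClass λ n h → trans (sym (at p n)) (c n h)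

onClass-proj : ∀ r a → OnClass r (proj r a)
onClass-proj r a = onClass λ n → proj-miss a

onClass-⊕ : ∀ {r a b} → OnClass r a → OnClass r b → OnClass r (a ⊕ b)
onClass-⊕ (onClass c) (onClass d) = onClass λ n h → cong₂ ℤ._+_ (c n h) (d n h)

onClass-⊖ : ∀ {r a} → OnClass r a → OnClass r (⊖ a)
onClass-⊖ (onClass c) = onClass λ n h → cong ℤ.-_ (c n h)

onClass-dil : ∀ a → OnClass 0 (dil 5 a)
onClass-dil a = onClass (dil-miss 5 a)

onClass-const : ∀ c → OnClass 0 (const c)
onClass-const c = onClass-≈ (dil-const 5 c) (onClass-dil (const c))

onClass-q^ : ∀ k → OnClass (k % 5) (q ↑ k)
onClass-q^ k = onClass λ n h → q^-off k n λ { refl → h refl }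

onClass-⊗ : ∀ {s r a b} → OnClass s a → OnClass r b → OnClass ((s + r) % 5) (a ⊗ b)
onClass-⊗ {s} {r} {a} {b} (onClass c) (onClass d) = onClass λ n h → ⊗-local-0 n {a} {b} (terms n h)
  where
  terms : ∀ n → n % 5 ≢ (s + r) % 5 → ∀ i j → i + j ≡ n → a i ℤ.* b j ≡ 0ℤ
  terms n h i j refl with i % 5 ℕ.≟ s | j % 5 ℕ.≟ r
  ... | no i≢ | _     = trans (cong (ℤ._* b j) (c i i≢)) (ℤ.*-zeroˡ (b j))
  ... | yes _ | no j≢ = trans (cong (λ t → a i ℤ.* t) (d j j≢)) (ℤ.*-zeroʳ (a i))
  ... | yes i≡ | yes j≡ = ⊥-elim (h (trans (%-distribˡ-+ i j 5) (cong₂ (λ s t → (s + t) % 5) i≡ j≡)))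

-- A factor supported on one class merely shifts classes and can be taken out of a projection. For s
-- = 0 this is linearity over the series in q⁵.
proj-⊗ : ∀ s r {a} b → r < 5 → OnClass s a → proj ((s + r) % 5) (a ⊗ b) ≈ a ⊗ proj r b
proj-⊗ s r {a} b r<5 C@(onClass c) = proj-unique hit (onClass-⊗ {s} {r} C (onClass-proj r b))
  where
  residue : ∀ i j → (i + j) % 5 ≡ (s + r) % 5 → i % 5 ≡ s → j % 5 ≡ r
  residue i j e refl = trans (sym (shift i j)) (trans (trans (%-distribˡ-+ (i + j) (4 * i) 5)
    (trans (cong (λ t → (t + 4 * i % 5) % 5) (trans e e′))
    (sym (%-distribˡ-+ (i + r) (4 * i) 5)))) (trans (shift i r) (m<n⇒m%n≡m r<5)))
    where
    e′ : (i % 5 + r) % 5 ≡ (i + r) % 5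
    e′ = trans (%-distribˡ-+ (i % 5) r 5) (trans (cong (λ t → (t + r % 5) % 5) (m%n%n≡m%n i 5)) (sym (%-distribˡ-+ i r 5)))
    -- Adding 4i subtracts i modulo 5, which removes the common summand on both sides of the
    -- congruence.
    shift : ∀ i j → (i + j + 4 * i) % 5 ≡ j % 5
    shift i j = trans (cong (_% 5) (lem i j)) ([m+kn]%n≡m%n j i 5)
      where
      lem : ∀ i j → i + j + 4 * i ≡ j + i * 5
      lem = ℕ-Solver.solve-∀
  hit : ∀ n → n % 5 ≡ (s + r) % 5 → (a ⊗ b) n ≡ (a ⊗ proj r b) n
  hit n e = ⊗-local n terms
    where
    terms : ∀ i j → i + j ≡ n → a i ℤ.* b j ≡ a i ℤ.* proj r b j
    terms i j refl with i % 5 ℕ.≟ s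
    ... | yes i≡ = cong (λ t → a i ℤ.* t) (sym (proj-hit b (residue i j e i≡)))
    ... | no  i≢ = trans (trans (cong (ℤ._* b j) (c i i≢)) (ℤ.*-zeroˡ (b j)))
      (sym (trans (cong (ℤ._* proj r b j) (c i i≢)) (ℤ.*-zeroˡ (proj r b j))))

U : ℕ → Series → Series
U r a n = a (r + n * 5)

U-cong : ∀ r a b → a ≈ b → U r a ≈ U r b
U-cong r a b p = mk≈ λ n → at p (r + n * 5)

-- Reduces the evaluation of `U r` to a projection, where multiplication is easier to follow.
U-proj : ∀ r a b → r < 5 → proj r a ≈ q ↑ r ⊗ dil 5 b → U r a ≈ b
U-proj r a b r<5 p = mk≈ λ n → begin
  a (r + n * 5)                      ≡⟨ proj-hit a (trans ([m+kn]%n≡m%n r n 5) (m<n⇒m%n≡m r<5)) ⟨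
  proj r a (r + n * 5)               ≡⟨ at p (r + n * 5) ⟩
  (q ↑ r ⊗ dil 5 b) (r + n * 5)      ≡⟨ q^-⊗-at r (dil 5 b) (n * 5) ⟩
  dil 5 b (n * 5)                      ≡⟨ dil-hit 5 b n ⟩
  b n                                    ∎
  where open ≡-Reasoning

-- The pentagonal number theorem

1-q^ : ℕ → Series
1-q^ k = 1s ⊕ ⊖ q ↑ k

-- qPoch k d = (1 − q^{k+1}) ⋯ (1 − q^{k+d})
qPoch : ℕ → ℕ → Series
qPoch k zero    = 1s
qPoch k (suc d) = 1-q^ (suc (k + d)) ⊗ qPoch k d

q^-≡ : ∀ {i j} → i ≡ j → q ↑ i ≈ q ↑ j
q^-≡ refl = S.refl

qPoch-split : ∀ k d → qPoch k (suc d) ≈ 1-q^ (suc k) ⊗ qPoch (suc k) d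
qPoch-split k zero rewrite ℕ.+-identityʳ k = S.refl
qPoch-split k (suc d) rewrite ℕ.+-suc k d = S.trans (S.*-congˡ (qPoch-split k d))
  (solve 3 (λ a b c → a :* (b :* c) := b :* (a :* c)) S.refl (1-q^ (suc (suc (k + d)))) (1-q^ (suc k)) (qPoch (suc k) d))

1-q^-⊗-≈[] : ∀ {M k} a → M < k → 1-q^ k ⊗ a ≈[ M ] a
1-q^-⊗-≈[] {M} {k} a M<k = begin
  (1s ⊕ ⊖ q ↑ k) ⊗ a  ≈⟨ ≈⇒≈[] (solve 2 (λ a x → (con 1ℤ :+ :- x) :* a := a :+ :- (x :* a)) S.refl a (q ↑ k)) ⟩
  a ⊕ ⊖ (q ↑ k ⊗ a)   ≈⟨ ⊕-cong[] (≈[].refl {x = a}) (⊖-cong[] (q^-vanish a M<k)) ⟩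
  a ⊕ ⊖ 0s            ≈⟨ ≈⇒≈[] (solve 1 (λ a → a :+ :- con 0ℤ := a) S.refl a) ⟩
  a                   ∎
  where open ≈[]-Reasoning M

g : ℕ → Series
g = qPoch 0

-- Euler's function Π (1 − qⁱ), the limit of its partial products.
f : Series
f = lim g

f-≈[] : ∀ m → f ≈[ m ] g m
f-≈[] = lim-≈[] g λ m → 1-q^-⊗-≈[] (g m) ℕ.≤-refl

tri : ℕ → ℕ
tri zero    = 0
tri (suc k) = suc k + tri k

sgn : ℕ → ℤ
sgn zero    = 1ℤ
sgn (suc k) = ℤ.- sgn k

-- Shanks' finite form of the pentagonal number theorem: these terms sum to pentSum n over k ≤ n,
-- and all of them but the one with k = 0 vanish modulo qⁿ⁺¹.
shanksTerm : ℕ → ℕ → Series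
shanksTerm n k = const (sgn k) ⊗ q ↑ (k * n + tri k) ⊗ qPoch k (n ∸ k)

shanksSum : ℕ → ℕ → Series
shanksSum n zero    = 0s
shanksSum n (suc m) = shanksSum n m ⊕ shanksTerm n m

const-⊖ : ∀ c → const (ℤ.- c) ≈ ⊖ const c
const-⊖ c = mk≈ λ { zero → refl ; (suc _) → refl }

-- The difference between the terms for n + 1 and n is T(k + 1) - T(k) with T(k) = (-1)ᵏ q^(kn + tri
-- k) (1 - qᵏ) `qPoch k (n ∸ k)`, because qᵏ(1 - qⁿ⁺¹) - 1 = -(1 - qᵏ) - q^(k + n + 1). The sum
-- telescopes to its upper boundary T(m + 1).
shanksSum-step : ∀ m d {n} → n ≡ m + d → shanksSum (suc n) (suc m) ≈
  shanksSum n (suc m) ⊕ const (sgn (suc m)) ⊗ q ↑ (suc m * n + tri (suc m)) ⊗ qPoch m d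
shanksSum-step m d refl = S.trans (S.+-cong (boundary m d refl) lhsTerm)
  (S.trans (solve 6 (λ S s a b c p → S :+ s :* a :* (con 1ℤ :+ :- b) :* p :+ s :* (a :* b) :* ((con 1ℤ :+ :- c) :* p)
      := S :+ s :* a :* p :+ :- s :* (a :* b :* c) :* p) S.refl
      (shanksSum (m + d) m) (const (sgn m)) (q ↑ (m * n + tri m)) (q ↑ m) (q ↑ suc n) (qPoch m d))
    (S.+-cong (S.+-congˡ {x = shanksSum (m + d) m} (S.sym nTerm)) (S.*-congʳ (S.*-cong (S.sym (const-⊖ (sgn m))) (S.sym
        edge)))))
  where
  n = m + d
  lhsTerm : shanksTerm (suc n) m ≈ const (sgn m) ⊗ (q ↑ (m * n + tri m) ⊗ q ↑ m) ⊗ (1-q^ (suc n) ⊗ qPoch m d)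
  lhsTerm rewrite sym (ℕ.+-suc m d) | ℕ.m+n∸m≡n m (suc d) | ℕ.+-suc m d =
    S.*-congʳ (S.*-congˡ (S.trans (q^-≡ (lem m (m + d) (tri m))) (^-homo-* q (m * (m + d) + tri m) m)))
    where
    lem : ∀ m n t → m * suc n + t ≡ m * n + t + m
    lem = ℕ-Solver.solve-∀
  nTerm : shanksTerm n m ≈ const (sgn m) ⊗ q ↑ (m * n + tri m) ⊗ qPoch m d
  nTerm rewrite ℕ.m+n∸m≡n m d = S.refl
  edge : q ↑ (suc m * n + tri (suc m)) ≈ q ↑ (m * n + tri m) ⊗ q ↑ m ⊗ q ↑ suc n
  edge = S.trans (q^-≡ (lem m n (tri m))) (S.trans (^-homo-* q (m * n + tri m + m) (suc n)) (S.*-congʳ (^-homo-* q (m * n +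
      tri m) m)))
    where
    lem : ∀ m n t → suc m * n + (suc m + t) ≡ m * n + t + m + suc n
    lem = ℕ-Solver.solve-∀
  -- Here T(m) keeps its factor 1 - qᵐ explicit, which covers m = 0, where it vanishes.
  boundary : ∀ m d {n} → n ≡ m + d → shanksSum (suc n) m ≈
    shanksSum n m ⊕ const (sgn m) ⊗ q ↑ (m * n + tri m) ⊗ (1s ⊕ ⊖ q ↑ m) ⊗ qPoch m d
  boundary zero d _ = solve 1 (λ p → con 0ℤ := con 0ℤ :+ con 1ℤ :* con 1ℤ :* (con 1ℤ :+ :- con 1ℤ) :* p) S.refl (qPoch 0 d)
  boundary (suc m) d {n} e = S.trans (shanksSum-step m (suc d) (trans e (sym (ℕ.+-suc m d))))
    (S.+-congˡ {x = shanksSum n (suc m)} (S.trans (S.*-congˡ {x = c} (qPoch-split m d)) (S.sym (S.*-assoc c (1-q^ (suc m))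
        (qPoch (suc m) d)))))
    where
    c = const (sgn (suc m)) ⊗ q ↑ (suc m * n + tri (suc m))

-- The generalised pentagonal numbers k(3k − 1)/2 and k(3k + 1)/2.
pent⁻ pent⁺ : ℕ → ℕ
pent⁻ zero    = 0
pent⁻ (suc k) = pent⁻ k + (3 * k + 1)
pent⁺ zero    = 0
pent⁺ (suc k) = pent⁺ k + (3 * k + 2)

pentTerm : ℕ → Series
pentTerm k = const (sgn k) ⊗ (q ↑ pent⁻ k ⊕ q ↑ pent⁺ k)

pentSum : ℕ → Series
pentSum zero    = 1s
pentSum (suc n) = pentSum n ⊕ pentTerm (suc n)

pent⁻-tri : ∀ n → suc n * n + tri (suc n) ≡ pent⁻ (suc n)
pent⁻-tri zero    = refl
pent⁻-tri (suc n) = trans (lem n (tri n)) (cong (ℕ._+ (3 * suc n + 1)) (pent⁻-tri n))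
  where
  lem : ∀ n t → suc (suc n) * suc n + (suc (suc n) + (suc n + t)) ≡ suc n * n + (suc n + t) + (3 * suc n + 1)
  lem = ℕ-Solver.solve-∀

pent⁺-tri : ∀ n → n * n + tri n ≡ pent⁺ n
pent⁺-tri zero    = refl
pent⁺-tri (suc n) = trans (lem n (tri n)) (cong (ℕ._+ (3 * n + 2)) (pent⁺-tri n))
  where
  lem : ∀ n t → suc n * suc n + (suc n + t) ≡ n * n + t + (3 * n + 2)
  lem = ℕ-Solver.solve-∀

-- Passing to n + 1 adds two monomials: the telescoped boundary, of exponent `pent⁻ (suc n)`, and
-- the new term k = n + 1, of exponent `pent⁺ (suc n)`.
shanks : ∀ n → shanksSum n (suc n) ≈ pentSum n
shanks zero    = solve 0 (con 0ℤ :+ con 1ℤ :* con 1ℤ :* con 1ℤ := con 1ℤ) S.refl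
shanks (suc n) = begin
  shanksSum (suc n) (suc n) ⊕ shanksTerm (suc n) (suc n)
    ≈⟨ S.+-cong step last ⟩
  shanksSum n (suc n) ⊕ c ⊗ q ↑ pent⁻ (suc n) ⊗ 1s ⊕ c ⊗ q ↑ pent⁺ (suc n) ⊗ 1s
    ≈⟨ solve 4 (λ S c a b → S :+ c :* a :* con 1ℤ :+ c :* b :* con 1ℤ := S :+ c :* (a :+ b)) S.refl (shanksSum n (suc n)) c
        _ _ ⟩
  shanksSum n (suc n) ⊕ pentTerm (suc n)
    ≈⟨ S.+-congʳ (shanks n) ⟩
  pentSum n ⊕ pentTerm (suc n) ∎
  where
  open ≈-Reasoning
  c = const (sgn (suc n))
  step : shanksSum (suc n) (suc n) ≈ shanksSum n (suc n) ⊕ c ⊗ q ↑ pent⁻ (suc n) ⊗ 1s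
  step = S.trans (shanksSum-step n 0 (sym (ℕ.+-identityʳ n)))
    (S.+-congˡ {x = shanksSum n (suc n)} (S.*-congʳ (S.*-congˡ (q^-≡ (pent⁻-tri n)))))
  last : shanksTerm (suc n) (suc n) ≈ c ⊗ q ↑ pent⁺ (suc n) ⊗ 1s
  last rewrite ℕ.n∸n≡0 n = S.*-congʳ (S.*-congˡ (q^-≡ (pent⁺-tri (suc n))))

shanksSum-≈[] : ∀ n m → shanksSum n (suc m) ≈[ n ] g n
shanksSum-≈[] n zero    = ≈⇒≈[] (solve 1 (λ p → con 0ℤ :+ con 1ℤ :* con 1ℤ :* p := p) S.refl (g n))
shanksSum-≈[] n (suc m) = begin
  shanksSum n (suc m) ⊕ shanksTerm n (suc m)
    ≈⟨ ⊕-cong[] (shanksSum-≈[] n m) (≈⇒≈[] (solve 3 (λ c a p → c :* a :* p := a :* (c :* p)) S.refl c (q ↑ e) (qPoch (suc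
        m) (n ∸ suc m)))) ⟩
  g n ⊕ q ↑ e ⊗ (c ⊗ qPoch (suc m) (n ∸ suc m))
    ≈⟨ ⊕-cong[] (≈[].refl {x = g n}) (q^-vanish _ n<e) ⟩
  g n ⊕ 0s
    ≈⟨ ≈⇒≈[] (S.+-identityʳ (g n)) ⟩
  g n ∎
  where
  open ≈[]-Reasoning n
  c = const (sgn (suc m))
  e = suc m * n + tri (suc m)
  n<e : n < e
  n<e = ℕ.≤-trans (ℕ.≤-reflexive (sym (ℕ.+-comm n 1))) (ℕ.+-mono-≤ (ℕ.m≤m+n n (m * n)) (s≤s z≤n))

pentagonal : ∀ n → f ≈[ n ] pentSum n
pentagonal n = ≈[].trans (f-≈[] n) (≈[].trans (≈[].sym (shanksSum-≈[] n n)) (≈⇒≈[] (shanks n)))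

-- The 5-dissection of f

-- Five successive increments add up to a multiple of 5, so the classes of the exponents can be read
-- off from finitely many indices; only 0, 1 and 2 occur.
pent⁻-mod : ∀ r J → pent⁻ (r + J * 5) % 5 ≡ pent⁻ r % 5
pent⁻-mod r zero    = cong (λ t → pent⁻ t % 5) (ℕ.+-identityʳ r)
pent⁻-mod r (suc J) = trans (cong (λ t → pent⁻ t % 5) (lem r J))
  (trans (cong (_% 5) (period (pent⁻ k) k)) (trans ([m+kn]%n≡m%n (pent⁻ k) (3 * k + 7) 5) (pent⁻-mod r J)))
  where
  k = r + J * 5
  lem : ∀ r J → r + suc J * 5 ≡ 5 + (r + J * 5)
  lem = ℕ-Solver.solve-∀
  period : ∀ p k → p + (3 * k + 1) + (3 * suc k + 1) + (3 * suc (suc k) + 1)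
    + (3 * suc (suc (suc k)) + 1) + (3 * suc (suc (suc (suc k))) + 1) ≡ p + (3 * k + 7) * 5
  period = ℕ-Solver.solve-∀

pent⁺-mod : ∀ r J → pent⁺ (r + J * 5) % 5 ≡ pent⁺ r % 5
pent⁺-mod r zero    = cong (λ t → pent⁺ t % 5) (ℕ.+-identityʳ r)
pent⁺-mod r (suc J) = trans (cong (λ t → pent⁺ t % 5) (lem r J))
  (trans (cong (_% 5) (period (pent⁺ k) k)) (trans ([m+kn]%n≡m%n (pent⁺ k) (3 * k + 8) 5) (pent⁺-mod r J)))
  where
  k = r + J * 5
  lem : ∀ r J → r + suc J * 5 ≡ 5 + (r + J * 5)
  lem = ℕ-Solver.solve-∀
  period : ∀ p k → p + (3 * k + 2) + (3 * suc k + 2) + (3 * suc (suc k) + 2)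
    + (3 * suc (suc (suc k)) + 2) + (3 * suc (suc (suc (suc k))) + 2) ≡ p + (3 * k + 8) * 5
  period = ℕ-Solver.solve-∀

-- Euler's function reproduces itself along the exponents 1 (mod 25): these come from
-- the indices k = 5J + 4 and k = 5J + 6 of the pentagonal numbers.
pent⁺-25 : ∀ J → pent⁺ (4 + J * 5) ≡ 1 + 5 * (5 * pent⁻ (suc J))
pent⁺-25 zero    = refl
pent⁺-25 (suc J) = trans (lem₁ (pent⁺ (4 + J * 5)) J) (trans (cong (ℕ._+ (100 + J * 75)) (pent⁺-25 J)) (lem₂ (pent⁻ (suc
    J)) J))
  where
  lem₁ : ∀ p J → p + (3 * (4 + J * 5) + 2) + (3 * (5 + J * 5) + 2) + (3 * (6 + J * 5) + 2)
    + (3 * (7 + J * 5) + 2) + (3 * (8 + J * 5) + 2) ≡ p + (100 + J * 75)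
  lem₁ = ℕ-Solver.solve-∀
  lem₂ : ∀ p J → 1 + 5 * (5 * p) + (100 + J * 75) ≡ 1 + 5 * (5 * (p + (3 * suc J + 1)))
  lem₂ = ℕ-Solver.solve-∀

pent⁻-25 : ∀ J → pent⁻ (6 + J * 5) ≡ 1 + 5 * (5 * pent⁺ (suc J))
pent⁻-25 zero    = refl
pent⁻-25 (suc J) = trans (lem₁ (pent⁻ (6 + J * 5)) J) (trans (cong (ℕ._+ (125 + J * 75)) (pent⁻-25 J)) (lem₂ (pent⁺ (suc
    J)) J))
  where
  lem₁ : ∀ p J → p + (3 * (6 + J * 5) + 1) + (3 * (7 + J * 5) + 1) + (3 * (8 + J * 5) + 1)
    + (3 * (9 + J * 5) + 1) + (3 * (10 + J * 5) + 1) ≡ p + (125 + J * 75)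
  lem₁ = ℕ-Solver.solve-∀
  lem₂ : ∀ p J → 1 + 5 * (5 * p) + (125 + J * 75) ≡ 1 + 5 * (5 * (p + (3 * suc J + 2)))
  lem₂ = ℕ-Solver.solve-∀

sgn-*5 : ∀ J → sgn (J * 5) ≡ sgn J
sgn-*5 zero    = refl
sgn-*5 (suc J) = cong ℤ.-_ (trans (ℤ.neg-involutive _) (trans (ℤ.neg-involutive _) (sgn-*5 J)))

dil25 : Series → Series
dil25 a = dil 5 (dil 5 a)

dil-q^ : ∀ k .{{_ : NonZero k}} e → dil k (q ↑ e) ≈ q ↑ (k * e)
dil-q^ k e = S.trans (dil-^ k q e) (S.trans (^-congˡ e (dil-q k)) (^-assocʳ q k e))

q·dil25-monomial : ∀ c e → q ⊗ dil25 (const c ⊗ q ↑ e) ≈ const c ⊗ q ↑ (1 + 5 * (5 * e))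
q·dil25-monomial c e = begin
  q ⊗ dil 5 (dil 5 (const c ⊗ q ↑ e))     ≈⟨ S.*-congˡ (dil-cong 5 (S.trans (dil-⊗ 5 (const c) (q ↑ e)) (S.*-cong
      (dil-const 5 c) (dil-q^ 5 e)))) ⟩
  q ⊗ dil 5 (const c ⊗ q ↑ (5 * e))     ≈⟨ S.*-congˡ (S.trans (dil-⊗ 5 (const c) (q ↑ (5 * e))) (S.*-cong (dil-const 5 c)
      (dil-q^ 5 (5 * e)))) ⟩
  q ⊗ (const c ⊗ q ↑ (5 * (5 * e)))   ≈⟨ solve 3 (λ q c a → q :* (c :* a) := c :* (q :* a)) S.refl q (const c) (q ↑ (5 * (5
      * e))) ⟩
  const c ⊗ (q ⊗ q ↑ (5 * (5 * e)))   ∎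
  where open ≈-Reasoning

dil25-⊕ : ∀ a b → dil25 (a ⊕ b) ≈ dil25 a ⊕ dil25 b
dil25-⊕ a b = S.trans (dil-cong 5 (dil-⊕ 5 a b)) (dil-⊕ 5 (dil 5 a) (dil 5 b))

onClass-monomial : ∀ {r} c e → e % 5 ≡ r → OnClass r (const c ⊗ q ↑ e)
onClass-monomial c e refl = onClass λ n h → trans (const-⊗ c (q ↑ e) n) (trans (cong (λ t → c ℤ.* t) (vanish (onClass-q^ e)
    n h)) (ℤ.*-zeroʳ c))

-- The cut at 2 + 5J makes the class 1 part match term by term: each further block k = 5J + 3, ...,
-- 5J + 7 contains exactly two monomials of class 1, at k = 5J + 4 and k = 5J + 6, and they form the
-- next term of the dilated sum. The other eight fall into classes 0 and 2.
pentSum-dissection : ∀ J → ∃₂ λ x z → OnClass 0 x × OnClass 2 z ×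
  pentSum (2 + J * 5) ≈ x ⊕ ⊖ (q ⊗ dil25 (pentSum J)) ⊕ z
pentSum-dissection zero =
  const 1ℤ ⊗ q ↑ 0 ⊕ const 1ℤ ⊗ q ↑ 5 , const -1ℤ ⊗ q ↑ 2 ⊕ const 1ℤ ⊗ q ↑ 7 ,
  onClass-⊕ (onClass-monomial 1ℤ 0 refl) (onClass-monomial 1ℤ 5 refl) ,
  onClass-⊕ (onClass-monomial -1ℤ 2 refl) (onClass-monomial 1ℤ 7 refl) ,
  S.trans (solve 1 (λ q → con 1ℤ :+ con -1ℤ :* (q :^ 1 :+ q :^ 2) :+ con 1ℤ :* (q :^ 5 :+ q :^ 7)
      := con 1ℤ :* q :^ 0 :+ con 1ℤ :* q :^ 5 :+ :- (q :* con 1ℤ) :+ (con -1ℤ :* q :^ 2 :+ con 1ℤ :* q :^ 7)) S.refl q)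
    (S.+-congʳ (S.+-congˡ {x = const 1ℤ ⊗ q ↑ 0 ⊕ const 1ℤ ⊗ q ↑ 5} (S.-‿cong (S.*-congˡ (S.sym (S.trans (dil-cong 5
        (dil-const 5 1ℤ)) (dil-const 5 1ℤ)))))))
pentSum-dissection (suc J) with pentSum-dissection J
... | x , z , x∈ , z∈ , e =
  x ⊕ (m⁺ 3 ⊕ m⁻ 5 ⊕ m⁺ 5 ⊕ m⁻ 7) , z ⊕ (m⁻ 3 ⊕ m⁻ 4 ⊕ m⁺ 6 ⊕ m⁺ 7) ,
  onClass-⊕ x∈ (onClass-⊕ (onClass-⊕ (onClass-⊕ (on⁺ 3) (on⁻ 5)) (on⁺ 5)) (on⁻ 7)) ,
  onClass-⊕ z∈ (onClass-⊕ (onClass-⊕ (onClass-⊕ (on⁻ 3) (on⁻ 4)) (on⁺ 6)) (on⁺ 7)) ,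
  (begin
    pentSum (2 + J * 5) ⊕ t 3 ⊕ t 4 ⊕ t 5 ⊕ t 6 ⊕ t 7
      ≈⟨ S.+-cong (S.+-cong (S.+-cong (S.+-cong (S.+-cong e (split 3)) (split 4)) (split 5)) (split 6)) (split 7) ⟩
    x ⊕ y ⊕ z ⊕ (m⁻ 3 ⊕ m⁺ 3) ⊕ (m⁻ 4 ⊕ m⁺ 4) ⊕ (m⁻ 5 ⊕ m⁺ 5) ⊕ (m⁻ 6 ⊕ m⁺ 6) ⊕ (m⁻ 7 ⊕ m⁺ 7)
      ≈⟨ solve 13 (λ x y z a3 b3 a4 b4 a5 b5 a6 b6 a7 b7 →
           x :+ y :+ z :+ (a3 :+ b3) :+ (a4 :+ b4) :+ (a5 :+ b5) :+ (a6 :+ b6) :+ (a7 :+ b7) :=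
           x :+ (b3 :+ a5 :+ b5 :+ a7) :+ (y :+ (b4 :+ a6)) :+ (z :+ (a3 :+ a4 :+ b6 :+ b7))) S.refl
           x y z (m⁻ 3) (m⁺ 3) (m⁻ 4) (m⁺ 4) (m⁻ 5) (m⁺ 5) (m⁻ 6) (m⁺ 6) (m⁻ 7) (m⁺ 7) ⟩
    X ⊕ (y ⊕ (m⁺ 4 ⊕ m⁻ 6)) ⊕ Z
      ≈⟨ S.+-congʳ (S.+-congˡ {x = X} middle) ⟩
    X ⊕ ⊖ (q ⊗ dil25 (pentSum (suc J))) ⊕ Z ∎)
  where
  open ≈-Reasoning
  y = ⊖ (q ⊗ dil25 (pentSum J))
  t m⁻ m⁺ : ℕ → Series
  t r = pentTerm (r + J * 5)
  m⁻ r = const (sgn (r + J * 5)) ⊗ q ↑ pent⁻ (r + J * 5)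
  m⁺ r = const (sgn (r + J * 5)) ⊗ q ↑ pent⁺ (r + J * 5)
  X = x ⊕ (m⁺ 3 ⊕ m⁻ 5 ⊕ m⁺ 5 ⊕ m⁻ 7)
  Z = z ⊕ (m⁻ 3 ⊕ m⁻ 4 ⊕ m⁺ 6 ⊕ m⁺ 7)
  split : ∀ r → t r ≈ m⁻ r ⊕ m⁺ r
  split r = S.distribˡ _ _ _
  on⁻ : ∀ r → OnClass (pent⁻ r % 5) (m⁻ r)
  on⁻ r = onClass-monomial (sgn (r + J * 5)) (pent⁻ (r + J * 5)) (pent⁻-mod r J)
  on⁺ : ∀ r → OnClass (pent⁺ r % 5) (m⁺ r)
  on⁺ r = onClass-monomial (sgn (r + J * 5)) (pent⁺ (r + J * 5)) (pent⁺-mod r J)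
  c = sgn (suc J)
  -- Both indices 5J + 4 and 5J + 6 carry the sign (-1)ᴶ, opposite to that of the term J + 1. This
  -- is the origin of the minus sign in `E₁`.
  coefficient : ∀ k → sgn k ≡ sgn J → const (sgn k) ≈ ⊖ const c
  coefficient k e = S.trans (mk≈ λ n → cong (λ t → const t n) (trans e (sym (ℤ.neg-involutive (sgn J))))) (const-⊖ c)
  sgn₄ : sgn (4 + J * 5) ≡ sgn J
  sgn₄ = trans (ℤ.neg-involutive _) (trans (ℤ.neg-involutive _) (sgn-*5 J))
  sgn₆ : sgn (6 + J * 5) ≡ sgn J
  sgn₆ = trans (ℤ.neg-involutive _) sgn₄
  middle : y ⊕ (m⁺ 4 ⊕ m⁻ 6) ≈ ⊖ (q ⊗ dil25 (pentSum (suc J)))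
  middle = begin
    y ⊕ (m⁺ 4 ⊕ m⁻ 6)
      ≈⟨ S.+-congˡ {x = y} (S.+-cong (S.*-cong (coefficient (4 + J * 5) sgn₄) (q^-≡ (pent⁺-25 J)))
                                     (S.*-cong (coefficient (6 + J * 5) sgn₆) (q^-≡ (pent⁻-25 J)))) ⟩
    y ⊕ (⊖ const c ⊗ q ↑ e₁ ⊕ ⊖ const c ⊗ q ↑ e₂)
      ≈⟨ solve 4 (λ p c a b → :- p :+ (:- c :* a :+ :- c :* b) := :- (p :+ (c :* a :+ c :* b))) S.refl (q ⊗ dil25 (pentSum
          J)) (const c) (q ↑ e₁) (q ↑ e₂) ⟩
    ⊖ (q ⊗ dil25 (pentSum J) ⊕ (const c ⊗ q ↑ e₁ ⊕ const c ⊗ q ↑ e₂))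
      ≈⟨ S.-‿cong (S.+-congˡ {x = q ⊗ dil25 (pentSum J)} (S.+-cong (q·dil25-monomial c (pent⁻ (suc J))) (q·dil25-monomial c
          (pent⁺ (suc J))))) ⟨
    ⊖ (q ⊗ dil25 (pentSum J) ⊕ (q ⊗ dil25 a₁ ⊕ q ⊗ dil25 a₂))
      ≈⟨ S.-‿cong (solve 4 (λ q p a b → q :* p :+ (q :* a :+ q :* b) := q :* (p :+ (a :+ b))) S.refl q (dil25 (pentSum J))
          (dil25 a₁) (dil25 a₂)) ⟩
    ⊖ (q ⊗ (dil25 (pentSum J) ⊕ (dil25 a₁ ⊕ dil25 a₂)))
      ≈⟨ S.-‿cong (S.*-congˡ (S.trans (dil25-⊕ (pentSum J) (pentTerm (suc J))) (S.+-congˡ {x = dil25 (pentSum J)} (S.trans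
          (dil-cong 5 (dil-cong 5 (S.distribˡ (const c) (q ↑ pent⁻ (suc J)) (q ↑ pent⁺ (suc J))))) (dil25-⊕ a₁ a₂))))) ⟨
    ⊖ (q ⊗ dil25 (pentSum (suc J))) ∎
    where
    e₁ = 1 + 5 * (5 * pent⁻ (suc J))
    e₂ = 1 + 5 * (5 * pent⁺ (suc J))
    a₁ = const c ⊗ q ↑ pent⁻ (suc J)
    a₂ = const c ⊗ q ↑ pent⁺ (suc J)

f₅ f₂₅ E₀ E₁ E₂ : Series
f₅ = dil 5 f
f₂₅ = dil 5 f₅
E₀ = proj 0 f
E₁ = ⊖ (q ⊗ f₂₅)
E₂ = proj 2 f

onClass-E₁ : OnClass 1 E₁
onClass-E₁ = onClass-⊖ {1} {q ⊗ f₂₅} (onClass-⊗ {1} {0} {q} {f₂₅} (onClass-≈ (S.*-identityʳ q) (onClass-q^ 1)) (onClass-dil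
    f₅))

-- In classes 0 and 2 this is the definition of `E₀` and `E₂`. The content lies in the other
-- classes, where the finite dissection with J = n already determines the coefficient of qⁿ.
f-dissection : f ≈ E₀ ⊕ E₁ ⊕ E₂
f-dissection = mk≈ go
  where
  go : ∀ n → f n ≡ (E₀ ⊕ E₁ ⊕ E₂) n
  go n with pentSum-dissection n
  ... | x′ , z′ , x′∈ , z′∈ , e = by-class (n % 5 ℕ.≟ 0) (n % 5 ℕ.≟ 2)
    where
    y′ = ⊖ (q ⊗ dil25 (pentSum n))
    f≈ : f n ≡ x′ n ℤ.+ y′ n ℤ.+ z′ n
    f≈ = trans (agree (pentagonal (2 + n * 5)) n (ℕ.m≤n⇒m≤o+n 2 (ℕ.m≤m*n n 5))) (at e n)
    y≡ : y′ n ≡ E₁ n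
    y≡ = sym (agree (⊖-cong[] (⊗-cong[] (≈[].refl {x = q}) (dil-cong[] 5 (dil-cong[] 5 (pentagonal n))))) n ℕ.≤-refl)
    sum₃ : ∀ {a b c a′ b′ c′ : ℤ} → a ≡ a′ → b ≡ b′ → c ≡ c′ → a ℤ.+ b ℤ.+ c ≡ a′ ℤ.+ b′ ℤ.+ c′
    sum₃ refl refl refl = refl
    by-class : Dec (n % 5 ≡ 0) → Dec (n % 5 ≡ 2) → f n ≡ E₀ n ℤ.+ E₁ n ℤ.+ E₂ n
    by-class (yes e) _ = sym (trans (sum₃ (proj-hit {n = n} f e) (vanish onClass-E₁ n (λ h → 0≢1 (trans (sym e) h)))
        (proj-miss {n = n} f λ h → 0≢2 (trans (sym e) h)))
      (trans (ℤ.+-identityʳ _) (ℤ.+-identityʳ (f n))))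
      where
      0≢1 : 0 ≢ 1
      0≢1 ()
      0≢2 : 0 ≢ 2
      0≢2 ()
    by-class (no h) (yes e) = sym (trans (sum₃ (proj-miss {n = n} f h) (vanish onClass-E₁ n (λ h → 2≢1 (trans (sym e) h)))
        (proj-hit {n = n} f e))
      (ℤ.+-identityˡ (f n)))
      where
      2≢1 : 2 ≢ 1
      2≢1 ()
    by-class (no h₀) (no h₂) = trans f≈ (trans (sum₃ (vanish x′∈ n h₀) y≡ (vanish z′∈ n h₂)) (sym (sum₃ (proj-miss {n = n}
        f h₀) (refl {x = E₁ n}) (proj-miss {n = n} f h₂))))

-- Jacobi's identity for f³

-- gauss m j is the Gaussian binomial coefficient "m + j choose m".
gauss : ℕ → ℕ → Series
gauss zero    j       = 1s
gauss (suc m) zero    = 1s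
gauss (suc m) (suc j) = gauss m (suc j) ⊕ q ↑ suc m ⊗ gauss (suc m) j

-- Pascal's rule yields the product formula with denominators cleared, via (1 - a) + a(1 - b) = 1 -
-- ab.
gauss-g : ∀ m j → gauss m j ⊗ (g m ⊗ g j) ≈ g (m + j)
gauss-g zero    j    = solve 1 (λ x → con 1ℤ :* (con 1ℤ :* x) := x) S.refl (g j)
gauss-g (suc m) zero rewrite ℕ.+-identityʳ m = solve 1 (λ x → con 1ℤ :* (x :* con 1ℤ) := x) S.refl (g (suc m))
gauss-g (suc m) (suc j) = begin
  (gauss m (suc j) ⊕ a ⊗ gauss (suc m) j) ⊗ ((1-q^ (suc m) ⊗ g m) ⊗ (1-q^ (suc j) ⊗ g j))
    ≈⟨ solve 6 (λ u v a b x w → (u :+ a :* v) :* (((con 1ℤ :+ :- a) :* x) :* ((con 1ℤ :+ :- b) :* w)) :=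
         (con 1ℤ :+ :- a) :* (u :* (x :* ((con 1ℤ :+ :- b) :* w))) :+ a :* (con 1ℤ :+ :- b) :* (v :* (((con 1ℤ :+ :- a) :*
             x) :* w))) S.refl
         (gauss m (suc j)) (gauss (suc m) j) a b (g m) (g j) ⟩
  1-q^ (suc m) ⊗ (gauss m (suc j) ⊗ (g m ⊗ g (suc j))) ⊕ a ⊗ 1-q^ (suc j) ⊗ (gauss (suc m) j ⊗ (g (suc m) ⊗ g j))
    ≈⟨ S.+-cong (S.*-congˡ (gauss-g m (suc j))) (S.*-congˡ (gauss-g (suc m) j)) ⟩
  1-q^ (suc m) ⊗ g (m + suc j) ⊕ a ⊗ 1-q^ (suc j) ⊗ g (suc m + j)
    ≈⟨ S.+-congˡ {x = 1-q^ (suc m) ⊗ g (m + suc j)} (S.*-congˡ (S.reflexive (cong g (sym (ℕ.+-suc m j))))) ⟩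
  1-q^ (suc m) ⊗ g (m + suc j) ⊕ a ⊗ 1-q^ (suc j) ⊗ g (m + suc j)
    ≈⟨ solve 3 (λ a b s → (con 1ℤ :+ :- a) :* s :+ a :* (con 1ℤ :+ :- b) :* s := (con 1ℤ :+ :- (a :* b)) :* s) S.refl a b
        (g (m + suc j)) ⟩
  (1s ⊕ ⊖ (a ⊗ b)) ⊗ g (m + suc j)
    ≈⟨ S.*-congʳ (S.+-congˡ {x = 1s} (S.-‿cong (S.sym (^-homo-* q (suc m) (suc j))))) ⟩
  g (suc m + suc j) ∎
  where
  open ≈-Reasoning
  a = q ↑ suc m
  b = q ↑ suc j

g-0 : ∀ m → g m 0 ≡ 1ℤ
g-0 zero    = refl
g-0 (suc m) = trans (cong (λ t → 1ℤ ℤ.* t) (g-0 m)) refl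

gauss-sym : ∀ m j → gauss m j ≈ gauss j m
gauss-sym m j = ⊗-cancelˡ (g m ⊗ g j) (cong₂ ℤ._*_ (g-0 m) (g-0 j)) (begin
  g m ⊗ g j ⊗ gauss m j    ≈⟨ S.*-comm (g m ⊗ g j) (gauss m j) ⟩
  gauss m j ⊗ (g m ⊗ g j)  ≈⟨ gauss-g m j ⟩
  g (m + j)              ≈⟨ S.reflexive (cong g (ℕ.+-comm m j)) ⟩
  g (j + m)              ≈⟨ gauss-g j m ⟨
  gauss j m ⊗ (g j ⊗ g m)  ≈⟨ solve 3 (λ a x w → a :* (w :* x) := x :* w :* a) S.refl (gauss j m) (g m) (g j) ⟩
  g m ⊗ g j ⊗ gauss j m    ∎)
  where open ≈-Reasoning

gauss-pascal : ∀ m j → gauss (suc m) (suc j) ≈ gauss (suc m) j ⊕ q ↑ suc j ⊗ gauss m (suc j)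
gauss-pascal m j = S.trans (gauss-sym (suc m) (suc j)) (S.+-cong (gauss-sym j (suc m)) (S.*-congˡ (gauss-sym (suc j) m)))

-- "m + j − 1 choose m − 1"
gauss⁻ : ℕ → ℕ → Series
gauss⁻ zero    j = 0s
gauss⁻ (suc m) j = gauss m j

-- Both forms of Pascal's rule combined lower the upper index of the binomial by 2, as needed to
-- pass from "2n + 3 choose n + 1 - k" to "2n + 1 choose n - j" with j = k + 1, k, k - 1.
gauss-three-term : ∀ m j → gauss (suc m) (suc (suc j)) ≈
  q ↑ suc (suc j) ⊗ gauss⁻ m (suc (suc j)) ⊕ (1s ⊕ q ↑ suc m ⊗ q ↑ suc j) ⊗ gauss m (suc j) ⊕ q ↑ suc m ⊗ gauss (suc m) j
gauss-three-term m j = S.trans (S.+-cong (first m) (S.*-congˡ (gauss-pascal m j)))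
  (solve 6 (λ u A x a b w → x :+ A :* u :+ a :* (w :+ b :* x) := A :* u :+ (con 1ℤ :+ a :* b) :* x :+ a :* w) S.refl
    (gauss⁻ m (suc (suc j))) (q ↑ suc (suc j)) (gauss m (suc j)) (q ↑ suc m) (q ↑ suc j) (gauss (suc m) j))
  where
  first : ∀ m → gauss m (suc (suc j)) ≈ gauss m (suc j) ⊕ q ↑ suc (suc j) ⊗ gauss⁻ m (suc (suc j))
  first zero    = solve 1 (λ A → con 1ℤ := con 1ℤ :+ A :* con 0ℤ) S.refl (q ↑ suc (suc j))
  first (suc m) = gauss-pascal m (suc j)

-- The numbers (−1)ᵏ (2k + 1).
coef : ℕ → ℤ
coef 0             = + 1
coef 1             = -[1+ 2 ]
coef (suc (suc k)) = ℤ.- (coef k ℤ.+ + 2 ℤ.* coef (suc k))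

const-coef : ∀ k → const (coef (suc (suc k))) ≈ ⊖ (const (coef k) ⊕ const (+ 2) ⊗ const (coef (suc k)))
const-coef k = mk≈ λ n → trans (at (const-⊖ (coef k ℤ.+ + 2 ℤ.* coef (suc k))) n) (cong ℤ.-_ (lem n))
  where
  lem : ∀ n → const (coef k ℤ.+ + 2 ℤ.* coef (suc k)) n ≡ const (coef k) n ℤ.+ (const (+ 2) ⊗ const (coef (suc k))) n
  lem zero    = refl
  lem (suc n) = sym (trans (ℤ.+-identityˡ _) (const-⊗ (+ 2) (const (coef (suc k))) (suc n)))

-- The binomial is "2n + 1 choose n - k". Summed over k ≤ n, these terms form a finite version of
-- Jacobi's identity: multiplied by f, they tend to the terms for f³.
jacobiTerm : ℕ → ℕ → Series
jacobiTerm n k = const (coef k) ⊗ q ↑ tri k ⊗ gauss (n ∸ k) (suc (n + k))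

jacobiSum : ℕ → ℕ → Series
jacobiSum n zero    = 0s
jacobiSum n (suc m) = jacobiSum n m ⊕ jacobiTerm n m

jacobiTerm-≡ : ∀ k d {n} → n ≡ k + d → jacobiTerm n k ≈ const (coef k) ⊗ q ↑ tri k ⊗ gauss d (suc (n + k))
jacobiTerm-≡ k d refl rewrite ℕ.m+n∸m≡n k d = S.refl

jacobiTerm-suc : ∀ k d {n} → n ≡ k + d → jacobiTerm (suc n) k ≈ const (coef k) ⊗ q ↑ tri k ⊗
  (q ↑ suc (suc (n + k)) ⊗ gauss⁻ d (suc (suc (n + k))) ⊕ (1s ⊕ q ↑ suc n ⊗ q ↑ suc n) ⊗ gauss d (suc (n + k)) ⊕ q ↑ suc d
      ⊗ gauss (suc d) (n + k))
jacobiTerm-suc k d {n} e = S.trans (jacobiTerm-≡ k (suc d) (trans (cong suc e) (sym (ℕ.+-suc k d))))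
  (S.*-congˡ (S.trans (gauss-three-term d (n + k)) (S.+-congʳ (S.+-congˡ {x = q ↑ suc (suc (n + k)) ⊗ gauss⁻ d (suc (suc (n
      + k)))}
     (S.*-congʳ (S.+-congˡ {x = 1s} powers))))))
  where
  powers : q ↑ suc d ⊗ q ↑ suc (n + k) ≈ q ↑ suc n ⊗ q ↑ suc n
  powers = S.trans (S.sym (^-homo-* q (suc d) (suc (n + k)))) (S.trans (q^-≡ (trans (lem d n k) (cong (λ t → suc n + suc t)
      (sym e)))) (^-homo-* q (suc n) (suc n)))
    where
    lem : ∀ d n k → suc d + suc (n + k) ≡ suc n + suc (k + d)
    lem = ℕ-Solver.solve-∀

-- Recombining the three-term relation over k gives the factor (1 − qⁿ⁺¹)² up to boundary terms,
-- because c(k − 1) + 2 c(k) + c(k + 1) = 0 for the coefficients c(k) = (−1)ᵏ (2k + 1).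
jacobiSum-step : ∀ k d {n} → n ≡ k + d → jacobiSum (suc n) (suc k) ≈
  1-q^ (suc n) ⊗ 1-q^ (suc n) ⊗ jacobiSum n (suc k)
  ⊕ const (coef k) ⊗ q ↑ tri k ⊗ q ↑ suc (suc (n + k)) ⊗ gauss⁻ d (suc (suc (n + k)))
  ⊕ ⊖ (const (coef (suc k)) ⊗ q ↑ (tri (suc k) + d) ⊗ gauss d (suc (n + k)))
jacobiSum-step zero d {n} refl = S.trans (S.+-congˡ {x = 0s} (S.trans (jacobiTerm-suc 0 d refl) (S.*-congˡ (S.+-congˡ {x =
    w} last))))
  (S.trans (solve 4 (λ A u a x → con 0ℤ :+ con 1ℤ :* con 1ℤ :* (A :* u :+ (con 1ℤ :+ a :* a) :* x :+ a :* x) :=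
     (con 1ℤ :+ :- a) :* (con 1ℤ :+ :- a) :* (con 0ℤ :+ con 1ℤ :* con 1ℤ :* x) :+ con 1ℤ :* con 1ℤ :* A :* u :+ :- (con
         -[1+ 2 ] :* a :* x)) S.refl
     (q ↑ suc (suc (n + 0))) (gauss⁻ d (suc (suc (n + 0)))) (q ↑ suc n) (gauss d (suc (n + 0)))) S.refl)
  where
  w = q ↑ suc (suc (n + 0)) ⊗ gauss⁻ d (suc (suc (n + 0))) ⊕ (1s ⊕ q ↑ suc n ⊗ q ↑ suc n) ⊗ gauss d (suc (n + 0))
  last : q ↑ suc d ⊗ gauss (suc d) (n + 0) ≈ q ↑ suc n ⊗ gauss d (suc (n + 0))
  last rewrite ℕ.+-identityʳ n = S.*-congˡ (gauss-sym (suc n) n)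
jacobiSum-step (suc k) d {n} e = begin
  jacobiSum (suc n) (suc k) ⊕ jacobiTerm (suc n) K
    ≈⟨ S.+-cong (jacobiSum-step k (suc d) (trans e (sym (ℕ.+-suc k d)))) (jacobiTerm-suc K d e) ⟩
  1-q^ (suc n) ⊗ 1-q^ (suc n) ⊗ S ⊕ const (coef k) ⊗ q ↑ tri k ⊗ q ↑ suc (suc (n + k)) ⊗ gauss d (suc (suc (n + k)))
    ⊕ ⊖ (C ⊗ q ↑ (tri K + suc d) ⊗ gauss (suc d) (suc (n + k)))
    ⊕ C ⊗ q ↑ tri K ⊗ (q ↑ suc (suc (n + K)) ⊗ gauss⁻ d (suc (suc (n + K))) ⊕ (1s ⊕ a ⊗ a) ⊗ gauss d (suc (n + K)) ⊕ q ↑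
        suc d ⊗ gauss (suc d) (n + K))
    ≈⟨ S.+-congʳ (S.+-cong (S.+-congˡ {x = 1-q^ (suc n) ⊗ 1-q^ (suc n) ⊗ S} (S.*-cong powers₁ (S.reflexive (cong (λ t →
        gauss d (suc t)) (sym (ℕ.+-suc n k))))))
         (S.-‿cong (S.*-cong (S.*-congˡ (^-homo-* q (tri K) (suc d))) (S.reflexive (cong (gauss (suc d)) (sym (ℕ.+-suc n
             k))))))) ⟩
  1-q^ (suc n) ⊗ 1-q^ (suc n) ⊗ S ⊕ const (coef k) ⊗ (b ⊗ a) ⊗ v
    ⊕ ⊖ (C ⊗ (b ⊗ q ↑ suc d) ⊗ gauss (suc d) (n + K))
    ⊕ C ⊗ b ⊗ (A ⊗ u ⊕ (1s ⊕ a ⊗ a) ⊗ v ⊕ q ↑ suc d ⊗ gauss (suc d) (n + K))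
    ≈⟨ solve 10 (λ S x a b v C e r A u →
         (con 1ℤ :+ :- a) :* (con 1ℤ :+ :- a) :* S :+ x :* (b :* a) :* v :+ :- (C :* (b :* e) :* r)
           :+ C :* b :* (A :* u :+ (con 1ℤ :+ a :* a) :* v :+ e :* r) :=
         (con 1ℤ :+ :- a) :* (con 1ℤ :+ :- a) :* (S :+ C :* b :* v) :+ C :* b :* A :* u
           :+ :- (:- (x :+ con (+ 2) :* C) :* (b :* a) :* v)) S.refl
         S (const (coef k)) a b v C (q ↑ suc d) (gauss (suc d) (n + K)) A u ⟩
  1-q^ (suc n) ⊗ 1-q^ (suc n) ⊗ (S ⊕ C ⊗ b ⊗ v) ⊕ C ⊗ b ⊗ A ⊗ u ⊕ ⊖ (⊖ (const (coef k) ⊕ const (+ 2) ⊗ C) ⊗ (b ⊗ a) ⊗ v)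
    ≈⟨ S.+-cong (S.+-congʳ (S.*-congˡ (S.+-congˡ {x = S} (S.sym (jacobiTerm-≡ K d e)))))
         (S.-‿cong (S.*-congʳ (S.*-cong (S.sym (const-coef k)) (S.sym powers₂)))) ⟩
  1-q^ (suc n) ⊗ 1-q^ (suc n) ⊗ jacobiSum n (suc K) ⊕ C ⊗ b ⊗ A ⊗ u ⊕ ⊖ (const (coef (suc K)) ⊗ q ↑ (tri (suc K) + d) ⊗ v) ∎
  where
  open ≈-Reasoning
  K = suc k
  S = jacobiSum n K
  C = const (coef K)
  a = q ↑ suc n
  b = q ↑ tri K
  v = gauss d (suc (n + K))
  A = q ↑ suc (suc (n + K))
  u = gauss⁻ d (suc (suc (n + K)))
  powers₁ : const (coef k) ⊗ q ↑ tri k ⊗ q ↑ suc (suc (n + k)) ≈ const (coef k) ⊗ (b ⊗ a)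
  powers₁ = S.trans (S.*-assoc (const (coef k)) (q ↑ tri k) (q ↑ suc (suc (n + k)))) (S.*-congˡ
    (S.trans (S.sym (^-homo-* q (tri k) (suc (suc (n + k))))) (S.trans (q^-≡ (lem (tri k) n k)) (^-homo-* q (tri K) (suc
        n)))))
    where
    lem : ∀ t n k → t + suc (suc (n + k)) ≡ suc k + t + suc n
    lem = ℕ-Solver.solve-∀
  powers₂ : q ↑ (tri (suc K) + d) ≈ b ⊗ a
  powers₂ = S.trans (q^-≡ (trans (lem (tri K) k d) (cong (λ t → tri K + suc t) (sym e)))) (^-homo-* q (tri K) (suc n))
    where
    lem : ∀ t k d → suc (suc k) + t + d ≡ t + suc (suc k + d)
    lem = ℕ-Solver.solve-∀

-- At k = n the first boundary term has the factor `gauss⁻ 0`, which is zero, and the second cancels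
-- the new term k = n + 1. Only the factor (1 - qⁿ⁺¹)² remains.
jacobi-finite : ∀ n → jacobiSum n (suc n) ≈ g n ⊗ g n
jacobi-finite zero    = solve 0 (con 0ℤ :+ con 1ℤ :* con 1ℤ :* con 1ℤ := con 1ℤ :* con 1ℤ) S.refl
jacobi-finite (suc n) = begin
  jacobiSum (suc n) (suc n) ⊕ jacobiTerm (suc n) (suc n)
    ≈⟨ S.+-cong (jacobiSum-step n 0 (sym (ℕ.+-identityʳ n))) (jacobiTerm-≡ (suc n) 0 (cong suc (sym (ℕ.+-identityʳ n)))) ⟩
  1-q^ (suc n) ⊗ 1-q^ (suc n) ⊗ jacobiSum n (suc n) ⊕ const (coef n) ⊗ q ↑ tri n ⊗ q ↑ suc (suc (n + n)) ⊗ 0s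
    ⊕ ⊖ (C ⊗ q ↑ (tri (suc n) + 0) ⊗ 1s) ⊕ C ⊗ q ↑ tri (suc n) ⊗ 1s
    ≈⟨ S.+-congʳ (S.+-congˡ {x = 1-q^ (suc n) ⊗ 1-q^ (suc n) ⊗ jacobiSum n (suc n) ⊕ const (coef n) ⊗ q ↑ tri n ⊗ q ↑ suc
        (suc (n + n)) ⊗ 0s}
        (S.-‿cong (S.*-congʳ (S.*-congˡ {x = C} (q^-≡ (ℕ.+-identityʳ (tri (suc n)))))))) ⟩
  1-q^ (suc n) ⊗ 1-q^ (suc n) ⊗ jacobiSum n (suc n) ⊕ const (coef n) ⊗ q ↑ tri n ⊗ q ↑ suc (suc (n + n)) ⊗ 0s
    ⊕ ⊖ (C ⊗ q ↑ tri (suc n) ⊗ 1s) ⊕ C ⊗ q ↑ tri (suc n) ⊗ 1s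
    ≈⟨ solve 4 (λ p S x w → p :* p :* S :+ x :* con 0ℤ :+ :- (w :* con 1ℤ) :+ w :* con 1ℤ := p :* p :* S) S.refl
         (1-q^ (suc n)) (jacobiSum n (suc n)) (const (coef n) ⊗ q ↑ tri n ⊗ q ↑ suc (suc (n + n))) (C ⊗ q ↑ tri (suc n)) ⟩
  1-q^ (suc n) ⊗ 1-q^ (suc n) ⊗ jacobiSum n (suc n)
    ≈⟨ S.*-congˡ (jacobi-finite n) ⟩
  1-q^ (suc n) ⊗ 1-q^ (suc n) ⊗ (g n ⊗ g n)
    ≈⟨ solve 2 (λ p x → p :* p :* (x :* x) := p :* x :* (p :* x)) S.refl (1-q^ (suc n)) (g n) ⟩
  g (suc n) ⊗ g (suc n) ∎
  where
  open ≈-Reasoning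
  C = const (coef (suc n))

f-0 : f 0 ≡ 1ℤ
f-0 = refl

-- Gaussian binomials tend to 1/f: as m ≤ j, each of `g m`, `g j` and `g (m + j)` agrees with f up
-- to qᵐ.
gauss-≈[] : ∀ m j → m ≤ j → gauss m j ⊗ f ≈[ m ] 1s
gauss-≈[] m j m≤j = ⊗-cancelˡ[] f f-0 (begin
  f ⊗ (gauss m j ⊗ f)       ≈⟨ ≈⇒≈[] (solve 2 (λ f x → f :* (x :* f) := x :* (f :* f)) S.refl f (gauss m j)) ⟩
  gauss m j ⊗ (f ⊗ f)       ≈⟨ ⊗-cong[] (≈[].refl {x = gauss m j}) (⊗-cong[] (f-≈[] m) (≈[]-weaken m≤j (f-≈[] j))) ⟩
  gauss m j ⊗ (g m ⊗ g j)   ≈⟨ ≈⇒≈[] (gauss-g m j) ⟩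
  g (m + j)               ≈⟨ ≈[]-weaken (ℕ.m≤m+n m j) (f-≈[] (m + j)) ⟨
  f                         ≈⟨ ≈⇒≈[] (S.*-identityʳ f) ⟨
  f ⊗ 1s                    ∎)
  where open ≈[]-Reasoning m

cubeSum : ℕ → Series
cubeSum zero    = 0s
cubeSum (suc m) = cubeSum m ⊕ const (coef m) ⊗ q ↑ tri m

k≤tri : ∀ k → k ≤ tri k
k≤tri zero    = z≤n
k≤tri (suc k) = ℕ.m≤m+n (suc k) (tri k)

-- The binomial of the term m approximates 1/f only up to q^(n - m). The factor q^(tri m) supplies
-- the missing m degrees, since m ≤ tri m.
jacobiSum-≈[] : ∀ n m → m ≤ suc n → jacobiSum n m ⊗ f ≈[ n ] cubeSum m
jacobiSum-≈[] n zero    _          = ≈⇒≈[] (S.zeroˡ f)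
jacobiSum-≈[] n (suc m) (s≤s m≤n) with ℕ.m≤n⇒∃[o]m+o≡n m≤n
... | d , refl = begin
  (jacobiSum n m ⊕ jacobiTerm n m) ⊗ f
    ≈⟨ ≈⇒≈[] (S.trans (S.distribʳ f (jacobiSum n m) (jacobiTerm n m)) (S.+-congˡ {x = jacobiSum n m ⊗ f} (S.trans
        (S.*-congʳ (jacobiTerm-≡ m d refl))
         (solve 4 (λ C b v f → C :* b :* v :* f := C :* (b :* (v :* f))) S.refl (const (coef m)) (q ↑ tri m) (gauss d (suc
             (n + m))) f)))) ⟩
  jacobiSum n m ⊗ f ⊕ const (coef m) ⊗ (q ↑ tri m ⊗ (gauss d (suc (n + m)) ⊗ f))
    ≈⟨ ⊕-cong[] (jacobiSum-≈[] n m (ℕ.m≤n⇒m≤1+n m≤n)) (⊗-cong[] (≈[].refl {x = const (coef m)})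
         (≈[]-weaken (ℕ.+-monoˡ-≤ d (k≤tri m)) (q^-shift (tri m) (gauss-≈[] d (suc (n + m)) d≤)))) ⟩
  cubeSum m ⊕ const (coef m) ⊗ (q ↑ tri m ⊗ 1s)
    ≈⟨ ≈⇒≈[] (S.+-congˡ {x = cubeSum m} (S.*-congˡ {x = const (coef m)} (S.*-identityʳ (q ↑ tri m)))) ⟩
  cubeSum m ⊕ const (coef m) ⊗ q ↑ tri m ∎
  where
  open ≈[]-Reasoning n
  d≤ : d ≤ suc (m + d + m)
  d≤ = ℕ.m≤n⇒m≤1+n (ℕ.≤-trans (ℕ.m≤n+m d m) (ℕ.m≤m+n (m + d) m))

jacobi : ∀ n → f ↑ 3 ≈[ n ] cubeSum (suc n)
jacobi n = begin
  f ↑ 3                        ≈⟨ ≈⇒≈[] (solve 1 (λ f → f :^ 3 := f :* f :* f) S.refl f) ⟩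
  f ⊗ f ⊗ f                    ≈⟨ ⊗-cong[] (⊗-cong[] (f-≈[] n) (f-≈[] n)) (≈[].refl {x = f}) ⟩
  g n ⊗ g n ⊗ f                ≈⟨ ≈⇒≈[] (S.*-congʳ (jacobi-finite n)) ⟨
  jacobiSum n (suc n) ⊗ f      ≈⟨ jacobiSum-≈[] n (suc n) ℕ.≤-refl ⟩
  cubeSum (suc n)              ∎
  where open ≈[]-Reasoning n

tri-mod : ∀ k → tri k % 5 ≢ 2
tri-mod 0 ()
tri-mod 1 ()
tri-mod 2 ()
tri-mod 3 ()
tri-mod 4 ()
tri-mod (suc (suc (suc (suc (suc k))))) e = tri-mod k (trans (sym (trans (cong (_% 5) (lem (tri k) k)) ([m+kn]%n≡m%n (tri
    k) (3 + k) 5))) e)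
  where
  lem : ∀ t k → 5 + k + (4 + k + (3 + k + (2 + k + (1 + k + t)))) ≡ t + (3 + k) * 5
  lem = ℕ-Solver.solve-∀

f³-vanish : ∀ n → n % 5 ≡ 2 → (f ↑ 3) n ≡ 0ℤ
f³-vanish n n≡2 = trans (agree (jacobi n) n ℕ.≤-refl) (go (suc n))
  where
  go : ∀ m → cubeSum m n ≡ 0ℤ
  go zero    = 0s-at n
  go (suc m) = cong₂ ℤ._+_ (go m) (trans (const-⊗ (coef m) (q ↑ tri m) n)
    (trans (cong (λ t → coef m ℤ.* t) (q^-off (tri m) n λ { refl → tri-mod m n≡2 })) (ℤ.*-zeroʳ (coef m))))

-- The quintic equation of f over the series in q⁵

const-cancel : ∀ k a → const (+ suc k) ⊗ a ≈ 0s → a ≈ 0s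
const-cancel k a e = mk≈ λ n → trans (zero-at n) (sym (0s-at n))
  where
  zero-at : ∀ n → a n ≡ 0ℤ
  zero-at n with ℤ.i*j≡0⇒i≡0∨j≡0 (+ suc k) (trans (sym (const-⊗ (+ suc k) a n)) (trans (at e n) (0s-at n)))
  ... | inj₂ a≡0 = a≡0

by-classes : ∀ a → a ≈ proj 0 a ⊕ proj 1 a ⊕ proj 2 a ⊕ proj 3 a ⊕ proj 4 a
by-classes a = mk≈ λ n → go n (n % 5) refl (m%n<n n 5)
  where
  go : ∀ n r → n % 5 ≡ r → r < 5 → a n ≡ proj 0 a n ℤ.+ proj 1 a n ℤ.+ proj 2 a n ℤ.+ proj 3 a n ℤ.+ proj 4 a n
  go n 0 e _ rewrite e = sym (trans (ℤ.+-identityʳ _) (trans (ℤ.+-identityʳ _) (trans (ℤ.+-identityʳ _) (ℤ.+-identityʳ (a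
      n)))))
  go n 1 e _ rewrite e = sym (trans (ℤ.+-identityʳ _) (trans (ℤ.+-identityʳ _) (trans (ℤ.+-identityʳ _) (ℤ.+-identityˡ (a
      n)))))
  go n 2 e _ rewrite e = sym (trans (ℤ.+-identityʳ _) (trans (ℤ.+-identityʳ _) (ℤ.+-identityˡ (a n))))
  go n 3 e _ rewrite e = sym (trans (ℤ.+-identityʳ _) (ℤ.+-identityˡ (a n)))
  go n 4 e _ rewrite e = sym (ℤ.+-identityˡ (a n))
  go n (suc (suc (suc (suc (suc r))))) e (s≤s (s≤s (s≤s (s≤s (s≤s ())))))

%-absorb : ∀ i m → (i + m % 5) % 5 ≡ (i + m) % 5
%-absorb i m = trans (%-distribˡ-+ i (m % 5) 5) (trans (cong (λ t → (i % 5 + t) % 5) (m%n%n≡m%n m 5)) (sym (%-distribˡ-+ i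
    m 5)))

-- The class r - i is written r + 4i to stay in ℕ; the offsets 4, 8, 12, 16 below are the shifts by
-- -1, -2, -3, -4.
proj-class-⊗ : ∀ r i {a} b → r < 5 → OnClass i a → proj r (a ⊗ b) ≈ a ⊗ proj ((r + 4 * i) % 5) b
proj-class-⊗ r i {a} b r<5 c = subst (λ t → proj t (a ⊗ b) ≈ a ⊗ proj ((r + 4 * i) % 5) b) index
  (proj-⊗ i ((r + 4 * i) % 5) b (m%n<n (r + 4 * i) 5) c)
  where
  lem : ∀ r i → i + (r + 4 * i) ≡ r + i * 5
  lem = ℕ-Solver.solve-∀
  index : (i + (r + 4 * i) % 5) % 5 ≡ r
  index = trans (%-absorb i (r + 4 * i)) (trans (cong (_% 5) (lem r i)) (trans ([m+kn]%n≡m%n r i 5) (m<n⇒m%n≡m r<5)))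

proj-cauchy : ∀ r a b → r < 5 → proj r (a ⊗ b) ≈
  proj 0 a ⊗ proj (r % 5) b ⊕ proj 1 a ⊗ proj ((r + 4) % 5) b ⊕ proj 2 a ⊗ proj ((r + 8) % 5) b
  ⊕ proj 3 a ⊗ proj ((r + 12) % 5) b ⊕ proj 4 a ⊗ proj ((r + 16) % 5) b
proj-cauchy r a b r<5 = begin
  proj r (a ⊗ b)
    ≈⟨ proj-cong r (S.trans (S.*-congʳ (by-classes a)) (solve 6 (λ s t u v w b → (s :+ t :+ u :+ v :+ w) :* b := s :* b :+
        t :* b :+ u :* b :+ v :* b :+ w :* b) S.refl
         (proj 0 a) (proj 1 a) (proj 2 a) (proj 3 a) (proj 4 a) b)) ⟩
  proj r (proj 0 a ⊗ b ⊕ proj 1 a ⊗ b ⊕ proj 2 a ⊗ b ⊕ proj 3 a ⊗ b ⊕ proj 4 a ⊗ b)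
    ≈⟨ S.trans (proj-⊕ r _ _) (S.+-congʳ (S.trans (proj-⊕ r _ _) (S.+-congʳ (S.trans (proj-⊕ r _ _) (S.+-congʳ (proj-⊕ r _
        _)))))) ⟩
  proj r (proj 0 a ⊗ b) ⊕ proj r (proj 1 a ⊗ b) ⊕ proj r (proj 2 a ⊗ b) ⊕ proj r (proj 3 a ⊗ b) ⊕ proj r (proj 4 a ⊗ b)
    ≈⟨ S.+-cong (S.+-cong (S.+-cong (S.+-cong first (part 1)) (part 2)) (part 3)) (part 4) ⟩
  _ ∎
  where
  open ≈-Reasoning
  part : ∀ i → proj r (proj i a ⊗ b) ≈ proj i a ⊗ proj ((r + 4 * i) % 5) b
  part i = proj-class-⊗ r i b r<5 (onClass-proj i a)
  first : proj r (proj 0 a ⊗ b) ≈ proj 0 a ⊗ proj (r % 5) b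
  first = subst (λ t → proj r (proj 0 a ⊗ b) ≈ proj 0 a ⊗ proj (t % 5) b) (ℕ.+-identityʳ r) (part 0)

proj-f-1 : proj 1 f ≈ E₁
proj-f-1 = begin
  proj 1 f                             ≈⟨ proj-cong 1 f-dissection ⟩
  proj 1 (E₀ ⊕ E₁ ⊕ E₂)                   ≈⟨ S.trans (proj-⊕ 1 (E₀ ⊕ E₁) E₂) (S.+-congʳ (proj-⊕ 1 E₀ E₁)) ⟩
  proj 1 E₀ ⊕ proj 1 E₁ ⊕ proj 1 E₂       ≈⟨ S.+-cong (S.+-cong (proj-other (onClass-proj 0 f) λ ()) (proj-self
      onClass-E₁)) (proj-other (onClass-proj 2 f) λ ()) ⟩
  0s ⊕ E₁ ⊕ 0s                          ≈⟨ solve 1 (λ E₁ → con 0ℤ :+ E₁ :+ con 0ℤ := E₁) S.refl E₁ ⟩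
  E₁                                    ∎
  where open ≈-Reasoning

proj-f-≥3 : ∀ r → 3 ≤ r → proj r f ≈ 0s
proj-f-≥3 r 3≤r = begin
  proj r f                             ≈⟨ proj-cong r f-dissection ⟩
  proj r (E₀ ⊕ E₁ ⊕ E₂)                   ≈⟨ S.trans (proj-⊕ r (E₀ ⊕ E₁) E₂) (S.+-congʳ (proj-⊕ r E₀ E₁)) ⟩
  proj r E₀ ⊕ proj r E₁ ⊕ proj r E₂       ≈⟨ S.+-cong (S.+-cong (proj-other (onClass-proj 0 f) (≢r (s≤s z≤n))) (proj-other
      onClass-E₁ (≢r (s≤s (s≤s z≤n))))) (proj-other (onClass-proj 2 f) (≢r ℕ.≤-refl)) ⟩
  0s ⊕ 0s ⊕ 0s                         ≈⟨ solve 0 (con 0ℤ :+ con 0ℤ :+ con 0ℤ := con 0ℤ) S.refl ⟩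
  0s                                   ∎
  where
  open ≈-Reasoning
  ≢r : ∀ {s} → s < 3 → s ≢ r
  ≢r s<3 refl = ℕ.<⇒≱ s<3 3≤r

proj-f⊗ : ∀ r a → r < 5 → proj r (f ⊗ a) ≈ E₀ ⊗ proj (r % 5) a ⊕ E₁ ⊗ proj ((r + 4) % 5) a ⊕ E₂ ⊗ proj ((r + 8) % 5) a
proj-f⊗ r a r<5 = S.trans (proj-cauchy r f a r<5) (S.trans
  (S.+-cong (S.+-cong (S.+-congʳ (S.+-congˡ {x = E₀ ⊗ proj (r % 5) a} (S.*-congʳ proj-f-1))) (S.*-congʳ (proj-f-≥3 3
      ℕ.≤-refl))) (S.*-congʳ (proj-f-≥3 4 (ℕ.m≤m+n 3 1))))
  (solve 3 (λ u v w → u :+ con 0ℤ :* v :+ con 0ℤ :* w := u) S.refl _ (proj ((r + 12) % 5) a) (proj ((r + 16) % 5) a)))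

f² = f ⊗ f

proj-f²-0 : proj 0 f² ≈ E₀ ⊗ E₀
proj-f²-0 = S.trans (proj-f⊗ 0 f (s≤s z≤n)) (S.trans (S.+-cong (S.+-congˡ {x = E₀ ⊗ E₀} (S.*-congˡ (proj-f-≥3 4 (ℕ.m≤m+n 3
    1)))) (S.*-congˡ (proj-f-≥3 3 ℕ.≤-refl)))
  (solve 3 (λ E₀ E₁ E₂ → E₀ :* E₀ :+ E₁ :* con 0ℤ :+ E₂ :* con 0ℤ := E₀ :* E₀) S.refl E₀ E₁ E₂))

proj-f²-1 : proj 1 f² ≈ const (+ 2) ⊗ E₀ ⊗ E₁
proj-f²-1 = S.trans (proj-f⊗ 1 f (s≤s (s≤s z≤n))) (S.trans (S.+-cong (S.+-congʳ (S.*-congˡ {x = E₀} proj-f-1)) (S.*-congˡ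
    (proj-f-≥3 4 (ℕ.m≤m+n 3 1))))
  (solve 3 (λ E₀ E₁ E₂ → E₀ :* E₁ :+ E₁ :* E₀ :+ E₂ :* con 0ℤ := con (+ 2) :* E₀ :* E₁) S.refl E₀ E₁ E₂))

proj-f²-2 : proj 2 f² ≈ E₁ ⊗ E₁ ⊕ const (+ 2) ⊗ (E₀ ⊗ E₂)
proj-f²-2 = S.trans (proj-f⊗ 2 f (s≤s (s≤s (s≤s z≤n)))) (S.trans (S.+-congʳ (S.+-congˡ {x = E₀ ⊗ E₂} (S.*-congˡ {x = E₁}
    proj-f-1)))
  (solve 3 (λ E₀ E₁ E₂ → E₀ :* E₂ :+ E₁ :* E₁ :+ E₂ :* E₀ := E₁ :* E₁ :+ con (+ 2) :* (E₀ :* E₂)) S.refl E₀ E₁ E₂))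

proj-f²-3 : proj 3 f² ≈ const (+ 2) ⊗ E₁ ⊗ E₂
proj-f²-3 = S.trans (proj-f⊗ 3 f (s≤s (s≤s (s≤s (s≤s z≤n))))) (S.trans (S.+-cong (S.+-congʳ (S.*-congˡ (proj-f-≥3 3
    ℕ.≤-refl))) (S.*-congˡ {x = E₂} proj-f-1))
  (solve 3 (λ E₀ E₁ E₂ → E₀ :* con 0ℤ :+ E₁ :* E₂ :+ E₂ :* E₁ := con (+ 2) :* E₁ :* E₂) S.refl E₀ E₁ E₂))

proj-f²-4 : proj 4 f² ≈ E₂ ⊗ E₂
proj-f²-4 = S.trans (proj-f⊗ 4 f (s≤s (s≤s (s≤s (s≤s (s≤s z≤n)))))) (S.trans (S.+-congʳ (S.+-cong (S.*-congˡ (proj-f-≥3 4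
    (ℕ.m≤m+n 3 1))) (S.*-congˡ (proj-f-≥3 3 ℕ.≤-refl))))
  (solve 3 (λ E₀ E₁ E₂ → E₀ :* con 0ℤ :+ E₁ :* con 0ℤ :+ E₂ :* E₂ := E₂ :* E₂) S.refl E₀ E₁ E₂))

f³≈ : f ↑ 3 ≈ f ⊗ f²
f³≈ = solve 1 (λ f → f :^ 3 := f :* (f :* f)) S.refl f

-- The class 2 part of f³ is 3E₀(E₀E₂ + E₁²), and Jacobi's identity makes it vanish. Both 3 and
-- `E₀`, whose constant coefficient is 1, can be cancelled.
E₀E₂≈-E₁² : E₀ ⊗ E₂ ≈ ⊖ (E₁ ⊗ E₁)
E₀E₂≈-E₁² = begin
  E₀ ⊗ E₂              ≈⟨ solve 2 (λ p E₁ → p := (p :+ E₁ :* E₁) :+ :- (E₁ :* E₁)) S.refl (E₀ ⊗ E₂) E₁ ⟩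
  w ⊕ ⊖ (E₁ ⊗ E₁)      ≈⟨ S.+-congʳ w≈0 ⟩
  0s ⊕ ⊖ (E₁ ⊗ E₁)     ≈⟨ S.+-identityˡ _ ⟩
  ⊖ (E₁ ⊗ E₁)          ∎
  where
  open ≈-Reasoning
  w = E₀ ⊗ E₂ ⊕ E₁ ⊗ E₁
  3xw : const (+ 3) ⊗ (E₀ ⊗ w) ≈ 0s
  3xw = begin
    const (+ 3) ⊗ (E₀ ⊗ w)
      ≈⟨ solve 3 (λ E₀ E₁ E₂ → con (+ 3) :* (E₀ :* (E₀ :* E₂ :+ E₁ :* E₁)) := E₀ :* (E₁ :* E₁ :+ con (+ 2) :* (E₀ :* E₂))
          :+ E₁ :* (con (+ 2) :* E₀ :* E₁) :+ E₂ :* (E₀ :* E₀)) S.refl E₀ E₁ E₂ ⟩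
    E₀ ⊗ (E₁ ⊗ E₁ ⊕ const (+ 2) ⊗ (E₀ ⊗ E₂)) ⊕ E₁ ⊗ (const (+ 2) ⊗ E₀ ⊗ E₁) ⊕ E₂ ⊗ (E₀ ⊗ E₀)
      ≈⟨ S.+-cong (S.+-cong (S.*-congˡ {x = E₀} proj-f²-2) (S.*-congˡ {x = E₁} proj-f²-1)) (S.*-congˡ {x = E₂} proj-f²-0) ⟨
    E₀ ⊗ proj 2 f² ⊕ E₁ ⊗ proj 1 f² ⊕ E₂ ⊗ proj 0 f²
      ≈⟨ proj-f⊗ 2 f² (s≤s (s≤s (s≤s z≤n))) ⟨
    proj 2 (f ⊗ f²)
      ≈⟨ proj-cong 2 f³≈ ⟨
    proj 2 (f ↑ 3)
      ≈⟨ proj-unique (λ n e → trans (f³-vanish n e) (sym (0s-at n))) (onClass λ n _ → 0s-at n) ⟩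
    0s ∎
  w≈0 : w ≈ 0s
  w≈0 = ⊗-cancelˡ E₀ refl (S.trans (const-cancel 2 (E₀ ⊗ w) 3xw) (S.sym (S.zeroʳ E₀)))

-- The norm Π f(ζq) over the fifth roots of unity ζ, simplified by E₀E₂ = −E₁².
𝒩 : Series
𝒩 = E₀ ↑ 5 ⊕ const (+ 11) ⊗ E₁ ↑ 5 ⊕ E₂ ↑ 5

onClass-𝒩 : OnClass 0 𝒩
onClass-𝒩 = onClass-⊕ (onClass-⊕ (pow (onClass-proj 0 f)) (onClass-⊗ (onClass-const (+ 11)) (pow onClass-E₁))) (pow
    (onClass-proj 2 f))
  where
  pow : ∀ {r a} → OnClass r a → OnClass ((r + (r + (r + (r + (r + 0) % 5) % 5) % 5) % 5) % 5) (a ↑ 5)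
  pow c = onClass-⊗ c (onClass-⊗ c (onClass-⊗ c (onClass-⊗ c (onClass-⊗ c (onClass-const 1ℤ)))))

-- The equation satisfied by all five conjugates f(ζq).
quintic : f ↑ 5 ≈ const (+ 5) ⊗ (E₁ ⊗ f ↑ 4) ⊕ const (ℤ.- + 15) ⊗ (E₁ ↑ 2 ⊗ f ↑ 3) ⊕ const (+ 25) ⊗ (E₁ ↑ 3 ⊗ f ↑ 2) ⊕
    const (ℤ.- + 25) ⊗ (E₁ ↑ 4 ⊗ f ↑ 1) ⊕ 𝒩
quintic = begin
  f ↑ 5
    -- With s = E₀ + E₂ = f - E₁ and E₀E₂ = -E₁², the power sum formula reads E₀⁵ + E₂⁵ = s⁵ +
    -- 5s³E₁² + 5sE₁⁴. Expanding it in f produces the constants 5, -15, 25, -25.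
    ≈⟨ solve 2 (λ f E₁ → f :^ 5 := con (+ 5) :* (E₁ :* f :^ 4) :+ con (ℤ.- + 15) :* (E₁ :^ 2 :* f :^ 3) :+ con (+ 25) :*
        (E₁ :^ 3 :* f :^ 2) :+ con (ℤ.- + 25) :* (E₁ :^ 4 :* f :^ 1)
         :+ ((f :- E₁) :^ 5 :+ con (+ 5) :* (f :- E₁) :^ 3 :* E₁ :^ 2 :+ con (+ 5) :* (f :- E₁) :* E₁ :^ 4 :+ con (+ 11) :*
             E₁ :^ 5)) S.refl f E₁ ⟩
  R ⊕ (s ↑ 5 ⊕ const (+ 5) ⊗ s ↑ 3 ⊗ E₁ ↑ 2 ⊕ const (+ 5) ⊗ s ⊗ E₁ ↑ 4 ⊕ const (+ 11) ⊗ E₁ ↑ 5)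
    ≈⟨ S.+-congˡ {x = R} (poly s≈) ⟩
  R ⊕ ((E₀ ⊕ E₂) ↑ 5 ⊕ const (+ 5) ⊗ (E₀ ⊕ E₂) ↑ 3 ⊗ E₁ ↑ 2 ⊕ const (+ 5) ⊗ (E₀ ⊕ E₂) ⊗ E₁ ↑ 4 ⊕ const (+ 11) ⊗ E₁ ↑ 5)
    ≈⟨ S.+-congˡ {x = R} (solve 3 (λ E₀ E₁ E₂ → (E₀ :+ E₂) :^ 5 :+ con (+ 5) :* (E₀ :+ E₂) :^ 3 :* E₁ :^ 2 :+ con (+ 5) :*
        (E₀ :+ E₂) :* E₁ :^ 4 :+ con (+ 11) :* E₁ :^ 5 :=
         E₀ :^ 5 :+ con (+ 11) :* E₁ :^ 5 :+ E₂ :^ 5 :+ (E₀ :* E₂ :+ E₁ :* E₁) :* (con (+ 5) :* (E₀ :+ E₂) :^ 3 :+ con (+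
             5) :* (E₀ :+ E₂) :* (E₁ :* E₁ :- E₀ :* E₂))) S.refl E₀ E₁ E₂) ⟩
  R ⊕ (𝒩 ⊕ (E₀ ⊗ E₂ ⊕ E₁ ⊗ E₁) ⊗ W)
    ≈⟨ S.+-congˡ {x = R} (S.+-congˡ {x = 𝒩} (S.*-congʳ {x = W} (S.trans (S.+-congʳ E₀E₂≈-E₁²) (S.-‿inverseˡ (E₁ ⊗ E₁))))) ⟩
  R ⊕ (𝒩 ⊕ 0s ⊗ W)
    ≈⟨ solve 3 (λ R 𝒩 W → R :+ (𝒩 :+ con 0ℤ :* W) := R :+ 𝒩) S.refl R 𝒩 W ⟩
  R ⊕ 𝒩 ∎
  where
  open ≈-Reasoning
  R = const (+ 5) ⊗ (E₁ ⊗ f ↑ 4) ⊕ const (ℤ.- + 15) ⊗ (E₁ ↑ 2 ⊗ f ↑ 3) ⊕ const (+ 25) ⊗ (E₁ ↑ 3 ⊗ f ↑ 2) ⊕ const (ℤ.- + 25)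
      ⊗ (E₁ ↑ 4 ⊗ f ↑ 1)
  W = const (+ 5) ⊗ (E₀ ⊕ E₂) ↑ 3 ⊕ const (+ 5) ⊗ (E₀ ⊕ E₂) ⊗ (E₁ ⊗ E₁ ⊕ ⊖ (E₀ ⊗ E₂))
  s = f ⊕ ⊖ E₁
  s≈ : s ≈ E₀ ⊕ E₂
  s≈ = S.trans (S.+-congʳ f-dissection) (solve 3 (λ E₀ E₁ E₂ → E₀ :+ E₁ :+ E₂ :- E₁ := E₀ :+ E₂) S.refl E₀ E₁ E₂)
  poly : ∀ {s t} → s ≈ t → s ↑ 5 ⊕ const (+ 5) ⊗ s ↑ 3 ⊗ E₁ ↑ 2 ⊕ const (+ 5) ⊗ s ⊗ E₁ ↑ 4 ⊕ const (+ 11) ⊗ E₁ ↑ 5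
                        ≈ t ↑ 5 ⊕ const (+ 5) ⊗ t ↑ 3 ⊗ E₁ ↑ 2 ⊕ const (+ 5) ⊗ t ⊗ E₁ ↑ 4 ⊕ const (+ 11) ⊗ E₁ ↑ 5
  poly p = S.+-congʳ (S.+-cong (S.+-cong (^-congˡ 5 p) (S.*-congʳ (S.*-congˡ (^-congˡ 3 p)))) (S.*-congʳ (S.*-congˡ p)))

proj-const : ∀ r c a → r < 5 → proj r (const c ⊗ a) ≈ const c ⊗ proj r a
proj-const r c a r<5 = subst (λ t → proj t (const c ⊗ a) ≈ const c ⊗ proj r a) (m<n⇒m%n≡m r<5) (proj-⊗ 0 r a r<5
    (onClass-const c))

onClass-E₁^ : ∀ j → OnClass (j % 5) (E₁ ↑ j)
onClass-E₁^ zero    = onClass-const 1ℤ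
onClass-E₁^ (suc j) = subst (λ t → OnClass t (E₁ ↑ suc j)) (%-absorb 1 j) (onClass-⊗ onClass-E₁ (onClass-E₁^ j))

quinticTail : Series → Series → Series → Series → Series → Series
quinticTail a₄ a₃ a₂ a₁ a₀ =
  const (+ 5) ⊗ (E₁ ⊗ a₄) ⊕ const (ℤ.- + 15) ⊗ (E₁ ↑ 2 ⊗ a₃) ⊕ const (+ 25) ⊗ (E₁ ↑ 3 ⊗ a₂) ⊕ const (ℤ.- + 25) ⊗ (E₁ ↑ 4 ⊗
      a₁) ⊕ 𝒩 ⊗ a₀

quinticTail-cong : ∀ {a₄ a₃ a₂ a₁ a₀ b₄ b₃ b₂ b₁ b₀} → a₄ ≈ b₄ → a₃ ≈ b₃ → a₂ ≈ b₂ → a₁ ≈ b₁ → a₀ ≈ b₀ →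
  quinticTail a₄ a₃ a₂ a₁ a₀ ≈ quinticTail b₄ b₃ b₂ b₁ b₀
quinticTail-cong p₄ p₃ p₂ p₁ p₀ = S.+-cong (S.+-cong (S.+-cong (S.+-cong (S.*-congˡ (S.*-congˡ p₄)) (S.*-congˡ (S.*-congˡ
    p₃)))
  (S.*-congˡ (S.*-congˡ p₂))) (S.*-congˡ (S.*-congˡ p₁))) (S.*-congˡ p₀)

proj-quintic : ∀ r a → r < 5 → proj r (f ↑ 5 ⊗ a) ≈ quinticTail
  (proj ((r + 4) % 5) (f ↑ 4 ⊗ a)) (proj ((r + 8) % 5) (f ↑ 3 ⊗ a)) (proj ((r + 12) % 5) (f ↑ 2 ⊗ a)) (proj ((r + 16) % 5)
      (f ↑ 1 ⊗ a)) (proj r a)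
proj-quintic r a r<5 = begin
  proj r (f ↑ 5 ⊗ a)
    ≈⟨ proj-cong r (S.trans (S.*-congʳ quintic) (solve 7 (λ E₁ f4 f3 f2 f1 𝒩 a →
         (con (+ 5) :* (E₁ :* f4) :+ con (ℤ.- + 15) :* (E₁ :^ 2 :* f3) :+ con (+ 25) :* (E₁ :^ 3 :* f2) :+ con (ℤ.- + 25)
             :* (E₁ :^ 4 :* f1) :+ 𝒩) :* a :=
         con (+ 5) :* (E₁ :* (f4 :* a)) :+ con (ℤ.- + 15) :* (E₁ :^ 2 :* (f3 :* a)) :+ con (+ 25) :* (E₁ :^ 3 :* (f2 :* a))
             :+ con (ℤ.- + 25) :* (E₁ :^ 4 :* (f1 :* a)) :+ 𝒩 :* a) S.refl
         E₁ (f ↑ 4) (f ↑ 3) (f ↑ 2) (f ↑ 1) 𝒩 a)) ⟩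
  proj r (const (+ 5) ⊗ (E₁ ⊗ (f ↑ 4 ⊗ a)) ⊕ const (ℤ.- + 15) ⊗ (E₁ ↑ 2 ⊗ (f ↑ 3 ⊗ a)) ⊕ const (+ 25) ⊗ (E₁ ↑ 3 ⊗ (f ↑ 2 ⊗
      a)) ⊕ const (ℤ.- + 25) ⊗ (E₁ ↑ 4 ⊗ (f ↑ 1 ⊗ a)) ⊕ 𝒩 ⊗ a)
    ≈⟨ S.trans (proj-⊕ r _ _) (S.+-congʳ (S.trans (proj-⊕ r _ _) (S.+-congʳ (S.trans (proj-⊕ r _ _) (S.+-congʳ (proj-⊕ r _
        _)))))) ⟩
  proj r (const (+ 5) ⊗ (E₁ ⊗ (f ↑ 4 ⊗ a))) ⊕ proj r (const (ℤ.- + 15) ⊗ (E₁ ↑ 2 ⊗ (f ↑ 3 ⊗ a))) ⊕ proj r (const (+ 25) ⊗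
      (E₁ ↑ 3 ⊗ (f ↑ 2 ⊗ a))) ⊕ proj r (const (ℤ.- + 25) ⊗ (E₁ ↑ 4 ⊗ (f ↑ 1 ⊗ a))) ⊕ proj r (𝒩 ⊗ a)
    ≈⟨ S.+-cong (S.+-cong (S.+-cong (S.+-cong (term (+ 5) 1 onClass-E₁) (term (ℤ.- + 15) 2 (onClass-E₁^ 2))) (term (+ 25) 3
        (onClass-E₁^ 3))) (term (ℤ.- + 25) 4 (onClass-E₁^ 4))) last ⟩
  _ ∎
  where
  open ≈-Reasoning
  term : ∀ c i {p b} → OnClass i p → proj r (const c ⊗ (p ⊗ b)) ≈ const c ⊗ (p ⊗ proj ((r + 4 * i) % 5) b)
  term c i {p} {b} p∈ = S.trans (proj-const r c (p ⊗ b) r<5) (S.*-congˡ (proj-class-⊗ r i b r<5 p∈))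
  last : proj r (𝒩 ⊗ a) ≈ 𝒩 ⊗ proj r a
  last = subst (λ t → proj t (𝒩 ⊗ a) ≈ 𝒩 ⊗ proj r a) (m<n⇒m%n≡m r<5) (proj-⊗ 0 r a r<5 onClass-𝒩)

-- The class of E₁ᵏ. A monomial of degree k in E₀, E₁, E₂ lies in it exactly when its exponents of
-- E₀ and E₂ agree modulo 5, so these two enter only through E₀E₂, E₀⁵ and E₂⁵.
𝒞 : ℕ → Series
𝒞 k = proj (k % 5) (f ↑ k)

-- In each term of the quintic, E₁ⁱ shifts the class by i while lowering the power of f by i, so the
-- choice of class is preserved.
𝒞-rec : ∀ k → 𝒞 (5 + k) ≈ quinticTail (𝒞 (4 + k)) (𝒞 (3 + k)) (𝒞 (2 + k)) (𝒞 (1 + k)) (𝒞 k)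
𝒞-rec k = begin
  𝒞 (5 + k)
    ≈⟨ S.trans (S.reflexive (cong (λ t → proj t (f ↑ (5 + k))) (shift 1))) (proj-cong (k % 5) (^-homo-* f 5 k)) ⟩
  proj (k % 5) (f ↑ 5 ⊗ f ↑ k)
    ≈⟨ proj-quintic (k % 5) (f ↑ k) (m%n<n k 5) ⟩
  quinticTail (proj ((k % 5 + 4) % 5) (f ↑ 4 ⊗ f ↑ k)) (proj ((k % 5 + 8) % 5) (f ↑ 3 ⊗ f ↑ k)) (proj ((k % 5 + 12) % 5) (f
      ↑ 2 ⊗ f ↑ k)) (proj ((k % 5 + 16) % 5) (f ↑ 1 ⊗ f ↑ k)) (𝒞 k)
    ≈⟨ quinticTail-cong (part 4 0) (part 3 1) (part 2 2) (part 1 3) S.refl ⟩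
  quinticTail (𝒞 (4 + k)) (𝒞 (3 + k)) (𝒞 (2 + k)) (𝒞 (1 + k)) (𝒞 k) ∎
  where
  open ≈-Reasoning
  shift : ∀ j → (j * 5 + k) % 5 ≡ k % 5
  shift j = trans (cong (_% 5) (ℕ.+-comm (j * 5) k)) ([m+kn]%n≡m%n k j 5)
  part : ∀ i j → proj ((k % 5 + (i + j * 5)) % 5) (f ↑ i ⊗ f ↑ k) ≈ 𝒞 (i + k)
  part i j = S.trans (S.reflexive (cong (λ t → proj t (f ↑ i ⊗ f ↑ k)) index)) (proj-cong ((i + k) % 5) (S.sym (^-homo-* f
      i k)))
    where
    lem : ∀ i j k → i + j * 5 + k ≡ i + k + j * 5
    lem = ℕ-Solver.solve-∀
    index : (k % 5 + (i + j * 5)) % 5 ≡ (i + k) % 5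
    index = trans (cong (_% 5) (ℕ.+-comm (k % 5) (i + j * 5))) (trans (%-absorb (i + j * 5) k)
      (trans (cong (_% 5) (lem i j k)) ([m+kn]%n≡m%n (i + k) j 5)))

-- The values for k ≤ 4 come from the dissection and start the recurrence, which is then run to 13,
-- the largest power of f in the `v` and `w` series. Each is a combination of E₁^(k - 5j) 𝒩ʲ;
-- trivial factors are kept for a uniform shape.
𝒞-0 : 𝒞 0 ≈ const (+ 1) ⊗ E₁ ↑ 0 ⊗ 𝒩 ↑ 0
𝒞-0 = S.trans (proj-self (onClass-const 1ℤ)) (solve 2 (λ E₁ 𝒩 → con 1ℤ := con (+ 1) :* E₁ :^ 0 :* 𝒩 :^ 0) S.refl E₁ 𝒩)

𝒞-1 : 𝒞 1 ≈ const (+ 1) ⊗ E₁ ↑ 1 ⊗ 𝒩 ↑ 0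
𝒞-1 = S.trans (proj-cong 1 (S.*-identityʳ f)) (S.trans proj-f-1 (solve 2 (λ E₁ 𝒩 → E₁ := con (+ 1) :* E₁ :^ 1 :* 𝒩 :^ 0)
    S.refl E₁ 𝒩))

𝒞-2 : 𝒞 2 ≈ const (ℤ.- + 1) ⊗ E₁ ↑ 2 ⊗ 𝒩 ↑ 0
𝒞-2 = begin
  proj 2 (f ↑ 2)                     ≈⟨ proj-cong 2 (S.*-congˡ {x = f} (S.*-identityʳ f)) ⟩
  proj 2 f²                          ≈⟨ proj-f²-2 ⟩
  E₁ ⊗ E₁ ⊕ const (+ 2) ⊗ (E₀ ⊗ E₂)      ≈⟨ S.+-congˡ {x = E₁ ⊗ E₁} (S.*-congˡ E₀E₂≈-E₁²) ⟩
  E₁ ⊗ E₁ ⊕ const (+ 2) ⊗ ⊖ (E₁ ⊗ E₁)    ≈⟨ solve 2 (λ E₁ 𝒩 → E₁ :* E₁ :+ con (+ 2) :* :- (E₁ :* E₁) := con (ℤ.- + 1) :* E₁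
      :^ 2 :* 𝒩 :^ 0) S.refl E₁ 𝒩 ⟩
  const (ℤ.- + 1) ⊗ E₁ ↑ 2 ⊗ 𝒩 ↑ 0 ∎
  where open ≈-Reasoning

𝒞-3 : 𝒞 3 ≈ const (ℤ.- + 5) ⊗ E₁ ↑ 3 ⊗ 𝒩 ↑ 0
𝒞-3 = begin
  proj 3 (f ↑ 3)
    ≈⟨ S.trans (proj-cong 3 f³≈) (proj-f⊗ 3 f² (s≤s (s≤s (s≤s (s≤s z≤n))))) ⟩
  E₀ ⊗ proj 3 f² ⊕ E₁ ⊗ proj 2 f² ⊕ E₂ ⊗ proj 1 f²
    ≈⟨ S.+-cong (S.+-cong (S.*-congˡ {x = E₀} proj-f²-3) (S.*-congˡ {x = E₁} proj-f²-2)) (S.*-congˡ {x = E₂} proj-f²-1) ⟩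
  E₀ ⊗ (const (+ 2) ⊗ E₁ ⊗ E₂) ⊕ E₁ ⊗ (E₁ ⊗ E₁ ⊕ const (+ 2) ⊗ (E₀ ⊗ E₂)) ⊕ E₂ ⊗ (const (+ 2) ⊗ E₀ ⊗ E₁)
    ≈⟨ solve 3 (λ E₀ E₁ E₂ → E₀ :* (con (+ 2) :* E₁ :* E₂) :+ E₁ :* (E₁ :* E₁ :+ con (+ 2) :* (E₀ :* E₂)) :+ E₂ :* (con (+
        2) :* E₀ :* E₁) := E₁ :* E₁ :* E₁ :+ con (+ 6) :* E₁ :* (E₀ :* E₂)) S.refl E₀ E₁ E₂ ⟩
  E₁ ⊗ E₁ ⊗ E₁ ⊕ const (+ 6) ⊗ E₁ ⊗ (E₀ ⊗ E₂)
    ≈⟨ S.+-congˡ {x = E₁ ⊗ E₁ ⊗ E₁} (S.*-congˡ E₀E₂≈-E₁²) ⟩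
  E₁ ⊗ E₁ ⊗ E₁ ⊕ const (+ 6) ⊗ E₁ ⊗ ⊖ (E₁ ⊗ E₁)
    ≈⟨ solve 2 (λ E₁ 𝒩 → E₁ :* E₁ :* E₁ :+ con (+ 6) :* E₁ :* :- (E₁ :* E₁) := con (ℤ.- + 5) :* E₁ :^ 3 :* 𝒩 :^ 0) S.refl
        E₁ 𝒩 ⟩
  const (ℤ.- + 5) ⊗ E₁ ↑ 3 ⊗ 𝒩 ↑ 0 ∎
  where open ≈-Reasoning

𝒞-4 : 𝒞 4 ≈ const (ℤ.- + 5) ⊗ E₁ ↑ 4 ⊗ 𝒩 ↑ 0
𝒞-4 = begin
  proj 4 (f ↑ 4)
    ≈⟨ S.trans (proj-cong 4 (solve 1 (λ f → f :^ 4 := f :* f :* (f :* f)) S.refl f)) (proj-cauchy 4 f² f² (s≤s (s≤s (s≤s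
        (s≤s (s≤s z≤n)))))) ⟩
  proj 0 f² ⊗ proj 4 f² ⊕ proj 1 f² ⊗ proj 3 f² ⊕ proj 2 f² ⊗ proj 2 f² ⊕ proj 3 f² ⊗ proj 1 f² ⊕ proj 4 f² ⊗ proj 0 f²
    ≈⟨ S.+-cong (S.+-cong (S.+-cong (S.+-cong (⊗-cong proj-f²-0 proj-f²-4) (⊗-cong proj-f²-1 proj-f²-3)) (⊗-cong proj-f²-2
        proj-f²-2)) (⊗-cong proj-f²-3 proj-f²-1)) (⊗-cong proj-f²-4 proj-f²-0) ⟩
  _ ≈⟨ solve 3 (λ E₀ E₁ E₂ → E₀ :* E₀ :* (E₂ :* E₂) :+ con (+ 2) :* E₀ :* E₁ :* (con (+ 2) :* E₁ :* E₂) :+ (E₁ :* E₁ :+ con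
      (+ 2) :* (E₀ :* E₂)) :* (E₁ :* E₁ :+ con (+ 2) :* (E₀ :* E₂)) :+ con (+ 2) :* E₁ :* E₂ :* (con (+ 2) :* E₀ :* E₁) :+
      E₂ :* E₂ :* (E₀ :* E₀)
         := E₁ :* E₁ :* E₁ :* E₁ :+ con (+ 12) :* (E₁ :* E₁) :* (E₀ :* E₂) :+ con (+ 6) :* (E₀ :* E₂) :* (E₀ :* E₂)) S.refl
             E₀ E₁ E₂ ⟩
  E₁ ⊗ E₁ ⊗ E₁ ⊗ E₁ ⊕ const (+ 12) ⊗ (E₁ ⊗ E₁) ⊗ (E₀ ⊗ E₂) ⊕ const (+ 6) ⊗ (E₀ ⊗ E₂) ⊗ (E₀ ⊗ E₂)
    ≈⟨ S.+-cong (S.+-congˡ {x = E₁ ⊗ E₁ ⊗ E₁ ⊗ E₁} (S.*-congˡ E₀E₂≈-E₁²)) (⊗-cong (S.*-congˡ E₀E₂≈-E₁²) E₀E₂≈-E₁²) ⟩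
  E₁ ⊗ E₁ ⊗ E₁ ⊗ E₁ ⊕ const (+ 12) ⊗ (E₁ ⊗ E₁) ⊗ ⊖ (E₁ ⊗ E₁) ⊕ const (+ 6) ⊗ ⊖ (E₁ ⊗ E₁) ⊗ ⊖ (E₁ ⊗ E₁)
    ≈⟨ solve 2 (λ E₁ 𝒩 → E₁ :* E₁ :* E₁ :* E₁ :+ con (+ 12) :* (E₁ :* E₁) :* :- (E₁ :* E₁) :+ con (+ 6) :* :- (E₁ :* E₁) :*
        :- (E₁ :* E₁) := con (ℤ.- + 5) :* E₁ :^ 4 :* 𝒩 :^ 0) S.refl E₁ 𝒩 ⟩
  const (ℤ.- + 5) ⊗ E₁ ↑ 4 ⊗ 𝒩 ↑ 0 ∎
  where open ≈-Reasoning

𝒞-5 : 𝒞 5 ≈ const (+ 1) ⊗ E₁ ↑ 0 ⊗ 𝒩 ↑ 1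
𝒞-5 = S.trans (𝒞-rec 0) (S.trans (quinticTail-cong 𝒞-4 𝒞-3 𝒞-2 𝒞-1 𝒞-0)
  (solve 2 (λ E₁ 𝒩 → con (+ 5) :* (E₁ :* (con (ℤ.- + 5) :* E₁ :^ 4 :* 𝒩 :^ 0)) :+ con (ℤ.- + 15) :* (E₁ :^ 2 :* (con (ℤ.- +
      5) :* E₁ :^ 3 :* 𝒩 :^ 0)) :+ con (+ 25) :* (E₁ :^ 3 :* (con (ℤ.- + 1) :* E₁ :^ 2 :* 𝒩 :^ 0)) :+ con (ℤ.- + 25) :* (E₁
      :^ 4 :* (con (+ 1) :* E₁ :^ 1 :* 𝒩 :^ 0)) :+ 𝒩 :* (con (+ 1) :* E₁ :^ 0 :* 𝒩 :^ 0)
    := con (+ 1) :* E₁ :^ 0 :* 𝒩 :^ 1) S.refl E₁ 𝒩))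

𝒞-6 : 𝒞 6 ≈ const (ℤ.- + 25) ⊗ E₁ ↑ 6 ⊗ 𝒩 ↑ 0 ⊕ const (+ 6) ⊗ E₁ ↑ 1 ⊗ 𝒩 ↑ 1
𝒞-6 = S.trans (𝒞-rec 1) (S.trans (quinticTail-cong 𝒞-5 𝒞-4 𝒞-3 𝒞-2 𝒞-1)
  (solve 2 (λ E₁ 𝒩 → con (+ 5) :* (E₁ :* (con (+ 1) :* E₁ :^ 0 :* 𝒩 :^ 1)) :+ con (ℤ.- + 15) :* (E₁ :^ 2 :* (con (ℤ.- + 5)
      :* E₁ :^ 4 :* 𝒩 :^ 0)) :+ con (+ 25) :* (E₁ :^ 3 :* (con (ℤ.- + 5) :* E₁ :^ 3 :* 𝒩 :^ 0)) :+ con (ℤ.- + 25) :* (E₁ :^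
      4 :* (con (ℤ.- + 1) :* E₁ :^ 2 :* 𝒩 :^ 0)) :+ 𝒩 :* (con (+ 1) :* E₁ :^ 1 :* 𝒩 :^ 0)
    := con (ℤ.- + 25) :* E₁ :^ 6 :* 𝒩 :^ 0 :+ con (+ 6) :* E₁ :^ 1 :* 𝒩 :^ 1) S.refl E₁ 𝒩))

𝒞-7 : 𝒞 7 ≈ const (ℤ.- + 125) ⊗ E₁ ↑ 7 ⊗ 𝒩 ↑ 0 ⊕ const (+ 14) ⊗ E₁ ↑ 2 ⊗ 𝒩 ↑ 1
𝒞-7 = S.trans (𝒞-rec 2) (S.trans (quinticTail-cong 𝒞-6 𝒞-5 𝒞-4 𝒞-3 𝒞-2)
  (solve 2 (λ E₁ 𝒩 → con (+ 5) :* (E₁ :* (con (ℤ.- + 25) :* E₁ :^ 6 :* 𝒩 :^ 0 :+ con (+ 6) :* E₁ :^ 1 :* 𝒩 :^ 1)) :+ con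
      (ℤ.- + 15) :* (E₁ :^ 2 :* (con (+ 1) :* E₁ :^ 0 :* 𝒩 :^ 1)) :+ con (+ 25) :* (E₁ :^ 3 :* (con (ℤ.- + 5) :* E₁ :^ 4 :*
      𝒩 :^ 0)) :+ con (ℤ.- + 25) :* (E₁ :^ 4 :* (con (ℤ.- + 5) :* E₁ :^ 3 :* 𝒩 :^ 0)) :+ 𝒩 :* (con (ℤ.- + 1) :* E₁ :^ 2 :*
      𝒩 :^ 0)
    := con (ℤ.- + 125) :* E₁ :^ 7 :* 𝒩 :^ 0 :+ con (+ 14) :* E₁ :^ 2 :* 𝒩 :^ 1) S.refl E₁ 𝒩))

𝒞-8 : 𝒞 8 ≈ const (ℤ.- + 125) ⊗ E₁ ↑ 8 ⊗ 𝒩 ↑ 0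
𝒞-8 = S.trans (𝒞-rec 3) (S.trans (quinticTail-cong 𝒞-7 𝒞-6 𝒞-5 𝒞-4 𝒞-3)
  (solve 2 (λ E₁ 𝒩 → con (+ 5) :* (E₁ :* (con (ℤ.- + 125) :* E₁ :^ 7 :* 𝒩 :^ 0 :+ con (+ 14) :* E₁ :^ 2 :* 𝒩 :^ 1)) :+ con
      (ℤ.- + 15) :* (E₁ :^ 2 :* (con (ℤ.- + 25) :* E₁ :^ 6 :* 𝒩 :^ 0 :+ con (+ 6) :* E₁ :^ 1 :* 𝒩 :^ 1)) :+ con (+ 25) :*
      (E₁ :^ 3 :* (con (+ 1) :* E₁ :^ 0 :* 𝒩 :^ 1)) :+ con (ℤ.- + 25) :* (E₁ :^ 4 :* (con (ℤ.- + 5) :* E₁ :^ 4 :* 𝒩 :^ 0))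
      :+ 𝒩 :* (con (ℤ.- + 5) :* E₁ :^ 3 :* 𝒩 :^ 0)
    := con (ℤ.- + 125) :* E₁ :^ 8 :* 𝒩 :^ 0) S.refl E₁ 𝒩))

𝒞-9 : 𝒞 9 ≈ const (+ 625) ⊗ E₁ ↑ 9 ⊗ 𝒩 ↑ 0 ⊕ const (ℤ.- + 90) ⊗ E₁ ↑ 4 ⊗ 𝒩 ↑ 1
𝒞-9 = S.trans (𝒞-rec 4) (S.trans (quinticTail-cong 𝒞-8 𝒞-7 𝒞-6 𝒞-5 𝒞-4)
  (solve 2 (λ E₁ 𝒩 → con (+ 5) :* (E₁ :* (con (ℤ.- + 125) :* E₁ :^ 8 :* 𝒩 :^ 0)) :+ con (ℤ.- + 15) :* (E₁ :^ 2 :* (con (ℤ.-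
      + 125) :* E₁ :^ 7 :* 𝒩 :^ 0 :+ con (+ 14) :* E₁ :^ 2 :* 𝒩 :^ 1)) :+ con (+ 25) :* (E₁ :^ 3 :* (con (ℤ.- + 25) :* E₁
      :^ 6 :* 𝒩 :^ 0 :+ con (+ 6) :* E₁ :^ 1 :* 𝒩 :^ 1)) :+ con (ℤ.- + 25) :* (E₁ :^ 4 :* (con (+ 1) :* E₁ :^ 0 :* 𝒩 :^ 1))
      :+ 𝒩 :* (con (ℤ.- + 5) :* E₁ :^ 4 :* 𝒩 :^ 0)
    := con (+ 625) :* E₁ :^ 9 :* 𝒩 :^ 0 :+ con (ℤ.- + 90) :* E₁ :^ 4 :* 𝒩 :^ 1) S.refl E₁ 𝒩))

𝒞-10 : 𝒞 10 ≈ const (+ 2500) ⊗ E₁ ↑ 10 ⊗ 𝒩 ↑ 0 ⊕ const (ℤ.- + 250) ⊗ E₁ ↑ 5 ⊗ 𝒩 ↑ 1 ⊕ const (+ 1) ⊗ E₁ ↑ 0 ⊗ 𝒩 ↑ 2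
𝒞-10 = S.trans (𝒞-rec 5) (S.trans (quinticTail-cong 𝒞-9 𝒞-8 𝒞-7 𝒞-6 𝒞-5)
  (solve 2 (λ E₁ 𝒩 → con (+ 5) :* (E₁ :* (con (+ 625) :* E₁ :^ 9 :* 𝒩 :^ 0 :+ con (ℤ.- + 90) :* E₁ :^ 4 :* 𝒩 :^ 1)) :+ con
      (ℤ.- + 15) :* (E₁ :^ 2 :* (con (ℤ.- + 125) :* E₁ :^ 8 :* 𝒩 :^ 0)) :+ con (+ 25) :* (E₁ :^ 3 :* (con (ℤ.- + 125) :* E₁
      :^ 7 :* 𝒩 :^ 0 :+ con (+ 14) :* E₁ :^ 2 :* 𝒩 :^ 1)) :+ con (ℤ.- + 25) :* (E₁ :^ 4 :* (con (ℤ.- + 25) :* E₁ :^ 6 :* 𝒩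
      :^ 0 :+ con (+ 6) :* E₁ :^ 1 :* 𝒩 :^ 1)) :+ 𝒩 :* (con (+ 1) :* E₁ :^ 0 :* 𝒩 :^ 1)
    := con (+ 2500) :* E₁ :^ 10 :* 𝒩 :^ 0 :+ con (ℤ.- + 250) :* E₁ :^ 5 :* 𝒩 :^ 1 :+ con (+ 1) :* E₁ :^ 0 :* 𝒩 :^ 2) S.refl
        E₁ 𝒩))

𝒞-11 : 𝒞 11 ≈ const (+ 3125) ⊗ E₁ ↑ 11 ⊗ 𝒩 ↑ 0 ⊕ const (ℤ.- + 275) ⊗ E₁ ↑ 6 ⊗ 𝒩 ↑ 1 ⊕ const (+ 11) ⊗ E₁ ↑ 1 ⊗ 𝒩 ↑ 2
𝒞-11 = S.trans (𝒞-rec 6) (S.trans (quinticTail-cong 𝒞-10 𝒞-9 𝒞-8 𝒞-7 𝒞-6)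
  (solve 2 (λ E₁ 𝒩 → con (+ 5) :* (E₁ :* (con (+ 2500) :* E₁ :^ 10 :* 𝒩 :^ 0 :+ con (ℤ.- + 250) :* E₁ :^ 5 :* 𝒩 :^ 1 :+ con
      (+ 1) :* E₁ :^ 0 :* 𝒩 :^ 2)) :+ con (ℤ.- + 15) :* (E₁ :^ 2 :* (con (+ 625) :* E₁ :^ 9 :* 𝒩 :^ 0 :+ con (ℤ.- + 90) :*
      E₁ :^ 4 :* 𝒩 :^ 1)) :+ con (+ 25) :* (E₁ :^ 3 :* (con (ℤ.- + 125) :* E₁ :^ 8 :* 𝒩 :^ 0)) :+ con (ℤ.- + 25) :* (E₁ :^
      4 :* (con (ℤ.- + 125) :* E₁ :^ 7 :* 𝒩 :^ 0 :+ con (+ 14) :* E₁ :^ 2 :* 𝒩 :^ 1)) :+ 𝒩 :* (con (ℤ.- + 25) :* E₁ :^ 6 :*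
      𝒩 :^ 0 :+ con (+ 6) :* E₁ :^ 1 :* 𝒩 :^ 1)
    := con (+ 3125) :* E₁ :^ 11 :* 𝒩 :^ 0 :+ con (ℤ.- + 275) :* E₁ :^ 6 :* 𝒩 :^ 1 :+ con (+ 11) :* E₁ :^ 1 :* 𝒩 :^ 2)
        S.refl E₁ 𝒩))

𝒞-12 : 𝒞 12 ≈ const (ℤ.- + 3125) ⊗ E₁ ↑ 12 ⊗ 𝒩 ↑ 0 ⊕ const (+ 54) ⊗ E₁ ↑ 2 ⊗ 𝒩 ↑ 2
𝒞-12 = S.trans (𝒞-rec 7) (S.trans (quinticTail-cong 𝒞-11 𝒞-10 𝒞-9 𝒞-8 𝒞-7)
  (solve 2 (λ E₁ 𝒩 → con (+ 5) :* (E₁ :* (con (+ 3125) :* E₁ :^ 11 :* 𝒩 :^ 0 :+ con (ℤ.- + 275) :* E₁ :^ 6 :* 𝒩 :^ 1 :+ con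
      (+ 11) :* E₁ :^ 1 :* 𝒩 :^ 2)) :+ con (ℤ.- + 15) :* (E₁ :^ 2 :* (con (+ 2500) :* E₁ :^ 10 :* 𝒩 :^ 0 :+ con (ℤ.- + 250)
      :* E₁ :^ 5 :* 𝒩 :^ 1 :+ con (+ 1) :* E₁ :^ 0 :* 𝒩 :^ 2)) :+ con (+ 25) :* (E₁ :^ 3 :* (con (+ 625) :* E₁ :^ 9 :* 𝒩 :^
      0 :+ con (ℤ.- + 90) :* E₁ :^ 4 :* 𝒩 :^ 1)) :+ con (ℤ.- + 25) :* (E₁ :^ 4 :* (con (ℤ.- + 125) :* E₁ :^ 8 :* 𝒩 :^ 0))
      :+ 𝒩 :* (con (ℤ.- + 125) :* E₁ :^ 7 :* 𝒩 :^ 0 :+ con (+ 14) :* E₁ :^ 2 :* 𝒩 :^ 1)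
    := con (ℤ.- + 3125) :* E₁ :^ 12 :* 𝒩 :^ 0 :+ con (+ 54) :* E₁ :^ 2 :* 𝒩 :^ 2) S.refl E₁ 𝒩))

𝒞-13 : 𝒞 13 ≈ const (ℤ.- + 15625) ⊗ E₁ ↑ 13 ⊗ 𝒩 ↑ 0 ⊕ const (+ 130) ⊗ E₁ ↑ 3 ⊗ 𝒩 ↑ 2
𝒞-13 = S.trans (𝒞-rec 8) (S.trans (quinticTail-cong 𝒞-12 𝒞-11 𝒞-10 𝒞-9 𝒞-8)
  (solve 2 (λ E₁ 𝒩 → con (+ 5) :* (E₁ :* (con (ℤ.- + 3125) :* E₁ :^ 12 :* 𝒩 :^ 0 :+ con (+ 54) :* E₁ :^ 2 :* 𝒩 :^ 2)) :+
      con (ℤ.- + 15) :* (E₁ :^ 2 :* (con (+ 3125) :* E₁ :^ 11 :* 𝒩 :^ 0 :+ con (ℤ.- + 275) :* E₁ :^ 6 :* 𝒩 :^ 1 :+ con (+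
      11) :* E₁ :^ 1 :* 𝒩 :^ 2)) :+ con (+ 25) :* (E₁ :^ 3 :* (con (+ 2500) :* E₁ :^ 10 :* 𝒩 :^ 0 :+ con (ℤ.- + 250) :* E₁
      :^ 5 :* 𝒩 :^ 1 :+ con (+ 1) :* E₁ :^ 0 :* 𝒩 :^ 2)) :+ con (ℤ.- + 25) :* (E₁ :^ 4 :* (con (+ 625) :* E₁ :^ 9 :* 𝒩 :^ 0
      :+ con (ℤ.- + 90) :* E₁ :^ 4 :* 𝒩 :^ 1)) :+ 𝒩 :* (con (ℤ.- + 125) :* E₁ :^ 8 :* 𝒩 :^ 0)
    := con (ℤ.- + 15625) :* E₁ :^ 13 :* 𝒩 :^ 0 :+ con (+ 130) :* E₁ :^ 3 :* 𝒩 :^ 2) S.refl E₁ 𝒩))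

-- Logarithmic derivatives and the norm of f

θ-const : ∀ c → θ (const c) ≈ 0s
θ-const c = mk≈ λ { zero → ℤ.*-zeroˡ c ; (suc n) → ℤ.*-zeroʳ (+ suc n) }

const-suc : ∀ k → const (+ suc k) ≈ 1s ⊕ const (+ k)
const-suc k = mk≈ λ { zero → refl ; (suc _) → refl }

θ-^ : ∀ a k → θ (a ↑ suc k) ≈ const (+ suc k) ⊗ (a ↑ k ⊗ θ a)
θ-^ a zero    = S.trans (θ-cong (S.*-identityʳ a)) (solve 1 (λ t → t := con 1ℤ :* (con 1ℤ :* t)) S.refl (θ a))
θ-^ a (suc k) = begin
  θ (a ⊗ a ↑ suc k)
    ≈⟨ θ-⊗ a (a ↑ suc k) ⟩
  θ a ⊗ a ↑ suc k ⊕ a ⊗ θ (a ↑ suc k)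
    ≈⟨ S.+-congˡ {x = θ a ⊗ a ↑ suc k} (S.*-congˡ {x = a} (θ-^ a k)) ⟩
  θ a ⊗ a ↑ suc k ⊕ a ⊗ (const (+ suc k) ⊗ (a ↑ k ⊗ θ a))
    ≈⟨ solve 4 (λ t a p c → t :* (a :* p) :+ a :* (c :* (p :* t)) := (con 1ℤ :+ c) :* (a :* p :* t)) S.refl (θ a) a (a ↑ k)
        (const (+ suc k)) ⟩
  (1s ⊕ const (+ suc k)) ⊗ (a ↑ suc k ⊗ θ a)
    ≈⟨ S.*-congʳ (const-suc (suc k)) ⟨
  const (+ suc (suc k)) ⊗ (a ↑ suc k ⊗ θ a) ∎
  where open ≈-Reasoning

const-cancelˡ : ∀ k a b → const (+ suc k) ⊗ a ≈ const (+ suc k) ⊗ b → a ≈ b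
const-cancelˡ k a b e = begin
  a                ≈⟨ solve 2 (λ a b → a := (a :- b) :+ b) S.refl a b ⟩
  (a ⊕ ⊖ b) ⊕ b    ≈⟨ S.+-congʳ (const-cancel k (a ⊕ ⊖ b) difference) ⟩
  0s ⊕ b           ≈⟨ S.+-identityˡ b ⟩
  b                ∎
  where
  open ≈-Reasoning
  difference : const (+ suc k) ⊗ (a ⊕ ⊖ b) ≈ 0s
  difference = S.trans (solve 3 (λ c a b → c :* (a :- b) := c :* a :- c :* b) S.refl (const (+ suc k)) a b)
    (S.trans (S.+-congʳ e) (S.-‿inverseʳ (const (+ suc k) ⊗ b)))

θ≈0⇒ : ∀ a → θ a ≈ 0s → ∀ n → a (suc n) ≡ 0ℤ
θ≈0⇒ a e n with ℤ.i*j≡0⇒i≡0∨j≡0 (+ suc n) (at e (suc n))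
... | inj₂ a≡0 = a≡0

-- Equal logarithmic derivatives force θ(a/b) = 0, so a/b is constant, as θ multiplies the
-- coefficient of qⁿ by n and ℤ has no zero divisors.
θ-unique : ∀ {a b w} → a 0 ≡ 1ℤ → b 0 ≡ 1ℤ → θ a ≈ a ⊗ w → θ b ≈ b ⊗ w → a ≈ b
θ-unique {a} {b} {w} a0 b0 θa θb = begin
  a       ≈⟨ a≈bd ⟩
  b ⊗ d   ≈⟨ S.*-congˡ d≈1 ⟩
  b ⊗ 1s  ≈⟨ S.*-identityʳ b ⟩
  b       ∎
  where
  open ≈-Reasoning
  b⁻¹ = proj₁ (inverse b b0)
  d = b⁻¹ ⊗ a
  a≈bd : a ≈ b ⊗ d
  a≈bd = S.trans (S.sym (S.*-identityˡ a)) (S.trans (S.*-congʳ (S.sym (proj₂ (inverse b b0)))) (S.*-assoc b b⁻¹ a))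
  θd≈0 : θ d ≈ 0s
  θd≈0 = ⊗-cancelˡ b b0 (begin
    b ⊗ θ d                       ≈⟨ solve 3 (λ bt t bd → bt := (t :+ bt) :- t) S.refl (b ⊗ θ d) (θ b ⊗ d) d ⟩
    (θ b ⊗ d ⊕ b ⊗ θ d) ⊕ ⊖ (θ b ⊗ d)  ≈⟨ S.+-cong (S.sym (θ-⊗ b d)) (S.-‿cong (S.*-congʳ θb)) ⟩
    θ (b ⊗ d) ⊕ ⊖ (b ⊗ w ⊗ d)     ≈⟨ S.+-congʳ (S.trans (θ-cong (S.sym a≈bd)) (S.trans θa (S.*-congʳ a≈bd))) ⟩
    b ⊗ d ⊗ w ⊕ ⊖ (b ⊗ w ⊗ d)     ≈⟨ solve 3 (λ b d w → b :* d :* w :- b :* w :* d := b :* con 0ℤ) S.refl b d w ⟩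
    b ⊗ 0s                        ∎)
  b⁻¹0 : b⁻¹ 0 ≡ 1ℤ
  b⁻¹0 = trans (sym (ℤ.*-identityˡ (b⁻¹ 0))) (trans (cong (ℤ._* b⁻¹ 0) (sym b0)) (at (proj₂ (inverse b b0)) 0))
  d≈1 : d ≈ 1s
  d≈1 = mk≈ λ { zero → cong₂ ℤ._*_ b⁻¹0 a0 ; (suc n) → θ≈0⇒ d θd≈0 n }

f⁻¹ : Series
f⁻¹ = proj₁ (inverse f f-0)

f⊗f⁻¹ : f ⊗ f⁻¹ ≈ 1s
f⊗f⁻¹ = proj₂ (inverse f f-0)

-- This is Σ σ₁(n) qⁿ.
ℒ : Series
ℒ = ⊖ (θ f ⊗ f⁻¹)

f⊗ℒ : f ⊗ ℒ ≈ ⊖ θ f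
f⊗ℒ = begin
  f ⊗ ⊖ (θ f ⊗ f⁻¹)    ≈⟨ lem f (θ f) f⁻¹ ⟩
  ⊖ θ f ⊗ (f ⊗ f⁻¹)    ≈⟨ S.*-congˡ {x = ⊖ θ f} f⊗f⁻¹ ⟩
  ⊖ θ f ⊗ 1s           ≈⟨ S.*-identityʳ (⊖ θ f) ⟩
  ⊖ θ f                ∎
  where
  open ≈-Reasoning
  lem : ∀ a t p → a ⊗ ⊖ (t ⊗ p) ≈ ⊖ t ⊗ (a ⊗ p)
  lem = solve 3 (λ a t p → a :* :- (t :* p) := :- t :* (a :* p)) S.refl

-- Projection of θ(fᵏ⁺¹) = (k + 1) fᵏ θf = -(k + 1) fᵏ⁺¹ ℒ; the integer factor stays on the left to
-- avoid division.
proj-f^⊗ℒ : ∀ k → const (+ suc k) ⊗ proj (suc k % 5) (f ↑ suc k ⊗ ℒ) ≈ ⊖ θ (𝒞 (suc k))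
proj-f^⊗ℒ k = begin
  const (+ suc k) ⊗ proj r (f ↑ suc k ⊗ ℒ)
    ≈⟨ proj-const r (+ suc k) (f ↑ suc k ⊗ ℒ) (m%n<n (suc k) 5) ⟨
  proj r (const (+ suc k) ⊗ (f ↑ suc k ⊗ ℒ))
    ≈⟨ proj-cong r (S.trans (solve 4 (λ c f p ℒ → c :* (f :* p :* ℒ) := c :* (p :* (f :* ℒ))) S.refl (const (+ suc k)) f (f
        ↑ k) ℒ)
         (S.trans (S.*-congˡ {x = const (+ suc k)} (S.*-congˡ {x = f ↑ k} f⊗ℒ)) (solve 3 (λ c p t → c :* (p :* :- t) := :-
             (c :* (p :* t))) S.refl (const (+ suc k)) (f ↑ k) (θ f)))) ⟩
  proj r (⊖ (const (+ suc k) ⊗ (f ↑ k ⊗ θ f)))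
    ≈⟨ proj-cong r (S.-‿cong (θ-^ f k)) ⟨
  proj r (⊖ θ (f ↑ suc k))
    ≈⟨ S.trans (proj-⊖ r _) (S.-‿cong (proj-θ r _)) ⟩
  ⊖ θ (𝒞 (suc k)) ∎
  where
  open ≈-Reasoning
  r = suc k % 5

θ-const⊗ : ∀ c a → θ (const c ⊗ a) ≈ const c ⊗ θ a
θ-const⊗ c a = S.trans (θ-⊗ (const c) a) (S.trans (S.+-congʳ (S.*-congʳ (θ-const c))) (solve 2 (λ a u → con 0ℤ :* a :+ u :=
    u) S.refl a (const c ⊗ θ a)))

-- Multiply the quintic by ℒ and project to the class 0, using fᵏ ℒ = −θ(fᵏ)/k.
θ-𝒩 : θ 𝒩 ≈ ⊖ (const (+ 5) ⊗ (𝒩 ⊗ proj 0 ℒ))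
θ-𝒩 = begin
  θ 𝒩
    ≈⟨ solve 1 (λ t → t := :- :- t) S.refl (θ 𝒩) ⟩
  ⊖ ⊖ θ 𝒩
    ≈⟨ S.-‿cong (S.-‿cong (θ-cong (S.trans 𝒞-5 (solve 2 (λ E₁ 𝒩 → con (+ 1) :* E₁ :^ 0 :* 𝒩 :^ 1 := 𝒩) S.refl E₁ 𝒩)))) ⟨
  ⊖ ⊖ θ (𝒞 5)
    ≈⟨ S.-‿cong (proj-f^⊗ℒ 4) ⟨
  ⊖ (const (+ 5) ⊗ proj 0 (f ↑ 5 ⊗ ℒ))
    ≈⟨ S.-‿cong (S.*-congˡ (S.trans (proj-quintic 0 ℒ (s≤s z≤n)) (quinticTail-cong part₄ part₃ part₂ part₁ (S.refl {proj 0
        ℒ})))) ⟩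
  ⊖ (const (+ 5) ⊗ quinticTail (const (+ 5) ⊗ (E₁ ↑ 3 ⊗ θ E₁)) (const (+ 5) ⊗ (E₁ ↑ 2 ⊗ θ E₁)) (E₁ ⊗ θ E₁) (⊖ θ E₁) (proj 0
      ℒ))
    -- The multiples of E₁⁴ θE₁ cancel, 25 - 75 + 25 + 25 = 0, so only the term with 𝒩 survives.
    ≈⟨ solve 4 (λ E₁ t 𝒩 p → :- (con (+ 5) :* (con (+ 5) :* (E₁ :* (con (+ 5) :* (E₁ :^ 3 :* t))) :+ con (ℤ.- + 15) :* (E₁
        :^ 2 :* (con (+ 5) :* (E₁ :^ 2 :* t)))
          :+ con (+ 25) :* (E₁ :^ 3 :* (E₁ :* t)) :+ con (ℤ.- + 25) :* (E₁ :^ 4 :* :- t) :+ 𝒩 :* p)) := :- (con (+ 5) :* (𝒩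
              :* p))) S.refl E₁ (θ E₁) 𝒩 (proj 0 ℒ) ⟩
  ⊖ (const (+ 5) ⊗ (𝒩 ⊗ proj 0 ℒ)) ∎
  where
  open ≈-Reasoning
  power : ∀ k c → 𝒞 (suc k) ≈ const c ⊗ E₁ ↑ suc k ⊗ 𝒩 ↑ 0 → θ (𝒞 (suc k)) ≈ const c ⊗ (const (+ suc k) ⊗ (E₁ ↑ k ⊗ θ E₁))
  power k c e = S.trans (θ-cong (S.trans e (S.*-identityʳ _))) (S.trans (θ-const⊗ c (E₁ ↑ suc k)) (S.*-congˡ (θ-^ E₁ k)))
  part₄ : proj 4 (f ↑ 4 ⊗ ℒ) ≈ const (+ 5) ⊗ (E₁ ↑ 3 ⊗ θ E₁)
  part₄ = const-cancelˡ 3 _ _ (S.trans (proj-f^⊗ℒ 3) (S.trans (S.-‿cong (power 3 (ℤ.- + 5) 𝒞-4))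
    (solve 2 (λ E₁ t → :- (con (ℤ.- + 5) :* (con (+ 4) :* (E₁ :^ 3 :* t))) := con (+ 4) :* (con (+ 5) :* (E₁ :^ 3 :* t)))
        S.refl E₁ (θ E₁))))
  part₃ : proj 3 (f ↑ 3 ⊗ ℒ) ≈ const (+ 5) ⊗ (E₁ ↑ 2 ⊗ θ E₁)
  part₃ = const-cancelˡ 2 _ _ (S.trans (proj-f^⊗ℒ 2) (S.trans (S.-‿cong (power 2 (ℤ.- + 5) 𝒞-3))
    (solve 2 (λ E₁ t → :- (con (ℤ.- + 5) :* (con (+ 3) :* (E₁ :^ 2 :* t))) := con (+ 3) :* (con (+ 5) :* (E₁ :^ 2 :* t)))
        S.refl E₁ (θ E₁))))
  part₂ : proj 2 (f ↑ 2 ⊗ ℒ) ≈ E₁ ⊗ θ E₁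
  part₂ = const-cancelˡ 1 _ _ (S.trans (proj-f^⊗ℒ 1) (S.trans (S.-‿cong (power 1 (ℤ.- + 1) 𝒞-2))
    (solve 2 (λ E₁ t → :- (con (ℤ.- + 1) :* (con (+ 2) :* (E₁ :^ 1 :* t))) := con (+ 2) :* (E₁ :* t)) S.refl E₁ (θ E₁))))
  part₁ : proj 1 (f ↑ 1 ⊗ ℒ) ≈ ⊖ θ E₁
  part₁ = const-cancelˡ 0 _ _ (S.trans (proj-f^⊗ℒ 0) (S.trans (S.-‿cong (power 0 (+ 1) 𝒞-1))
    (solve 1 (λ t → :- (con (+ 1) :* (con (+ 1) :* (con 1ℤ :* t))) := con (+ 1) :* :- t) S.refl (θ E₁))))

-- Lambert series and σ₁(5n)

ones : Series
ones zero    = 0ℤ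
ones (suc _) = 1ℤ

-- This is k qᵏ/(1 - qᵏ), minus the logarithmic derivative of 1 - qᵏ.
lambert : (k : ℕ) .{{_ : NonZero k}} → Series
lambert k = const (+ k) ⊗ dil k ones

1-q^-⊗-dil-ones : ∀ k .{{_ : NonZero k}} → 1-q^ k ⊗ dil k ones ≈ q ↑ k
1-q^-⊗-dil-ones k = begin
  1-q^ k ⊗ dil k ones                  ≈⟨ S.*-congʳ (S.trans (dil-⊕ k 1s (⊖ q)) (S.+-cong (dil-const k 1ℤ) (S.trans (dil-⊖
      k q) (S.-‿cong (dil-q k))))) ⟨
  dil k (1s ⊕ ⊖ q) ⊗ dil k ones        ≈⟨ dil-⊗ k (1s ⊕ ⊖ q) ones ⟨
  dil k ((1s ⊕ ⊖ q) ⊗ ones)            ≈⟨ dil-cong k base ⟩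
  dil k q                              ≈⟨ dil-q k ⟩
  q ↑ k                                ∎
  where
  open ≈-Reasoning
  base : (1s ⊕ ⊖ q) ⊗ ones ≈ q
  base = S.trans (solve 2 (λ q a → (con 1ℤ :- q) :* a := a :- q :* a) S.refl q ones) (mk≈ λ
    { zero → refl ; (suc zero) → refl
    ; (suc (suc n)) → cong (λ t → 1ℤ ℤ.+ ℤ.- t) (q-⊗-suc ones (suc n)) })

lambertSum : ℕ → Series
lambertSum zero    = 0s
lambertSum (suc K) = lambertSum K ⊕ lambert (suc K)

θ-q^ : ∀ k → θ (q ↑ k) ≈ const (+ k) ⊗ q ↑ k
θ-q^ k = mk≈ λ n → trans (lem n) (sym (const-⊗ (+ k) (q ↑ k) n))
  where
  lem : ∀ n → + n ℤ.* (q ↑ k) n ≡ + k ℤ.* (q ↑ k) n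
  lem n with n ℕ.≟ k
  ... | yes refl = refl
  ... | no  n≢k rewrite q^-off k n n≢k = trans (ℤ.*-zeroʳ (+ n)) (sym (ℤ.*-zeroʳ (+ k)))

θ-g : ∀ K → θ (g K) ≈ ⊖ (g K ⊗ lambertSum K)
θ-g zero    = S.trans (θ-const 1ℤ) (solve 0 (con 0ℤ := :- (con 1ℤ :* con 0ℤ)) S.refl)
θ-g (suc K) = begin
  θ (1-q^ (suc K) ⊗ g K)
    ≈⟨ θ-⊗ (1-q^ (suc K)) (g K) ⟩
  θ (1-q^ (suc K)) ⊗ g K ⊕ 1-q^ (suc K) ⊗ θ (g K)
    ≈⟨ S.+-cong (S.*-congʳ factor) (S.*-congˡ (θ-g K)) ⟩
  ⊖ (const (+ suc K) ⊗ (1-q^ (suc K) ⊗ dil (suc K) ones)) ⊗ g K ⊕ 1-q^ (suc K) ⊗ ⊖ (g K ⊗ lambertSum K)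
    ≈⟨ solve 5 (λ c p d g s → :- (c :* (p :* d)) :* g :+ p :* :- (g :* s) := :- (p :* g :* (s :+ c :* d))) S.refl
         (const (+ suc K)) (1-q^ (suc K)) (dil (suc K) ones) (g K) (lambertSum K) ⟩
  ⊖ (g (suc K) ⊗ lambertSum (suc K)) ∎
  where
  open ≈-Reasoning
  factor : θ (1-q^ (suc K)) ≈ ⊖ (const (+ suc K) ⊗ (1-q^ (suc K) ⊗ dil (suc K) ones))
  factor = begin
    θ (1-q^ (suc K))                    ≈⟨ θ-⊕ 1s (⊖ (q ↑ suc K)) ⟩
    θ 1s ⊕ θ (⊖ (q ↑ suc K))            ≈⟨ S.+-cong (θ-const 1ℤ) (mk≈ λ n → sym (ℤ.neg-distribʳ-* (+ n) ((q ↑ suc K) n))) ⟩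
    0s ⊕ ⊖ θ (q ↑ suc K)                ≈⟨ S.+-identityˡ _ ⟩
    ⊖ θ (q ↑ suc K)                     ≈⟨ S.-‿cong (S.trans (θ-q^ (suc K)) (S.*-congˡ (S.sym (1-q^-⊗-dil-ones (suc K))))) ⟩
    _ ∎

ℒ-≈[] : ∀ M → ℒ ≈[ M ] lambertSum M
ℒ-≈[] M = ⊗-cancelˡ[] f f-0 (begin
  f ⊗ ℒ                  ≈⟨ ≈⇒≈[] f⊗ℒ ⟩
  ⊖ θ f                  ≈⟨ ⊖-cong[] (mk≈[] λ n n≤ → cong (λ t → + n ℤ.* t) (agree (f-≈[] M) n n≤)) ⟩
  ⊖ θ (g M)              ≈⟨ ≈⇒≈[] (S.trans (S.-‿cong (θ-g M)) (solve 1 (λ t → :- :- t := t) S.refl (g M ⊗ lambertSum M))) ⟩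
  g M ⊗ lambertSum M     ≈⟨ ⊗-cong[] (≈[].sym (f-≈[] M)) ≈[].refl ⟩
  f ⊗ lambertSum M       ∎)
  where open ≈[]-Reasoning M

prime-5 : Prime 5
prime-5 = from-yes (prime? 5)

dil-*5 : ∀ a j .{{_ : NonZero j}} .{{_ : NonZero (5 * j)}} → dil 5 (dil j a) ≈ dil (5 * j) a
dil-*5 a j = dil-unique 5 (dil j a) (dil (5 * j) a)
  (by-residue j _ (λ m → trans (trans (cong (dil (5 * j) a) (lem m j)) (dil-hit (5 * j) a m)) (sym (dil-hit j a m)))
    (λ n h → trans (dil-miss (5 * j) a (n * 5) (λ e → h (n∣m⇒m%n≡0 n j (*-cancelʳ-∣ 5 (subst (_∣ n * 5) (ℕ.*-comm 5 j)
        (m%n≡0⇒n∣m (n * 5) (5 * j) e))))))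
                   (sym (dil-miss j a n h))))
  (λ n h → dil-miss (5 * j) a n (λ e → h (n∣m⇒m%n≡0 n 5 (∣-trans (m∣m*n j) (m%n≡0⇒n∣m n (5 * j) e)))))
  where
  lem : ∀ m j → m * j * 5 ≡ m * (5 * j)
  lem = ℕ-Solver.solve-∀

ones-*5 : ∀ m → ones (m * 5) ≡ ones m
ones-*5 zero    = refl
ones-*5 (suc m) = refl

proj-dil-ones : ∀ k .{{_ : NonZero k}} → k % 5 ≢ 0 → proj 0 (dil k ones) ≈ dil 5 (dil k ones)
proj-dil-ones k k%5≢0 = S.sym (dil-unique 5 (dil k ones) (proj 0 (dil k ones))
  (λ m → trans (proj-hit (dil k ones) (n∣m⇒m%n≡0 (m * 5) 5 (n∣m*n m))) (hit m))
  (λ n h → proj-miss (dil k ones) h))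
  where
  lem : ∀ m k → m * k * 5 ≡ m * 5 * k
  lem = ℕ-Solver.solve-∀
  hit : ∀ m → dil k ones (m * 5) ≡ dil k ones m
  hit = by-residue k _
    (λ m → trans (cong (dil k ones) (lem m k)) (trans (dil-hit k ones (m * 5)) (trans (ones-*5 m) (sym (dil-hit k ones
        m)))))
    (λ n h → trans (dil-miss k ones (n * 5) (λ e → h (n∣m⇒m%n≡0 n k (coprime n (m%n≡0⇒n∣m (n * 5) k e))))) (sym (dil-miss k
        ones n h)))
    where
    coprime : ∀ n → k ∣ n * 5 → k ∣ n
    coprime n (divides s e) with euclidsLemma s k prime-5 (divides n (sym e))
    ... | inj₂ 5∣k = ⊥-elim (k%5≢0 (n∣m⇒m%n≡0 k 5 5∣k))
    ... | inj₁ (divides t refl) = divides t (ℕ.*-cancelʳ-≡ n (t * k) 5 (trans e (trans (lem₂ t k) refl)))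
      where
      lem₂ : ∀ t k → t * 5 * k ≡ t * k * 5
      lem₂ = ℕ-Solver.solve-∀

dil-const⊗ : ∀ k .{{_ : NonZero k}} c a → dil k (const c ⊗ a) ≈ const c ⊗ dil k a
dil-const⊗ k c a = S.trans (dil-⊗ k (const c) a) (S.*-congʳ (dil-const k c))

proj-lambert : ∀ k .{{_ : NonZero k}} → k % 5 ≢ 0 → proj 0 (lambert k) ≈ dil 5 (lambert k)
proj-lambert k h = S.trans (proj-const 0 (+ k) (dil k ones) (s≤s z≤n))
  (S.trans (S.*-congˡ (proj-dil-ones k h)) (S.sym (dil-const⊗ 5 (+ k) (dil k ones))))

lambert-*5 : ∀ j .{{_ : NonZero j}} .{{_ : NonZero (5 * j)}} → lambert (5 * j) ≈ const (+ 5) ⊗ dil 5 (lambert j)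
lambert-*5 j = begin
  const (+ (5 * j)) ⊗ dil (5 * j) ones             ≈⟨ S.*-cong coefficient (S.sym (dil-*5 ones j)) ⟩
  const (+ 5) ⊗ const (+ j) ⊗ dil 5 (dil j ones)       ≈⟨ S.*-assoc (const (+ 5)) (const (+ j)) (dil 5 (dil j ones)) ⟩
  const (+ 5) ⊗ (const (+ j) ⊗ dil 5 (dil j ones))     ≈⟨ S.*-congˡ (S.sym (dil-const⊗ 5 (+ j) (dil j ones))) ⟩
  const (+ 5) ⊗ dil 5 (lambert j)                      ∎
  where
  open ≈-Reasoning
  coefficient : const (+ (5 * j)) ≈ const (+ 5) ⊗ const (+ j)
  coefficient = mk≈ λ n → trans (lem n) (sym (const-⊗ (+ 5) (const (+ j)) n))
    where
    lem : ∀ n → const (+ (5 * j)) n ≡ + 5 ℤ.* const (+ j) n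
    lem zero    = ℤ.pos-* 5 j
    lem (suc n) = refl

lambert-≡ : ∀ {j k} .{{_ : NonZero j}} .{{_ : NonZero k}} → j ≡ k → lambert j ≈ lambert k
lambert-≡ refl = S.refl

-- On `lambert k` the projection acts as `dil 5` if 5 does not divide k, and as the identity if k =
-- 5j, where the series is 5 `dil 5 (lambert j)`. The last summand corrects for applying `dil 5` to
-- the multiples of 5 as well.
proj-lambertSum : ∀ J → proj 0 (lambertSum (J * 5)) ≈
  dil 5 (lambertSum (J * 5)) ⊕ const (+ 5) ⊗ dil 5 (lambertSum J) ⊕ ⊖ (const (+ 5) ⊗ dil25 (lambertSum J))
proj-lambertSum zero = S.trans (proj-self (onClass-const 0ℤ)) (S.sym (S.trans
  (S.+-cong (S.+-cong (dil-const 5 0ℤ) (S.*-congˡ (dil-const 5 0ℤ))) (S.-‿cong (S.*-congˡ (S.trans (dil-cong 5 (dil-const 5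
      0ℤ)) (dil-const 5 0ℤ)))))
  (solve 0 (con 0ℤ :+ con (+ 5) :* con 0ℤ :+ :- (con (+ 5) :* con 0ℤ) := con 0ℤ) S.refl)))
proj-lambertSum (suc J) = begin
  proj 0 (S ⊕ a 1 ⊕ a 2 ⊕ a 3 ⊕ a 4 ⊕ a 5)
    ≈⟨ S.trans (proj-⊕ 0 _ _) (S.+-congʳ (S.trans (proj-⊕ 0 _ _) (S.+-congʳ (S.trans (proj-⊕ 0 _ _) (S.+-congʳ (S.trans
        (proj-⊕ 0 _ _) (S.+-congʳ (proj-⊕ 0 _ _)))))))) ⟩
  proj 0 S ⊕ proj 0 (a 1) ⊕ proj 0 (a 2) ⊕ proj 0 (a 3) ⊕ proj 0 (a 4) ⊕ proj 0 (a 5)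
    ≈⟨ S.+-cong (S.+-cong (S.+-cong (S.+-cong (S.+-cong (proj-lambertSum J) (away 1 λ ())) (away 2 λ ())) (away 3 λ ()))
        (away 4 λ ())) proj-a₅ ⟩
  dil 5 S ⊕ const (+ 5) ⊗ dil 5 T′ ⊕ ⊖ (const (+ 5) ⊗ dil25 T′) ⊕ dil 5 (a 1) ⊕ dil 5 (a 2) ⊕ dil 5 (a 3) ⊕ dil 5 (a 4) ⊕
      const (+ 5) ⊗ dil 5 b
    ≈⟨ solve 9 (λ s t t′ a1 a2 a3 a4 b b′ →
         s :+ con (+ 5) :* t :+ :- (con (+ 5) :* t′) :+ a1 :+ a2 :+ a3 :+ a4 :+ con (+ 5) :* b :=
         s :+ a1 :+ a2 :+ a3 :+ a4 :+ con (+ 5) :* b′ :+ con (+ 5) :* (t :+ b) :+ :- (con (+ 5) :* (t′ :+ b′))) S.refl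
         (dil 5 S) (dil 5 T′) (dil25 T′) (dil 5 (a 1)) (dil 5 (a 2)) (dil 5 (a 3)) (dil 5 (a 4)) (dil 5 b) (dil25 b) ⟩
  dil 5 S ⊕ dil 5 (a 1) ⊕ dil 5 (a 2) ⊕ dil 5 (a 3) ⊕ dil 5 (a 4) ⊕ const (+ 5) ⊗ dil25 b
    ⊕ const (+ 5) ⊗ (dil 5 T′ ⊕ dil 5 b) ⊕ ⊖ (const (+ 5) ⊗ (dil25 T′ ⊕ dil25 b))
    ≈⟨ S.+-cong (S.+-cong expand (S.*-congˡ (dil-⊕ 5 T′ b))) (S.-‿cong (S.*-congˡ (dil25-⊕ T′ b))) ⟨
  dil 5 (S ⊕ a 1 ⊕ a 2 ⊕ a 3 ⊕ a 4 ⊕ a 5) ⊕ const (+ 5) ⊗ dil 5 (T′ ⊕ b) ⊕ ⊖ (const (+ 5) ⊗ dil25 (T′ ⊕ b)) ∎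
  where
  open ≈-Reasoning
  S = lambertSum (J * 5)
  T′ = lambertSum J
  a : (i : ℕ) .{{_ : NonZero i}} → Series
  a (suc i) = lambert (suc i + J * 5)
  b = lambert (suc J)
  away : ∀ i .{{_ : NonZero i}} → i % 5 ≢ 0 → proj 0 (a i) ≈ dil 5 (a i)
  away (suc i) h = proj-lambert (suc i + J * 5) λ e → h (trans (sym ([m+kn]%n≡m%n (suc i) J 5)) e)
  a₅ : a 5 ≈ const (+ 5) ⊗ dil 5 b
  a₅ = S.trans (lambert-≡ (ℕ.*-comm (suc J) 5)) (lambert-*5 (suc J))
  proj-a₅ : proj 0 (a 5) ≈ const (+ 5) ⊗ dil 5 b
  proj-a₅ = S.trans (proj-cong 0 a₅) (proj-self (onClass-⊗ (onClass-const (+ 5)) (onClass-dil b)))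
  expand : dil 5 (S ⊕ a 1 ⊕ a 2 ⊕ a 3 ⊕ a 4 ⊕ a 5) ≈ dil 5 S ⊕ dil 5 (a 1) ⊕ dil 5 (a 2) ⊕ dil 5 (a 3) ⊕ dil 5 (a 4) ⊕
      const (+ 5) ⊗ dil25 b
  expand = S.trans (dil-⊕ 5 (S ⊕ a 1 ⊕ a 2 ⊕ a 3 ⊕ a 4) (a 5)) (S.+-cong
    (S.trans (dil-⊕ 5 (S ⊕ a 1 ⊕ a 2 ⊕ a 3) (a 4)) (S.+-congʳ
    (S.trans (dil-⊕ 5 (S ⊕ a 1 ⊕ a 2) (a 3)) (S.+-congʳ
    (S.trans (dil-⊕ 5 (S ⊕ a 1) (a 2)) (S.+-congʳ
    (dil-⊕ 5 S (a 1))))))))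
    (S.trans (dil-cong 5 a₅) (dil-const⊗ 5 (+ 5) (dil 5 b))))

proj-cong[] : ∀ {M r a b} → a ≈[ M ] b → proj r a ≈[ M ] proj r b
proj-cong[] {M} {r} {a} {b} p = mk≈[] (proj-ind r (λ n → n ≤ M → proj r a n ≡ proj r b n)
  (λ n e n≤ → trans (proj-hit {n = n} a e) (trans (agree p n n≤) (sym (proj-hit {n = n} b e))))
  (λ n h _ → trans (proj-miss {n = n} a h) (sym (proj-miss {n = n} b h))))

-- In coefficients, σ₁(5n) = 6σ₁(n) - 5σ₁(n/5), the Hecke relation at 5.
proj-ℒ : proj 0 ℒ ≈ const (+ 6) ⊗ dil 5 ℒ ⊕ ⊖ (const (+ 5) ⊗ dil25 ℒ)
proj-ℒ = S.trans (≈[]⇒≈ limit)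
  (solve 2 (λ u v → u :+ con (+ 5) :* u :+ :- (con (+ 5) :* v) := con (+ 6) :* u :+ :- (con (+ 5) :* v)) S.refl (dil 5 ℒ)
      (dil25 ℒ))
  where
  limit : ∀ M → proj 0 ℒ ≈[ M ] dil 5 ℒ ⊕ const (+ 5) ⊗ dil 5 ℒ ⊕ ⊖ (const (+ 5) ⊗ dil25 ℒ)
  limit M = ≈[].trans (proj-cong[] big) (≈[].trans (≈⇒≈[] (proj-lambertSum M))
    (⊕-cong[] (⊕-cong[] (dil-cong[] 5 (≈[].sym big)) (⊗-cong[] ≈[].refl (dil-cong[] 5 small)))
      (⊖-cong[] (⊗-cong[] ≈[].refl (dil-cong[] 5 (dil-cong[] 5 small))))))
    where
    big : ℒ ≈[ M ] lambertSum (M * 5)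
    big = ≈[]-weaken (ℕ.m≤m*n M 5) (ℒ-≈[] (M * 5))
    small : lambertSum M ≈[ M ] ℒ
    small = ≈[].sym (ℒ-≈[] M)

θf≈ : θ f ≈ ⊖ (f ⊗ ℒ)
θf≈ = S.trans (solve 1 (λ t → t := :- :- t) S.refl (θ f)) (S.-‿cong (S.sym f⊗ℒ))

θ-f₅ : θ f₅ ≈ ⊖ (const (+ 5) ⊗ (f₅ ⊗ dil 5 ℒ))
θ-f₅ = begin
  θ f₅                                    ≈⟨ θ-dil 5 f ⟩
  const (+ 5) ⊗ dil 5 (θ f)               ≈⟨ S.*-congˡ (S.trans (dil-cong 5 θf≈) (S.trans (dil-⊖ 5 (f ⊗ ℒ)) (S.-‿cong
      (dil-⊗ 5 f ℒ)))) ⟩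
  const (+ 5) ⊗ ⊖ (f₅ ⊗ dil 5 ℒ)          ≈⟨ solve 2 (λ c t → c :* :- t := :- (c :* t)) S.refl (const (+ 5)) (f₅ ⊗ dil 5 ℒ)
      ⟩
  ⊖ (const (+ 5) ⊗ (f₅ ⊗ dil 5 ℒ))        ∎
  where open ≈-Reasoning

θ-f₂₅ : θ f₂₅ ≈ ⊖ (const (+ 25) ⊗ (f₂₅ ⊗ dil25 ℒ))
θ-f₂₅ = begin
  θ f₂₅                                   ≈⟨ θ-dil 5 f₅ ⟩
  const (+ 5) ⊗ dil 5 (θ f₅)              ≈⟨ S.*-congˡ (S.trans (dil-cong 5 θ-f₅) (S.trans (dil-⊖ 5 (const (+ 5) ⊗ (f₅ ⊗
      dil 5 ℒ)))
                                               (S.-‿cong (S.trans (dil-const⊗ 5 (+ 5) (f₅ ⊗ dil 5 ℒ)) (S.*-congˡ (dil-⊗ 5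
                                                   f₅ (dil 5 ℒ))))))) ⟩
  const (+ 5) ⊗ ⊖ (const (+ 5) ⊗ (f₂₅ ⊗ dil25 ℒ))
                                          ≈⟨ solve 1 (λ t → con (+ 5) :* :- (con (+ 5) :* t) := :- (con (+ 25) :* t))
                                              S.refl (f₂₅ ⊗ dil25 ℒ) ⟩
  ⊖ (const (+ 25) ⊗ (f₂₅ ⊗ dil25 ℒ))      ∎
  where open ≈-Reasoning

-- Both sides have logarithmic derivative −30 Σ σ₁(n) q⁵ⁿ.
norm : 𝒩 ⊗ f₂₅ ≈ f₅ ↑ 6
norm = θ-unique {w = ⊖ (const (+ 30) ⊗ dil 5 ℒ)} refl refl
  (begin
    θ (𝒩 ⊗ f₂₅)
      ≈⟨ θ-⊗ 𝒩 f₂₅ ⟩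
    θ 𝒩 ⊗ f₂₅ ⊕ 𝒩 ⊗ θ f₂₅
      ≈⟨ S.+-cong (S.*-congʳ (S.trans θ-𝒩 (S.-‿cong (S.*-congˡ {x = const (+ 5)} (S.*-congˡ {x = 𝒩} proj-ℒ))))) (S.*-congˡ
          {x = 𝒩} θ-f₂₅) ⟩
    ⊖ (const (+ 5) ⊗ (𝒩 ⊗ (const (+ 6) ⊗ dil 5 ℒ ⊕ ⊖ (const (+ 5) ⊗ dil25 ℒ)))) ⊗ f₂₅ ⊕ 𝒩 ⊗ ⊖ (const (+ 25) ⊗ (f₂₅ ⊗ dil25
        ℒ))
      ≈⟨ solve 4 (λ 𝒩 e u v → :- (con (+ 5) :* (𝒩 :* (con (+ 6) :* u :+ :- (con (+ 5) :* v)))) :* e :+ 𝒩 :* :- (con (+ 25)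
          :* (e :* v)) := 𝒩 :* e :* :- (con (+ 30) :* u)) S.refl
           𝒩 f₂₅ (dil 5 ℒ) (dil25 ℒ) ⟩
    𝒩 ⊗ f₂₅ ⊗ ⊖ (const (+ 30) ⊗ dil 5 ℒ) ∎)
  (begin
    θ (f₅ ↑ 6)
      ≈⟨ θ-^ f₅ 5 ⟩
    const (+ 6) ⊗ (f₅ ↑ 5 ⊗ θ f₅)
      ≈⟨ S.*-congˡ {x = const (+ 6)} (S.*-congˡ {x = f₅ ↑ 5} θ-f₅) ⟩
    const (+ 6) ⊗ (f₅ ↑ 5 ⊗ ⊖ (const (+ 5) ⊗ (f₅ ⊗ dil 5 ℒ)))
      ≈⟨ solve 2 (λ a u → con (+ 6) :* (a :^ 5 :* :- (con (+ 5) :* (a :* u))) := a :^ 6 :* :- (con (+ 30) :* u)) S.refl f₅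
          (dil 5 ℒ) ⟩
    f₅ ↑ 6 ⊗ ⊖ (const (+ 30) ⊗ dil 5 ℒ) ∎)
  where open ≈-Reasoning

-- The action of U on eta products

f₅⁻¹ f₂₅⁻¹ : Series
f₅⁻¹ = dil 5 f⁻¹
f₂₅⁻¹ = dil 5 f₅⁻¹

f₅⊗f₅⁻¹ : f₅ ⊗ f₅⁻¹ ≈ 1s
f₅⊗f₅⁻¹ = S.trans (S.sym (dil-⊗ 5 f f⁻¹)) (S.trans (dil-cong 5 f⊗f⁻¹) (dil-const 5 1ℤ))

f₂₅⊗f₂₅⁻¹ : f₂₅ ⊗ f₂₅⁻¹ ≈ 1s
f₂₅⊗f₂₅⁻¹ = S.trans (S.sym (dil-⊗ 5 f₅ f₅⁻¹)) (S.trans (dil-cong 5 f₅⊗f₅⁻¹) (dil-const 5 1ℤ))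

-- Up to a power of q these are eta quotients of weight 6; U 1 maps the span of the vᵢ to that of the
-- wᵢ, and U 3 maps back.
v₀ v₁ v₂ w₀ w₁ w₂ : Series
v₀ = f ↑ 11 ⊗ f₅
v₁ = q ⊗ f ↑ 5 ⊗ f₅ ↑ 7
v₂ = q ↑ 2 ⊗ f⁻¹ ⊗ f₅ ↑ 13
w₀ = f ↑ 13 ⊗ f₅⁻¹
w₁ = q ⊗ f ↑ 7 ⊗ f₅ ↑ 5
w₂ = q ↑ 2 ⊗ f ⊗ f₅ ↑ 11

dil-v₀ : dil 5 v₀ ≈ f₅ ↑ 11 ⊗ f₂₅
dil-v₀ = S.trans (dil-⊗ 5 (f ↑ 11) f₅) (S.*-congʳ (dil-^ 5 f 11))

dil-three : ∀ a b c {a′ b′ c′} → dil 5 a ≈ a′ → dil 5 b ≈ b′ → dil 5 c ≈ c′ → dil 5 (a ⊗ b ⊗ c) ≈ a′ ⊗ b′ ⊗ c′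
dil-three a b c p r s = S.trans (dil-⊗ 5 (a ⊗ b) c) (⊗-cong (S.trans (dil-⊗ 5 a b) (⊗-cong p r)) s)

dil-v₁ : dil 5 v₁ ≈ q ↑ 5 ⊗ f₅ ↑ 5 ⊗ f₂₅ ↑ 7
dil-v₁ = dil-three q (f ↑ 5) (f₅ ↑ 7) (dil-q 5) (dil-^ 5 f 5) (dil-^ 5 f₅ 7)

dil-v₂ : dil 5 v₂ ≈ q ↑ 10 ⊗ f₅⁻¹ ⊗ f₂₅ ↑ 13
dil-v₂ = dil-three (q ↑ 2) f⁻¹ (f₅ ↑ 13) (dil-q^ 5 2) S.refl (dil-^ 5 f₅ 13)

dil-w₀ : dil 5 w₀ ≈ f₅ ↑ 13 ⊗ f₂₅⁻¹
dil-w₀ = S.trans (dil-⊗ 5 (f ↑ 13) f₅⁻¹) (S.*-congʳ (dil-^ 5 f 13))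

dil-w₁ : dil 5 w₁ ≈ q ↑ 5 ⊗ f₅ ↑ 7 ⊗ f₂₅ ↑ 5
dil-w₁ = dil-three q (f ↑ 7) (f₅ ↑ 5) (dil-q 5) (dil-^ 5 f 7) (dil-^ 5 f₅ 5)

dil-w₂ : dil 5 w₂ ≈ q ↑ 10 ⊗ f₅ ⊗ f₂₅ ↑ 11
dil-w₂ = dil-three (q ↑ 2) f (f₅ ↑ 11) (dil-q^ 5 2) S.refl (dil-^ 5 f₅ 11)

𝒩≈ : 𝒩 ≈ f₅ ↑ 6 ⊗ f₂₅⁻¹
𝒩≈ = begin
  𝒩                        ≈⟨ S.*-identityʳ 𝒩 ⟨
  𝒩 ⊗ 1s                   ≈⟨ S.*-congˡ {x = 𝒩} f₂₅⊗f₂₅⁻¹ ⟨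
  𝒩 ⊗ (f₂₅ ⊗ f₂₅⁻¹)        ≈⟨ S.*-assoc 𝒩 f₂₅ f₂₅⁻¹ ⟨
  𝒩 ⊗ f₂₅ ⊗ f₂₅⁻¹          ≈⟨ S.*-congʳ norm ⟩
  f₅ ↑ 6 ⊗ f₂₅⁻¹           ∎
  where open ≈-Reasoning

-- The factor f₂₅ of `E₁` cancels the denominator of 𝒩. Pairing the two leaves f₂₅⁻¹ only where it
-- belongs to the dilation of `w₀`.
E₁𝒩 : E₁ ⊗ 𝒩 ≈ ⊖ (q ⊗ f₅ ↑ 6)
E₁𝒩 = S.trans (solve 3 (λ q e 𝒩 → :- (q :* e) :* 𝒩 := :- (q :* (𝒩 :* e))) S.refl q f₂₅ 𝒩) (S.-‿cong (S.*-congˡ {x = q}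
    norm))

onClass-^ : ∀ a k → OnClass 0 a → OnClass 0 (a ↑ k)
onClass-^ a zero    c = onClass-const 1ℤ
onClass-^ a (suc k) c = onClass-⊗ c (onClass-^ a k c)

comb : ℤ → ℤ → ℤ → Series → Series → Series → Series
comb a b c s t u = const a ⊗ s ⊕ const b ⊗ t ⊕ const c ⊗ u

dil-comb : ∀ a b c s t u → dil 5 (comb a b c s t u) ≈ comb a b c (dil 5 s) (dil 5 t) (dil 5 u)
dil-comb a b c s t u = S.trans (dil-⊕ 5 (const a ⊗ s ⊕ const b ⊗ t) (const c ⊗ u)) (S.+-cong
  (S.trans (dil-⊕ 5 (const a ⊗ s) (const b ⊗ t)) (S.+-cong (dil-const⊗ 5 a s) (dil-const⊗ 5 b t))) (dil-const⊗ 5 c u))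

comb-cong : ∀ {a b c s t u s′ t′ u′} → s ≈ s′ → t ≈ t′ → u ≈ u′ → comb a b c s t u ≈ comb a b c s′ t′ u′
comb-cong p r s = S.+-cong (S.+-cong (S.*-congˡ p) (S.*-congˡ r)) (S.*-congˡ s)

-- The pattern for all six basis series: powers of q and series in q⁵ leave the projection, the
-- remaining class part of a power of f is inserted, and E₁ = -q f₂₅ together with the norm formula
-- turns the result into qʳ times a dilation.
U₁-v₀ : U 1 v₀ ≈ comb (ℤ.- + 11) (ℤ.- + 275) (ℤ.- + 3125) w₀ w₁ w₂
U₁-v₀ = U-proj 1 v₀ (comb (ℤ.- + 11) (ℤ.- + 275) (ℤ.- + 3125) w₀ w₁ w₂) (s≤s (s≤s z≤n)) (begin
  proj 1 (f ↑ 11 ⊗ f₅)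
    ≈⟨ proj-cong 1 (S.*-comm (f ↑ 11) f₅) ⟩
  proj 1 (f₅ ⊗ f ↑ 11)
    ≈⟨ proj-⊗ 0 1 (f ↑ 11) (s≤s (s≤s z≤n)) (onClass-dil f) ⟩
  f₅ ⊗ 𝒞 11
    ≈⟨ S.*-congˡ {x = f₅} (S.trans 𝒞-11 (solve 2 (λ E₁ 𝒩 → con (+ 3125) :* E₁ :^ 11 :* 𝒩 :^ 0 :+ con (ℤ.- + 275) :* E₁ :^ 6
        :* 𝒩 :^ 1 :+ con (+ 11) :* E₁ :^ 1 :* 𝒩 :^ 2
        := con (+ 3125) :* E₁ :^ 11 :+ con (ℤ.- + 275) :* E₁ :^ 5 :* (E₁ :* 𝒩) :+ con (+ 11) :* (E₁ :* 𝒩) :* 𝒩) S.refl E₁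
            𝒩)) ⟩
  f₅ ⊗ (const (+ 3125) ⊗ E₁ ↑ 11 ⊕ const (ℤ.- + 275) ⊗ E₁ ↑ 5 ⊗ (E₁ ⊗ 𝒩) ⊕ const (+ 11) ⊗ (E₁ ⊗ 𝒩) ⊗ 𝒩)
    ≈⟨ S.*-congˡ {x = f₅} (S.+-cong (S.+-congˡ {x = const (+ 3125) ⊗ E₁ ↑ 11} (S.*-congˡ E₁𝒩)) (⊗-cong (S.*-congˡ E₁𝒩) 𝒩≈))
        ⟩
  f₅ ⊗ (const (+ 3125) ⊗ E₁ ↑ 11 ⊕ const (ℤ.- + 275) ⊗ E₁ ↑ 5 ⊗ ⊖ (q ⊗ f₅ ↑ 6) ⊕ const (+ 11) ⊗ ⊖ (q ⊗ f₅ ↑ 6) ⊗ (f₅ ↑ 6 ⊗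
      f₂₅⁻¹))
    ≈⟨ solve 4 (λ q h e p → h :* (con (+ 3125) :* (:- (q :* e)) :^ 11 :+ con (ℤ.- + 275) :* (:- (q :* e)) :^ 5 :* :- (q :*
        h :^ 6) :+ con (+ 11) :* :- (q :* h :^ 6) :* (h :^ 6 :* p))
         := q :^ 1 :* (con (ℤ.- + 11) :* (h :^ 13 :* p) :+ con (ℤ.- + 275) :* (q :^ 5 :* h :^ 7 :* e :^ 5) :+ con (ℤ.- +
             3125) :* (q :^ 10 :* h :* e :^ 11))) S.refl q f₅ f₂₅ f₂₅⁻¹ ⟩
  q ↑ 1 ⊗ comb (ℤ.- + 11) (ℤ.- + 275) (ℤ.- + 3125) (f₅ ↑ 13 ⊗ f₂₅⁻¹) (q ↑ 5 ⊗ f₅ ↑ 7 ⊗ f₂₅ ↑ 5) (q ↑ 10 ⊗ f₅ ⊗ f₂₅ ↑ 11)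
    ≈⟨ S.*-congˡ {x = q ↑ 1} (S.trans (dil-comb (ℤ.- + 11) (ℤ.- + 275) (ℤ.- + 3125) w₀ w₁ w₂) (comb-cong dil-w₀ dil-w₁
        dil-w₂)) ⟨
  q ↑ 1 ⊗ dil 5 (comb (ℤ.- + 11) (ℤ.- + 275) (ℤ.- + 3125) w₀ w₁ w₂) ∎)
  where open ≈-Reasoning

onClass-q : OnClass 1 q
onClass-q = onClass-≈ (S.*-identityʳ q) (onClass-q^ 1)

onClass-f₅^ : ∀ k → OnClass 0 (f₅ ↑ k)
onClass-f₅^ k = onClass-^ f₅ k (onClass-dil f)

U₁-v₁ : U 1 v₁ ≈ comb (+ 1) (+ 0) (+ 0) w₀ w₁ w₂
U₁-v₁ = U-proj 1 v₁ (comb (+ 1) (+ 0) (+ 0) w₀ w₁ w₂) (s≤s (s≤s z≤n)) (begin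
  proj 1 (q ⊗ f ↑ 5 ⊗ f₅ ↑ 7)
    ≈⟨ proj-cong 1 (solve 3 (λ a b c → a :* b :* c := (a :* c) :* b) S.refl q (f ↑ 5) (f₅ ↑ 7)) ⟩
  proj 1 (q ⊗ f₅ ↑ 7 ⊗ f ↑ 5)
    ≈⟨ proj-⊗ 1 0 (f ↑ 5) (s≤s z≤n) (onClass-⊗ onClass-q (onClass-f₅^ 7)) ⟩
  q ⊗ f₅ ↑ 7 ⊗ 𝒞 5
    ≈⟨ S.*-congˡ {x = q ⊗ f₅ ↑ 7} (S.trans 𝒞-5 (S.trans (solve 2 (λ E₁ 𝒩 → con (+ 1) :* E₁ :^ 0 :* 𝒩 :^ 1 := 𝒩) S.refl E₁
        𝒩) 𝒩≈)) ⟩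
  q ⊗ f₅ ↑ 7 ⊗ (f₅ ↑ 6 ⊗ f₂₅⁻¹)
    ≈⟨ solve 5 (λ q h p s t → q :* h :^ 7 :* (h :^ 6 :* p) := q :^ 1 :* (con (+ 1) :* (h :^ 13 :* p) :+ con (+ 0) :* s :+
        con (+ 0) :* t)) S.refl q f₅ f₂₅⁻¹ (dil 5 w₁) (dil 5 w₂) ⟩
  q ↑ 1 ⊗ comb (+ 1) (+ 0) (+ 0) (f₅ ↑ 13 ⊗ f₂₅⁻¹) (dil 5 w₁) (dil 5 w₂)
    ≈⟨ S.*-congˡ {x = q ↑ 1} (S.trans (dil-comb (+ 1) (+ 0) (+ 0) w₀ w₁ w₂) (comb-cong dil-w₀ (S.refl {dil 5 w₁}) (S.refl
        {dil 5 w₂}))) ⟨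
  q ↑ 1 ⊗ dil 5 (comb (+ 1) (+ 0) (+ 0) w₀ w₁ w₂) ∎)
  where open ≈-Reasoning

f^⊗f⁻¹ : ∀ k → f ↑ suc k ⊗ f⁻¹ ≈ f ↑ k
f^⊗f⁻¹ k = S.trans (solve 3 (λ f p i → f :* p :* i := p :* (f :* i)) S.refl f (f ↑ k) f⁻¹)
  (S.trans (S.*-congˡ {x = f ↑ k} f⊗f⁻¹) (S.*-identityʳ (f ↑ k)))

-- Equivalent to Ramanujan's identity for the partition function at 5n + 4.
proj-f⁻¹ : f₅ ↑ 6 ⊗ proj 4 f⁻¹ ≈ const (+ 5) ⊗ E₁ ↑ 4 ⊗ f₂₅
proj-f⁻¹ = begin
  f₅ ↑ 6 ⊗ p
    ≈⟨ S.*-congʳ norm ⟨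
  𝒩 ⊗ f₂₅ ⊗ p
    -- The recurrence for `𝒞` run backwards to k = -1: the known terms add up to (-25 + 15 + 25 -
    -- 25) E₁⁴ = -10 E₁⁴, while `𝒞 4` is -5 E₁⁴.
    ≈⟨ solve 4 (λ 𝒩 e p E₁ → 𝒩 :* e :* p :=
         ((con (+ 5) :* (E₁ :* (con (ℤ.- + 5) :* E₁ :^ 3 :* 𝒩 :^ 0)) :+ con (ℤ.- + 15) :* (E₁ :^ 2 :* (con (ℤ.- + 1) :* E₁
             :^ 2 :* 𝒩 :^ 0))
           :+ con (+ 25) :* (E₁ :^ 3 :* (con (+ 1) :* E₁ :^ 1 :* 𝒩 :^ 0)) :+ con (ℤ.- + 25) :* (E₁ :^ 4 :* (con (+ 1) :* E₁
               :^ 0 :* 𝒩 :^ 0)) :+ 𝒩 :* p)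
         :+ con (+ 10) :* E₁ :^ 4) :* e) S.refl 𝒩 f₂₅ p E₁ ⟩
  (quinticTail (const (ℤ.- + 5) ⊗ E₁ ↑ 3 ⊗ 𝒩 ↑ 0) (const (ℤ.- + 1) ⊗ E₁ ↑ 2 ⊗ 𝒩 ↑ 0) (const (+ 1) ⊗ E₁ ↑ 1 ⊗ 𝒩 ↑ 0) (const
      (+ 1) ⊗ E₁ ↑ 0 ⊗ 𝒩 ↑ 0) p ⊕ const (+ 10) ⊗ E₁ ↑ 4) ⊗ f₂₅
    ≈⟨ S.*-congʳ (S.+-congʳ (quinticTail-cong (step 3 𝒞-3) (step 2 𝒞-2) (step 1 𝒞-1) (step 0 𝒞-0) (S.refl {p}))) ⟨
  (quinticTail (proj 3 (f ↑ 4 ⊗ f⁻¹)) (proj 2 (f ↑ 3 ⊗ f⁻¹)) (proj 1 (f ↑ 2 ⊗ f⁻¹)) (proj 0 (f ↑ 1 ⊗ f⁻¹)) p ⊕ const (+ 10)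
      ⊗ E₁ ↑ 4) ⊗ f₂₅
    ≈⟨ S.*-congʳ (S.+-congʳ (S.trans (S.sym (proj-quintic 4 f⁻¹ ℕ.≤-refl)) (step 4 𝒞-4))) ⟩
  (const (ℤ.- + 5) ⊗ E₁ ↑ 4 ⊗ 𝒩 ↑ 0 ⊕ const (+ 10) ⊗ E₁ ↑ 4) ⊗ f₂₅
    ≈⟨ solve 3 (λ 𝒩 e E₁ → (con (ℤ.- + 5) :* E₁ :^ 4 :* 𝒩 :^ 0 :+ con (+ 10) :* E₁ :^ 4) :* e := con (+ 5) :* E₁ :^ 4 :* e)
        S.refl 𝒩 f₂₅ E₁ ⟩
  const (+ 5) ⊗ E₁ ↑ 4 ⊗ f₂₅ ∎
  where
  open ≈-Reasoning
  p = proj 4 f⁻¹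
  step : ∀ k {v} → 𝒞 k ≈ v → proj (k % 5) (f ↑ suc k ⊗ f⁻¹) ≈ v
  step k e = S.trans (proj-cong (k % 5) (f^⊗f⁻¹ k)) e

U₁-v₂ : U 1 v₂ ≈ comb (+ 0) (+ 5) (+ 0) w₀ w₁ w₂
U₁-v₂ = U-proj 1 v₂ (comb (+ 0) (+ 5) (+ 0) w₀ w₁ w₂) (s≤s (s≤s z≤n)) (begin
  proj 1 (q ↑ 2 ⊗ f⁻¹ ⊗ f₅ ↑ 13)
    ≈⟨ proj-cong 1 (solve 3 (λ a b c → a :* b :* c := (a :* c) :* b) S.refl (q ↑ 2) f⁻¹ (f₅ ↑ 13)) ⟩
  proj 1 (q ↑ 2 ⊗ f₅ ↑ 13 ⊗ f⁻¹)
    ≈⟨ proj-⊗ 2 4 f⁻¹ ℕ.≤-refl (onClass-⊗ (onClass-q^ 2) (onClass-f₅^ 13)) ⟩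
  q ↑ 2 ⊗ f₅ ↑ 13 ⊗ proj 4 f⁻¹
    ≈⟨ solve 3 (λ q h p → q :^ 2 :* h :^ 13 :* p := q :^ 2 :* h :^ 7 :* (h :^ 6 :* p)) S.refl q f₅ (proj 4 f⁻¹) ⟩
  q ↑ 2 ⊗ f₅ ↑ 7 ⊗ (f₅ ↑ 6 ⊗ proj 4 f⁻¹)
    ≈⟨ S.*-congˡ {x = q ↑ 2 ⊗ f₅ ↑ 7} proj-f⁻¹ ⟩
  q ↑ 2 ⊗ f₅ ↑ 7 ⊗ (const (+ 5) ⊗ E₁ ↑ 4 ⊗ f₂₅)
    ≈⟨ solve 5 (λ q h e s t → q :^ 2 :* h :^ 7 :* (con (+ 5) :* (:- (q :* e)) :^ 4 :* e) := q :^ 1 :* (con (+ 0) :* s :+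
        con (+ 5) :* (q :^ 5 :* h :^ 7 :* e :^ 5) :+ con (+ 0) :* t)) S.refl
         q f₅ f₂₅ (dil 5 w₀) (dil 5 w₂) ⟩
  q ↑ 1 ⊗ comb (+ 0) (+ 5) (+ 0) (dil 5 w₀) (q ↑ 5 ⊗ f₅ ↑ 7 ⊗ f₂₅ ↑ 5) (dil 5 w₂)
    ≈⟨ S.*-congˡ {x = q ↑ 1} (S.trans (dil-comb (+ 0) (+ 5) (+ 0) w₀ w₁ w₂) (comb-cong (S.refl {dil 5 w₀}) dil-w₁ (S.refl
        {dil 5 w₂}))) ⟨
  q ↑ 1 ⊗ dil 5 (comb (+ 0) (+ 5) (+ 0) w₀ w₁ w₂) ∎)
  where open ≈-Reasoning

U₃-w₀ : U 3 w₀ ≈ comb (ℤ.- + 130) (+ 0) (+ 15625) v₀ v₁ v₂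
U₃-w₀ = U-proj 3 w₀ (comb (ℤ.- + 130) (+ 0) (+ 15625) v₀ v₁ v₂) (s≤s (s≤s (s≤s (s≤s z≤n)))) (begin
  proj 3 (f ↑ 13 ⊗ f₅⁻¹)
    ≈⟨ proj-cong 3 (S.*-comm (f ↑ 13) f₅⁻¹) ⟩
  proj 3 (f₅⁻¹ ⊗ f ↑ 13)
    ≈⟨ proj-⊗ 0 3 (f ↑ 13) (s≤s (s≤s (s≤s (s≤s z≤n)))) (onClass-dil f⁻¹) ⟩
  f₅⁻¹ ⊗ 𝒞 13
    ≈⟨ S.*-congˡ {x = f₅⁻¹} (S.trans 𝒞-13 (solve 2 (λ E₁ 𝒩 → con (ℤ.- + 15625) :* E₁ :^ 13 :* 𝒩 :^ 0 :+ con (+ 130) :* E₁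
        :^ 3 :* 𝒩 :^ 2
        := con (ℤ.- + 15625) :* E₁ :^ 13 :+ con (+ 130) :* E₁ :* ((E₁ :* 𝒩) :* (E₁ :* 𝒩))) S.refl E₁ 𝒩)) ⟩
  f₅⁻¹ ⊗ (const (ℤ.- + 15625) ⊗ E₁ ↑ 13 ⊕ const (+ 130) ⊗ E₁ ⊗ ((E₁ ⊗ 𝒩) ⊗ (E₁ ⊗ 𝒩)))
    ≈⟨ S.*-congˡ {x = f₅⁻¹} (S.+-congˡ {x = const (ℤ.- + 15625) ⊗ E₁ ↑ 13} (S.*-congˡ {x = const (+ 130) ⊗ E₁} (⊗-cong E₁𝒩
        E₁𝒩))) ⟩
  f₅⁻¹ ⊗ (const (ℤ.- + 15625) ⊗ E₁ ↑ 13 ⊕ const (+ 130) ⊗ E₁ ⊗ (⊖ (q ⊗ f₅ ↑ 6) ⊗ ⊖ (q ⊗ f₅ ↑ 6)))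
    ≈⟨ solve 4 (λ q h e s → s :* (con (ℤ.- + 15625) :* (:- (q :* e)) :^ 13 :+ con (+ 130) :* :- (q :* e) :* (:- (q :* h :^
        6) :* :- (q :* h :^ 6)))
         := q :^ 3 :* (con (ℤ.- + 130) :* (h :^ 11 :* e) :* (h :* s) :+ con (+ 15625) :* (q :^ 10 :* s :* e :^ 13))) S.refl
             q f₅ f₂₅ f₅⁻¹ ⟩
  q ↑ 3 ⊗ (const (ℤ.- + 130) ⊗ (f₅ ↑ 11 ⊗ f₂₅) ⊗ (f₅ ⊗ f₅⁻¹) ⊕ const (+ 15625) ⊗ (q ↑ 10 ⊗ f₅⁻¹ ⊗ f₂₅ ↑ 13))
    ≈⟨ S.*-congˡ {x = q ↑ 3} (S.+-congʳ (S.*-congˡ {x = const (ℤ.- + 130) ⊗ (f₅ ↑ 11 ⊗ f₂₅)} f₅⊗f₅⁻¹)) ⟩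
  q ↑ 3 ⊗ (const (ℤ.- + 130) ⊗ (f₅ ↑ 11 ⊗ f₂₅) ⊗ 1s ⊕ const (+ 15625) ⊗ (q ↑ 10 ⊗ f₅⁻¹ ⊗ f₂₅ ↑ 13))
    ≈⟨ solve 4 (λ Q a b c → Q :* (con (ℤ.- + 130) :* a :* con 1ℤ :+ con (+ 15625) :* c) := Q :* (con (ℤ.- + 130) :* a :+
        con (+ 0) :* b :+ con (+ 15625) :* c)) S.refl
         (q ↑ 3) (f₅ ↑ 11 ⊗ f₂₅) (dil 5 v₁) (q ↑ 10 ⊗ f₅⁻¹ ⊗ f₂₅ ↑ 13) ⟩
  q ↑ 3 ⊗ comb (ℤ.- + 130) (+ 0) (+ 15625) (f₅ ↑ 11 ⊗ f₂₅) (dil 5 v₁) (q ↑ 10 ⊗ f₅⁻¹ ⊗ f₂₅ ↑ 13)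
    ≈⟨ S.*-congˡ {x = q ↑ 3} (S.trans (dil-comb (ℤ.- + 130) (+ 0) (+ 15625) v₀ v₁ v₂) (comb-cong dil-v₀ (S.refl {dil 5 v₁})
        dil-v₂)) ⟨
  q ↑ 3 ⊗ dil 5 (comb (ℤ.- + 130) (+ 0) (+ 15625) v₀ v₁ v₂) ∎)
  where open ≈-Reasoning

U₃-w₁ : U 3 w₁ ≈ comb (+ 14) (+ 125) (+ 0) v₀ v₁ v₂
U₃-w₁ = U-proj 3 w₁ (comb (+ 14) (+ 125) (+ 0) v₀ v₁ v₂) (s≤s (s≤s (s≤s (s≤s z≤n)))) (begin
  proj 3 (q ⊗ f ↑ 7 ⊗ f₅ ↑ 5)
    ≈⟨ proj-cong 3 (solve 3 (λ a b c → a :* b :* c := (a :* c) :* b) S.refl q (f ↑ 7) (f₅ ↑ 5)) ⟩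
  proj 3 (q ⊗ f₅ ↑ 5 ⊗ f ↑ 7)
    ≈⟨ proj-⊗ 1 2 (f ↑ 7) (s≤s (s≤s (s≤s z≤n))) (onClass-⊗ onClass-q (onClass-f₅^ 5)) ⟩
  q ⊗ f₅ ↑ 5 ⊗ 𝒞 7
    ≈⟨ S.*-congˡ {x = q ⊗ f₅ ↑ 5} (S.trans 𝒞-7 (solve 2 (λ E₁ 𝒩 → con (ℤ.- + 125) :* E₁ :^ 7 :* 𝒩 :^ 0 :+ con (+ 14) :* E₁
        :^ 2 :* 𝒩 :^ 1
        := con (ℤ.- + 125) :* E₁ :^ 7 :+ con (+ 14) :* E₁ :* (E₁ :* 𝒩)) S.refl E₁ 𝒩)) ⟩
  q ⊗ f₅ ↑ 5 ⊗ (const (ℤ.- + 125) ⊗ E₁ ↑ 7 ⊕ const (+ 14) ⊗ E₁ ⊗ (E₁ ⊗ 𝒩))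
    ≈⟨ S.*-congˡ {x = q ⊗ f₅ ↑ 5} (S.+-congˡ {x = const (ℤ.- + 125) ⊗ E₁ ↑ 7} (S.*-congˡ {x = const (+ 14) ⊗ E₁} E₁𝒩)) ⟩
  q ⊗ f₅ ↑ 5 ⊗ (const (ℤ.- + 125) ⊗ E₁ ↑ 7 ⊕ const (+ 14) ⊗ E₁ ⊗ ⊖ (q ⊗ f₅ ↑ 6))
    ≈⟨ solve 4 (λ q h e t → q :* h :^ 5 :* (con (ℤ.- + 125) :* (:- (q :* e)) :^ 7 :+ con (+ 14) :* :- (q :* e) :* :- (q :*
        h :^ 6))
         := q :^ 3 :* (con (+ 14) :* (h :^ 11 :* e) :+ con (+ 125) :* (q :^ 5 :* h :^ 5 :* e :^ 7) :+ con (+ 0) :* t))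
             S.refl q f₅ f₂₅ (dil 5 v₂) ⟩
  q ↑ 3 ⊗ comb (+ 14) (+ 125) (+ 0) (f₅ ↑ 11 ⊗ f₂₅) (q ↑ 5 ⊗ f₅ ↑ 5 ⊗ f₂₅ ↑ 7) (dil 5 v₂)
    ≈⟨ S.*-congˡ {x = q ↑ 3} (S.trans (dil-comb (+ 14) (+ 125) (+ 0) v₀ v₁ v₂) (comb-cong dil-v₀ dil-v₁ (S.refl {dil 5
        v₂}))) ⟨
  q ↑ 3 ⊗ dil 5 (comb (+ 14) (+ 125) (+ 0) v₀ v₁ v₂) ∎)
  where open ≈-Reasoning

U₃-w₂ : U 3 w₂ ≈ comb (ℤ.- + 1) (+ 0) (+ 0) v₀ v₁ v₂
U₃-w₂ = U-proj 3 w₂ (comb (ℤ.- + 1) (+ 0) (+ 0) v₀ v₁ v₂) (s≤s (s≤s (s≤s (s≤s z≤n)))) (begin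
  proj 3 (q ↑ 2 ⊗ f ⊗ f₅ ↑ 11)
    ≈⟨ proj-cong 3 (solve 3 (λ a b c → a :* b :* c := (a :* c) :* b) S.refl (q ↑ 2) f (f₅ ↑ 11)) ⟩
  proj 3 (q ↑ 2 ⊗ f₅ ↑ 11 ⊗ f)
    ≈⟨ proj-⊗ 2 1 f (s≤s (s≤s z≤n)) (onClass-⊗ (onClass-q^ 2) (onClass-f₅^ 11)) ⟩
  q ↑ 2 ⊗ f₅ ↑ 11 ⊗ proj 1 f
    ≈⟨ S.*-congˡ {x = q ↑ 2 ⊗ f₅ ↑ 11} proj-f-1 ⟩
  q ↑ 2 ⊗ f₅ ↑ 11 ⊗ E₁
    ≈⟨ rearrange q f₅ f₂₅ ⟩
  q ↑ 3 ⊗ (const (ℤ.- + 1) ⊗ (f₅ ↑ 11 ⊗ f₂₅))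
    ≈⟨ S.*-congˡ {x = q ↑ 3} (pad (const (ℤ.- + 1) ⊗ (f₅ ↑ 11 ⊗ f₂₅)) (dil 5 v₁) (dil 5 v₂)) ⟩
  q ↑ 3 ⊗ comb (ℤ.- + 1) (+ 0) (+ 0) (f₅ ↑ 11 ⊗ f₂₅) (dil 5 v₁) (dil 5 v₂)
    ≈⟨ S.*-congˡ {x = q ↑ 3} (S.trans (dil-comb (ℤ.- + 1) (+ 0) (+ 0) v₀ v₁ v₂) (comb-cong dil-v₀ (S.refl {dil 5 v₁})
        (S.refl {dil 5 v₂}))) ⟨
  q ↑ 3 ⊗ dil 5 (comb (ℤ.- + 1) (+ 0) (+ 0) v₀ v₁ v₂) ∎)
  where
  open ≈-Reasoning
  rearrange : ∀ q h e → q ↑ 2 ⊗ h ↑ 11 ⊗ ⊖ (q ⊗ e) ≈ q ↑ 3 ⊗ (const (ℤ.- + 1) ⊗ (h ↑ 11 ⊗ e))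
  rearrange = solve 3 (λ q h e → q :^ 2 :* h :^ 11 :* :- (q :* e) := q :^ 3 :* (con (ℤ.- + 1) :* (h :^ 11 :* e))) S.refl
  pad : ∀ h s t → h ≈ h ⊕ const (+ 0) ⊗ s ⊕ const (+ 0) ⊗ t
  pad = solve 3 (λ h s t → h := h :+ con (+ 0) :* s :+ con (+ 0) :* t) S.refl

-- Iterating U in coordinates

U-const⊗ : ∀ r c a → U r (const c ⊗ a) ≈ const c ⊗ U r a
U-const⊗ r c a = mk≈ λ n → trans (const-⊗ c a (r + n * 5)) (sym (const-⊗ c (U r a) n))

const-+ : ∀ a b → const (a ℤ.+ b) ≈ const a ⊕ const b
const-+ a b = mk≈ λ { zero → refl ; (suc _) → refl }

const-* : ∀ a b → const (a ℤ.* b) ≈ const a ⊗ const b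
const-* a b = mk≈ λ n → trans (lem n) (sym (const-⊗ a (const b) n))
  where
  lem : ∀ n → const (a ℤ.* b) n ≡ a ℤ.* const b n
  lem zero    = refl
  lem (suc n) = sym (ℤ.*-zeroʳ a)

U-⊕ : ∀ r a b → U r (a ⊕ b) ≈ U r a ⊕ U r b
U-⊕ r a b = mk≈ λ _ → refl

U-comb : ∀ r a b c {s t u s′ t′ u′} → U r s ≈ s′ → U r t ≈ t′ → U r u ≈ u′ → U r (comb a b c s t u) ≈ comb a b c s′ t′ u′
U-comb r a b c {s} {t} {u} p₁ p₂ p₃ = S.trans (U-⊕ r (const a ⊗ s ⊕ const b ⊗ t) (const c ⊗ u)) (S.+-cong
  (S.trans (U-⊕ r (const a ⊗ s) (const b ⊗ t)) (S.+-cong (S.trans (U-const⊗ r a s) (S.*-congˡ p₁)) (S.trans (U-const⊗ r b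
      t) (S.*-congˡ p₂))))
  (S.trans (U-const⊗ r c u) (S.*-congˡ p₃)))

U₁-comb : ∀ a b c → U 1 (comb a b c v₀ v₁ v₂) ≈ comb (ℤ.- + 11 ℤ.* a ℤ.+ b) (ℤ.- + 275 ℤ.* a ℤ.+ + 5 ℤ.* c) (ℤ.- + 3125 ℤ.*
    a) w₀ w₁ w₂
U₁-comb a b c = S.trans (U-comb 1 a b c {v₀} {v₁} {v₂} U₁-v₀ U₁-v₁ U₁-v₂) (S.trans
  (solve 6 (λ a b c s t u → a :* (con (ℤ.- + 11) :* s :+ con (ℤ.- + 275) :* t :+ con (ℤ.- + 3125) :* u) :+ b :* (con (+ 1)
      :* s :+ con (+ 0) :* t :+ con (+ 0) :* u)
       :+ c :* (con (+ 0) :* s :+ con (+ 5) :* t :+ con (+ 0) :* u) :=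
     (con (ℤ.- + 11) :* a :+ b) :* s :+ (con (ℤ.- + 275) :* a :+ con (+ 5) :* c) :* t :+ con (ℤ.- + 3125) :* a :* u) S.refl
         (const a) (const b) (const c) w₀ w₁ w₂)
  (S.sym (S.+-cong (S.+-cong (S.*-congʳ (S.trans (const-+ (ℤ.- + 11 ℤ.* a) b) (S.+-congʳ (const-* (ℤ.- + 11) a))))
    (S.*-congʳ (S.trans (const-+ (ℤ.- + 275 ℤ.* a) (+ 5 ℤ.* c)) (S.+-cong (const-* (ℤ.- + 275) a) (const-* (+ 5) c)))))
        (S.*-congʳ (const-* (ℤ.- + 3125) a)))))

U₃-comb : ∀ a b c → U 3 (comb a b c w₀ w₁ w₂) ≈ comb (ℤ.- + 130 ℤ.* a ℤ.+ + 14 ℤ.* b ℤ.+ ℤ.- c) (+ 125 ℤ.* b) (+ 15625 ℤ.*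
    a) v₀ v₁ v₂
U₃-comb a b c = S.trans (U-comb 3 a b c {w₀} {w₁} {w₂} U₃-w₀ U₃-w₁ U₃-w₂) (S.trans
  (solve 6 (λ a b c s t u → a :* (con (ℤ.- + 130) :* s :+ con (+ 0) :* t :+ con (+ 15625) :* u) :+ b :* (con (+ 14) :* s :+
      con (+ 125) :* t :+ con (+ 0) :* u)
       :+ c :* (con (ℤ.- + 1) :* s :+ con (+ 0) :* t :+ con (+ 0) :* u) :=
     (con (ℤ.- + 130) :* a :+ con (+ 14) :* b :+ :- c) :* s :+ con (+ 125) :* b :* t :+ con (+ 15625) :* a :* u) S.refl
         (const a) (const b) (const c) v₀ v₁ v₂)
  (S.sym (S.+-cong (S.+-cong (S.*-congʳ (S.trans (const-+ (ℤ.- + 130 ℤ.* a ℤ.+ + 14 ℤ.* b) (ℤ.- c)) (S.+-cong (S.trans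
      (const-+ (ℤ.- + 130 ℤ.* a) (+ 14 ℤ.* b)) (S.+-cong (const-* (ℤ.- + 130) a) (const-* (+ 14) b))) (const-⊖ c))))
    (S.*-congʳ (const-* (+ 125) b))) (S.*-congʳ (const-* (+ 15625) a)))))

-- The new coordinates come with equations, so each iterate can be stated with evaluated integers
-- and confirmed by `refl`.
U₁-step : ∀ s {a b c a′ b′ c′} → s ≈ comb a b c v₀ v₁ v₂ →
  ℤ.- + 11 ℤ.* a ℤ.+ b ≡ a′ → ℤ.- + 275 ℤ.* a ℤ.+ + 5 ℤ.* c ≡ b′ → ℤ.- + 3125 ℤ.* a ≡ c′ →
  U 1 s ≈ comb a′ b′ c′ w₀ w₁ w₂
U₁-step s {a} {b} {c} p refl refl refl = S.trans (U-cong 1 s (comb a b c v₀ v₁ v₂) p) (U₁-comb a b c)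

U₃-step : ∀ s {a b c a′ b′ c′} → s ≈ comb a b c w₀ w₁ w₂ →
  ℤ.- + 130 ℤ.* a ℤ.+ + 14 ℤ.* b ℤ.+ ℤ.- c ≡ a′ → + 125 ℤ.* b ≡ b′ → + 15625 ℤ.* a ≡ c′ →
  U 3 s ≈ comb a′ b′ c′ v₀ v₁ v₂
U₃-step s {a} {b} {c} p refl refl refl = S.trans (U-cong 3 s (comb a b c w₀ w₁ w₂) p) (U₃-comb a b c)

comb-first : ∀ s t u → s ≈ comb (+ 1) (+ 0) (+ 0) s t u
comb-first = solve 3 (λ s t u → s := con (+ 1) :* s :+ con (+ 0) :* t :+ con (+ 0) :* u) S.refl

U₁₃ : Series → Series
U₁₃ a = U 3 (U 1 a)

-- Exact integer coordinates; no single step before the fifth leaves just one of them nonzero modulo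
-- 13.
s₁ : U 1 v₀ ≈ comb (ℤ.- + 11) (ℤ.- + 275) (ℤ.- + 3125) w₀ w₁ w₂
s₁ = U₁-step v₀ (comb-first v₀ v₁ v₂) refl refl refl

s₂ : U₁₃ v₀ ≈ comb (+ 705) (ℤ.- + 34375) (ℤ.- + 171875) v₀ v₁ v₂
s₂ = U₃-step (U 1 v₀) s₁ refl refl refl

s₃ : U 1 (U₁₃ v₀) ≈ comb (ℤ.- + 42130) (ℤ.- + 1053250) (ℤ.- + 2203125) w₀ w₁ w₂
s₃ = U₁-step (U₁₃ v₀) s₂ refl refl refl

s₄ : U₁₃ (U₁₃ v₀) ≈ comb (ℤ.- + 7065475) (ℤ.- + 131656250) (ℤ.- + 658281250) v₀ v₁ v₂
s₄ = U₃-step (U 1 (U₁₃ v₀)) s₃ refl refl refl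

s₅ : U 1 (U₁₃ (U₁₃ v₀)) ≈ comb (ℤ.- + 53936025) (ℤ.- + 1348400625) (+ 22079609375) w₀ w₁ w₂
s₅ = U₁-step (U₁₃ (U₁₃ v₀)) s₄ refl refl refl

s₆ : U₁₃ (U₁₃ (U₁₃ v₀)) ≈ comb (ℤ.- + 33945534875) (ℤ.- + 168550078125) (ℤ.- + 842750390625) v₀ v₁ v₂
s₆ = U₃-step (U 1 (U₁₃ (U₁₃ v₀))) s₅ refl refl refl

infix 4 _≋_

-- Congruence modulo 13 with its quotient as data, so that congruences can be treated as identities
-- over ℤ.
record _≋_ (a b : Series) : Set where
  constructor mk≋
  field
    quotient : Series
    equation : a ≈ b ⊕ const (+ 13) ⊗ quotient

open _≋_

module _ {a b c a′ b′ c′ : ℤ} (s t u : Series) (e : ℤ) where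

  const-13 : ∀ i j → i ≡ + 13 ℤ.* j → const i ≈ const (+ 13) ⊗ const j
  const-13 i j refl = const-* (+ 13) j

  const-e+13 : ∀ i j → i ≡ e ℤ.+ + 13 ℤ.* j → const i ≈ const e ⊕ const (+ 13) ⊗ const j
  const-e+13 i j refl = S.trans (const-+ e (+ 13 ℤ.* j)) (S.+-congˡ {x = const e} (const-* (+ 13) j))

  comb-≋-first : a ≡ e ℤ.+ + 13 ℤ.* a′ → b ≡ + 13 ℤ.* b′ → c ≡ + 13 ℤ.* c′ → comb a b c s t u ≋ const e ⊗ s
  comb-≋-first p r w = mk≋ (comb a′ b′ c′ s t u) (S.trans
    (S.+-cong (S.+-cong (S.*-congʳ (const-e+13 a a′ p)) (S.*-congʳ (const-13 b b′ r))) (S.*-congʳ (const-13 c c′ w)))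
    (solve 8 (λ e M a b c s t u → (e :+ M :* a) :* s :+ M :* b :* t :+ M :* c :* u := e :* s :+ M :* (a :* s :+ b :* t :+ c
        :* u)) S.refl
      (const e) (const (+ 13)) (const a′) (const b′) (const c′) s t u))

  comb-≋-third : a ≡ + 13 ℤ.* a′ → b ≡ + 13 ℤ.* b′ → c ≡ e ℤ.+ + 13 ℤ.* c′ → comb a b c s t u ≋ const e ⊗ u
  comb-≋-third p r w = mk≋ (comb a′ b′ c′ s t u) (S.trans
    (S.+-cong (S.+-cong (S.*-congʳ (const-13 a a′ p)) (S.*-congʳ (const-13 b b′ r))) (S.*-congʳ (const-e+13 c c′ w)))
    (solve 8 (λ e M a b c s t u → M :* a :* s :+ M :* b :* t :+ (e :+ M :* c) :* u := e :* u :+ M :* (a :* s :+ b :* t :+ c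
        :* u)) S.refl
      (const e) (const (+ 13)) (const a′) (const b′) (const c′) s t u))

≋-respˡ : ∀ {a b c} → a ≈ b → b ≋ c → a ≋ c
≋-respˡ p (mk≋ d e) = mk≋ d (S.trans p e)

s₅-≋ : U 1 (U₁₃ (U₁₃ v₀)) ≋ const (+ 5) ⊗ w₂
-- The coordinates of `s₅` divided by 13, the third one after subtracting 5.
s₅-≋ = ≋-respˡ s₅ (comb-≋-third {a′ = ℤ.- + 4148925} {ℤ.- + 103723125} {+ 1698431490} w₀ w₁ w₂ (+ 5) refl refl refl)

s₆-≋ : U₁₃ (U₁₃ (U₁₃ v₀)) ≋ const (+ 8) ⊗ v₀
s₆-≋ = ≋-respˡ s₆ (comb-≋-first {a′ = ℤ.- + 2611194991} {ℤ.- + 12965390625} {ℤ.- + 64826953125} v₀ v₁ v₂ (+ 8) refl refl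
    refl)

-- Counting regular bipartitions

-- A duplicate-free list of exactly the solutions of P. Two such lists are permutations of each
-- other, so counting reduces to exhibiting a second list.
record Enumerates {A : Set} (P : A → Set) (xs : List A) : Set where
  constructor enumerates
  field
    unique : Unique xs
    sound  : ∀ {x} → x ∈ xs → P x
    covers : ∀ {x} → P x → x ∈ xs

open Enumerates

Enumerates-length : ∀ {A : Set} {P : A → Set} {xs ys} → Enumerates P xs → Enumerates P ys → length xs ≡ length ys
Enumerates-length e e′ = ↭-length (∼bag⇒↭ (WithK.unique∧set⇒bag (unique e) (unique e′)
  (mk⇔ (covers e′ ∘ sound e) (covers e ∘ sound e′))))

Enumerates-⇔ : ∀ {A : Set} {P Q : A → Set} {xs} → (∀ {x} → P x → Q x) → (∀ {x} → Q x → P x) → Enumerates P xs → Enumerates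
    Q xs
Enumerates-⇔ to from e = enumerates (unique e) (to ∘ sound e) (covers e ∘ from)

module _ {A B : Set} (Y : ℕ → List B) where

  -- Follows the recursion of `⊗` clause by clause, so its length is a coefficient of the product of
  -- the two length series.
  antidiagonal : (ℕ → List A) → ℕ → List (A × B)
  antidiagonal X zero    = cartesianProduct (X 0) (Y 0)
  antidiagonal X (suc n) = cartesianProduct (X 0) (Y (suc n)) ++ antidiagonal (X ∘ suc) n

  antidiagonal⁻ : ∀ X n {p} → p ∈ antidiagonal X n → ∃₂ λ i j → i + j ≡ n × proj₁ p ∈ X i × proj₂ p ∈ Y j
  antidiagonal⁻ X zero    p∈ = 0 , 0 , refl , ∈-cartesianProduct⁻ (X 0) (Y 0) p∈
  antidiagonal⁻ X (suc n) p∈ with ∈-++⁻ (cartesianProduct (X 0) (Y (suc n))) p∈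
  ... | inj₁ p∈ˡ = 0 , suc n , refl , ∈-cartesianProduct⁻ (X 0) (Y (suc n)) p∈ˡ
  ... | inj₂ p∈ʳ with antidiagonal⁻ (X ∘ suc) n p∈ʳ
  ...   | i , j , refl , h = suc i , j , refl , h

  antidiagonal⁺ : ∀ X i j {x y} → x ∈ X i → y ∈ Y j → (x , y) ∈ antidiagonal X (i + j)
  antidiagonal⁺ X zero zero    x∈ y∈ = ∈-cartesianProduct⁺ x∈ y∈
  antidiagonal⁺ X zero (suc j) x∈ y∈ = ∈-++⁺ˡ (∈-cartesianProduct⁺ x∈ y∈)
  antidiagonal⁺ X (suc i) j    x∈ y∈ = ∈-++⁺ʳ (cartesianProduct (X 0) (Y (suc i + j))) (antidiagonal⁺ (X ∘ suc) i j x∈ y∈)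

  antidiagonal-unique : ∀ X n → (∀ i → Unique (X i)) → (∀ j → Unique (Y j)) →
    (∀ {x i j} → x ∈ X i → x ∈ X j → i ≡ j) → Unique (antidiagonal X n)
  antidiagonal-unique X zero    uX uY disjoint = Unique.cartesianProduct⁺ (uX 0) (uY 0)
  antidiagonal-unique X (suc n) uX uY disjoint = Unique.++⁺ (Unique.cartesianProduct⁺ (uX 0) (uY (suc n)))
    (antidiagonal-unique (X ∘ suc) n (uX ∘ suc) uY (λ p r → ℕ.suc-injective (disjoint p r)))
    λ (p , r) → apart (∈-cartesianProduct⁻ (X 0) (Y (suc n)) p) (antidiagonal⁻ (X ∘ suc) n r)
    where
    apart : ∀ {p} → proj₁ p ∈ X 0 × proj₂ p ∈ Y (suc n) → (∃₂ λ i j → i + j ≡ n × proj₁ p ∈ X (suc i) × proj₂ p ∈ Y j) → ⊥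
    apart (p , _) (i , _ , _ , r , _) with disjoint p r
    ... | ()

  length-× : ∀ (xs : List A) (ys : List B) → length (cartesianProduct xs ys) ≡ length xs * length ys
  length-× []       ys = refl
  length-× (x ∷ xs) ys = trans (length-++ (map (x ,_) ys)) (cong₂ ℕ._+_ (length-map (x ,_) ys) (length-× xs ys))

  length-antidiagonal : ∀ X n → + length (antidiagonal X n) ≡ ((λ i → + length (X i)) ⊗ (λ j → + length (Y j))) n
  length-antidiagonal X zero    = trans (cong +_ (length-× (X 0) (Y 0))) (ℤ.pos-* (length (X 0)) (length (Y 0)))
  length-antidiagonal X (suc n) = trans (cong +_ (length-++ (cartesianProduct (X 0) (Y (suc n)))))
    (trans (ℤ.pos-+ (length (cartesianProduct (X 0) (Y (suc n)))) (length (antidiagonal (X ∘ suc) n))) (cong₂ ℤ._+_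
      (trans (cong +_ (length-× (X 0) (Y (suc n)))) (ℤ.pos-* (length (X 0)) (length (Y (suc n)))))
      (length-antidiagonal (X ∘ suc) n)))

-- The bound K on the parts is the induction variable that builds the generating product factor by
-- factor.
Partition : ℕ → ℕ → ℕ → List ℕ → Set
Partition l K n ps = ((IsPartition ps × Regular l ps) × All (_≤ K) ps) × sum ps ≡ n

partition? : ∀ l K n ps → Dec (Partition l K n ps)
partition? l K n ps = ((isPartition? ps ×-dec regular? l ps) ×-dec All.all? (ℕ._≤? K) ps) ×-dec (sum ps ℕ.≟ n)

partitions : ℕ → ℕ → ℕ → List (List ℕ)
partitions l K n = filter (partition? l K n) (boundedLists n n)

partitions-enumerates : ∀ l K n → Enumerates (Partition l K n) (partitions l K n)
partitions-enumerates l K n = enumerates (Unique.filter⁺ (partition? l K n) (boundedLists-unique n n))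
  (λ p∈ → proj₂ (∈-filter⁻ (partition? l K n) {xs = boundedLists n n} p∈))
  λ p → ∈-filter⁺ (partition? l K n) (bounded p) p
  where
  bounded : ∀ {ps} → Partition l K n ps → ps ∈ boundedLists n n
  bounded ((((_ , ps>0) , _) , _) , refl) = ∈-boundedLists n ps>0 ℕ.≤-refl ℕ.≤-refl

count : ℕ → ℕ → Series
count l K n = + length (partitions l K n)

head-max : ∀ {p ps} → Linked ℕ._≥_ (p ∷ ps) → All (_≤ p) ps
head-max [-]        = []
head-max (p≥x ∷ ps) = p≥x ∷ All.map (λ y≤x → ℕ.≤-trans y≤x p≥x) (head-max ps)

cons-linked : ∀ {p ps} → All (_≤ p) ps → Linked ℕ._≥_ ps → Linked ℕ._≥_ (p ∷ ps)
cons-linked []      []       = [-]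
cons-linked (h ∷ _) [-]      = h ∷ [-]
cons-linked (h ∷ _) (e ∷ ps) = h ∷ e ∷ ps

tail-linked : ∀ {p ps} → Linked ℕ._≥_ (p ∷ ps) → Linked ℕ._≥_ ps
tail-linked [-]      = []
tail-linked (_ ∷ ps) = ps

part≤sum : ∀ ps → All (_≤ sum ps) ps
part≤sum []       = []
part≤sum (p ∷ ps) = ℕ.m≤m+n p (sum ps) ∷ All.map (λ h → ℕ.≤-trans h (ℕ.m≤n+m (sum ps) p)) (part≤sum ps)

weaken : ∀ {l K K′ n ps} → K ≤ K′ → Partition l K n ps → Partition l K′ n ps
weaken K≤ ((reg , ≤K) , s) = (reg , All.map (λ h → ℕ.≤-trans h K≤) ≤K) , s

-- Parts are weakly decreasing, so a part `suc K` occurs only if it is the head. Removing it keeps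
-- the bound `suc K`, which gives the factor 1/(1 - qᴷ⁺¹).
split-head : ∀ {l K n} ps → Partition l (suc K) n ps →
  Partition l K n ps ⊎ (¬ l ∣ suc K × ∃ λ qs → ps ≡ suc K ∷ qs × ∃ λ m → suc K + m ≡ n × Partition l (suc K) m qs)
split-head []       ((reg , _) , s) = inj₁ ((reg , []) , s)
split-head {K = K} (p ∷ ps) ((((link , p>0 ∷ ps>0) , (l∤p ∷ l∤ps)) , (p≤ ∷ ps≤)) , s) with ℕ.m≤n⇒m<n∨m≡n p≤
... | inj₁ (s≤s p≤K) = inj₁ ((((link , p>0 ∷ ps>0) , (l∤p ∷ l∤ps)) , (p≤K ∷ All.map (λ h → ℕ.≤-trans h p≤K) (head-max
    link))) , s)
... | inj₂ refl = inj₂ (l∤p , ps , refl , sum ps , s , (((tail-linked link , ps>0) , l∤ps) , ps≤) , refl)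

cons-partition : ∀ {l K m qs} → ¬ l ∣ suc K → Partition l (suc K) m qs → Partition l (suc K) (suc K + m) (suc K ∷ qs)
cons-partition l∤ ((((link , qs>0) , l∤qs) , qs≤) , refl) = (((cons-linked qs≤ link , s≤s z≤n ∷ qs>0) , (l∤ ∷ l∤qs)) ,
    (ℕ.≤-refl ∷ qs≤)) , refl

count-≡ : ∀ l K l′ K′ n → (∀ {ps} → Partition l K n ps → Partition l′ K′ n ps) → (∀ {ps} → Partition l′ K′ n ps → Partition
    l K n ps) →
  count l K n ≡ count l′ K′ n
count-≡ l K l′ K′ n to from = cong +_ (Enumerates-length (partitions-enumerates l K n) (Enumerates-⇔ from to
    (partitions-enumerates l′ K′ n)))

count-divisible : ∀ l K → l ∣ suc K → count l (suc K) ≈ count l K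
count-divisible l K l∣ = mk≈ λ n → count-≡ l (suc K) l K n (λ {ps} p → [ (λ h → h) , (λ h → ⊥-elim (proj₁ h l∣)) ]′
    (split-head ps p)) (weaken (ℕ.n≤1+n K))

count-below : ∀ l K n → n < suc K → count l (suc K) n ≡ count l K n
count-below l K n n< = count-≡ l (suc K) l K n
  (λ {ps} p → [ (λ h → h) , (λ { (_ , _ , _ , m , refl , _) → ⊥-elim (ℕ.<⇒≱ n< (ℕ.m≤m+n (suc K) m)) }) ]′ (split-head ps
      p)) (weaken (ℕ.n≤1+n K))

count-above : ∀ l K m → ¬ l ∣ suc K → count l (suc K) (suc K + m) ≡ count l K (suc K + m) ℤ.+ count l (suc K) m
count-above l K m l∤ = trans (cong +_ (trans (Enumerates-length (partitions-enumerates l (suc K) n) union)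
  (trans (length-++ (partitions l K n)) (cong (length (partitions l K n) ℕ.+_) (length-map (suc K ∷_) (partitions l (suc K)
      m))))))
  (ℤ.pos-+ (length (partitions l K n)) (length (partitions l (suc K) m)))
  where
  n = suc K + m
  e₁ = partitions-enumerates l K n
  e₂ = partitions-enumerates l (suc K) m
  cons-∈ : ∀ {ps} → ps ∈ map (suc K ∷_) (partitions l (suc K) m) → ∃ λ qs → qs ∈ partitions l (suc K) m × ps ≡ suc K ∷ qs
  cons-∈ = ∈-map⁻ (suc K ∷_)
  join : ∀ {ps} → Partition l K n ps ⊎ (¬ l ∣ suc K × ∃ λ qs → ps ≡ suc K ∷ qs × ∃ λ m′ → suc K + m′ ≡ n × Partition l (suc
      K) m′ qs) →
    ps ∈ partitions l K n ++ map (suc K ∷_) (partitions l (suc K) m)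
  join (inj₁ p) = ∈-++⁺ˡ (covers e₁ p)
  join (inj₂ (_ , qs , refl , m′ , e , p)) = ∈-++⁺ʳ (partitions l K n) (∈-map⁺ (suc K ∷_) (covers e₂ (subst (λ t →
      Partition l (suc K) t qs) (ℕ.+-cancelˡ-≡ (suc K) m′ m e) p)))
  split : ∀ {ps} → ps ∈ partitions l K n ⊎ ps ∈ map (suc K ∷_) (partitions l (suc K) m) → Partition l (suc K) n ps
  split (inj₁ p∈) = weaken (ℕ.n≤1+n K) (sound e₁ p∈)
  split (inj₂ p∈) with cons-∈ p∈
  ... | qs , qs∈ , refl = cons-partition l∤ (sound e₂ qs∈)
  union : Enumerates (Partition l (suc K) n) (partitions l K n ++ map (suc K ∷_) (partitions l (suc K) m))
  union = enumerates
    (Unique.++⁺ (unique e₁) (Unique.map⁺ ∷-injectiveʳ (unique e₂)) λ (p , r) → apart p (cons-∈ r))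
    (λ p∈ → split (∈-++⁻ (partitions l K n) p∈))
    (λ {ps} p → join (split-head ps p))
    where
    apart : ∀ {ps} → ps ∈ partitions l K n → (∃ λ qs → qs ∈ partitions l (suc K) m × ps ≡ suc K ∷ qs) → ⊥
    apart p∈ (qs , _ , refl) with sound e₁ p∈
    ... | ((_ , (h ∷ _)) , _) = ℕ.1+n≰n h

1-q^-⊗-count : ∀ l K → ¬ l ∣ suc K → 1-q^ (suc K) ⊗ count l (suc K) ≈ count l K
1-q^-⊗-count l K l∤ = begin
  1-q^ (suc K) ⊗ c′            ≈⟨ solve 2 (λ x c → (con 1ℤ :- x) :* c := c :- x :* c) S.refl (q ↑ suc K) c′ ⟩
  c′ ⊕ ⊖ (q ↑ suc K ⊗ c′)      ≈⟨ S.+-congʳ recurrence ⟩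
  (count l K ⊕ q ↑ suc K ⊗ c′) ⊕ ⊖ (q ↑ suc K ⊗ c′)
                               ≈⟨ solve 2 (λ c t → (c :+ t) :- t := c) S.refl (count l K) (q ↑ suc K ⊗ c′) ⟩
  count l K                    ∎
  where
  open ≈-Reasoning
  c′ = count l (suc K)
  recurrence : c′ ≈ count l K ⊕ q ↑ suc K ⊗ c′
  recurrence = mk≈ λ n → go n (ℕ.<-≤-connex n (suc K))
    where
    go : ∀ n → n < suc K ⊎ suc K ≤ n → c′ n ≡ count l K n ℤ.+ (q ↑ suc K ⊗ c′) n
    go n (inj₁ n<) = trans (count-below l K n n<) (sym (trans (cong (λ t → count l K n ℤ.+ t) (q^-⊗-below (suc K) c′ n n<))
        (ℤ.+-identityʳ _)))
    go n (inj₂ ≤n) with ℕ.m≤n⇒∃[o]m+o≡n ≤n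
    ... | m , refl = trans (count-above l K m l∤) (cong (λ t → count l K (suc K + m) ℤ.+ t) (sym (q^-⊗-at (suc K) c′ m)))

module _ (l : ℕ) .{{_ : NonZero l}} where

  factor : ∀ k → Dec (l ∣ k) → Series
  factor k (yes _) = 1-q^ k
  factor k (no _)  = 1s

  -- The product of 1 − qⁱ over the multiples i ≤ K of l.
  multiples : ℕ → Series
  multiples zero    = 1s
  multiples (suc K) = factor (suc K) (l ∣? suc K) ⊗ multiples K

  -- Each factor 1 - qᴷ⁺¹ of `g` either undoes the passage from K to K + 1 in the count or, when l
  -- divides K + 1, is left over and collected in `multiples`.
  count-⊗-g : ∀ K → count l K ⊗ g K ≈ multiples K
  count-⊗-g zero = S.trans (S.*-identityʳ (count l 0)) (mk≈ λ { zero → one ; (suc n) → none n })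
    where
    empty : ∀ {n} ps → Partition l 0 n ps → ps ≡ [] × n ≡ 0
    empty []      (_ , s) = refl , sym s
    empty (p ∷ _) ((((_ , p>0 ∷ _) , _) , p≤0 ∷ _) , _) = ⊥-elim (ℕ.<⇒≱ p>0 p≤0)
    one : count l 0 0 ≡ 1ℤ
    one = cong +_ (Enumerates-length {ys = [] ∷ []} (partitions-enumerates l 0 0) (enumerates ([] ∷ [])
      (λ { (here refl) → ((([] , []) , []) , []) , refl }) (λ {ps} p → here (proj₁ (empty ps p)))))
    none : ∀ n → count l 0 (suc n) ≡ 0ℤ
    none n = cong +_ (Enumerates-length {ys = []} (partitions-enumerates l 0 (suc n)) (enumerates []
      (λ ()) (λ {ps} p → ⊥-elim (ℕ.1+n≢0 (proj₂ (empty ps p))))))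
  count-⊗-g (suc K) = step (l ∣? suc K)
    where
    step : (d : Dec (l ∣ suc K)) → count l (suc K) ⊗ (1-q^ (suc K) ⊗ g K) ≈ factor (suc K) d ⊗ multiples K
    step (yes l∣) = begin
      count l (suc K) ⊗ (1-q^ (suc K) ⊗ g K)  ≈⟨ S.*-congʳ (count-divisible l K l∣) ⟩
      count l K ⊗ (1-q^ (suc K) ⊗ g K)        ≈⟨ solve 3 (λ c p g → c :* (p :* g) := p :* (c :* g)) S.refl (count l K)
          (1-q^ (suc K)) (g K) ⟩
      1-q^ (suc K) ⊗ (count l K ⊗ g K)        ≈⟨ S.*-congˡ (count-⊗-g K) ⟩
      1-q^ (suc K) ⊗ multiples K              ∎
      where open ≈-Reasoning
    step (no l∤) = begin
      count l (suc K) ⊗ (1-q^ (suc K) ⊗ g K)  ≈⟨ solve 3 (λ c p g → c :* (p :* g) := p :* c :* g) S.refl (count l (suc K))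
          (1-q^ (suc K)) (g K) ⟩
      1-q^ (suc K) ⊗ count l (suc K) ⊗ g K    ≈⟨ S.*-congʳ (1-q^-⊗-count l K l∤) ⟩
      count l K ⊗ g K                         ≈⟨ count-⊗-g K ⟩
      multiples K                             ≈⟨ S.*-identityˡ (multiples K) ⟨
      1s ⊗ multiples K                        ∎
      where open ≈-Reasoning

  multiples-skip : ∀ J r → r < l → multiples (r + J * l) ≈ multiples (J * l)
  multiples-skip J zero    _   = S.refl
  multiples-skip J (suc r) r<l = S.trans (step (l ∣? suc (r + J * l))) (multiples-skip J r (ℕ.<-trans (ℕ.n<1+n r) r<l))
    where
    l∤ : ¬ l ∣ suc (r + J * l)
    l∤ l∣ = ℕ.<⇒≱ r<l (∣⇒≤ (∣m+n∣m⇒∣n (subst (l ∣_) (ℕ.+-comm (suc r) (J * l)) l∣) (n∣m*n J)))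
    step : (d : Dec (l ∣ suc (r + J * l))) → factor (suc (r + J * l)) d ⊗ multiples (r + J * l) ≈ multiples (r + J * l)
    step (yes l∣) = ⊥-elim (l∤ l∣)
    step (no _)   = S.*-identityˡ _

  dil-1-q^ : ∀ k → dil l (1-q^ k) ≈ 1-q^ (k * l)
  dil-1-q^ k = S.trans (dil-⊕ l 1s (⊖ (q ↑ k))) (S.+-cong (dil-const l 1ℤ) (S.trans (dil-⊖ l (q ↑ k)) (S.-‿cong
    (S.trans (dil-^ l q k) (S.trans (^-congˡ k (dil-q l)) (S.trans (^-assocʳ q l k) (q^-≡ (ℕ.*-comm l k))))))))

  multiples-≈ : ∀ J → multiples (J * l) ≈ dil l (g J)
  multiples-≈ zero    = S.sym (dil-const l 1ℤ)
  multiples-≈ (suc J) = begin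
    multiples (l + J * l)                    ≈⟨ S.reflexive (cong (λ t → multiples (t + J * l)) (sym l≡)) ⟩
    multiples (suc l′ + J * l)               ≈⟨ step (l ∣? suc (l′ + J * l)) ⟩
    1-q^ (suc l′ + J * l) ⊗ multiples (l′ + J * l)
      ≈⟨ S.*-cong (S.reflexive (cong (λ t → 1-q^ (t + J * l)) l≡)) (S.trans (multiples-skip J l′ (ℕ.≤-reflexive l≡))
          (multiples-≈ J)) ⟩
    1-q^ (suc J * l) ⊗ dil l (g J)             ≈⟨ S.*-congʳ (dil-1-q^ (suc J)) ⟨
    dil l (1-q^ (suc J)) ⊗ dil l (g J)           ≈⟨ dil-⊗ l (1-q^ (suc J)) (g J) ⟨
    dil l (g (suc J))                            ∎
    where
    open ≈-Reasoning
    l′ = ℕ.pred l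
    l≡ : suc l′ ≡ l
    l≡ = ℕ.suc-pred l
    step : (d : Dec (l ∣ suc (l′ + J * l))) → factor (suc (l′ + J * l)) d ⊗ multiples (l′ + J * l) ≈ 1-q^ (suc l′ + J * l)
        ⊗ multiples (l′ + J * l)
    step (yes _) = S.refl
    step (no l∤) = ⊥-elim (l∤ (subst (λ t → l ∣ t + J * l) (sym l≡) (n∣m*n (suc J))))

  -- A part of a partition of n is at most n, so the bound n is no restriction.
  regular : Series
  regular n = count l n n

  regular-≈[] : ∀ M → regular ≈[ M ] count l M
  regular-≈[] M = mk≈[] λ n n≤ → count-≡ l n l M n (weaken n≤) λ { {ps} ((reg , _) , refl) → (reg , part≤sum ps) , refl }

  regular-⊗-f : regular ⊗ f ≈ dil l f
  regular-⊗-f = ≈[]⇒≈ limit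
    where
    limit : ∀ M → regular ⊗ f ≈[ M ] dil l f
    limit M = begin
      regular ⊗ f                       ≈⟨ ⊗-cong[] (≈[]-weaken M≤ (regular-≈[] (M * l))) (≈[]-weaken M≤ (f-≈[] (M * l))) ⟩
      count l (M * l) ⊗ g (M * l)   ≈⟨ ≈⇒≈[] (S.trans (count-⊗-g (M * l)) (multiples-≈ M)) ⟩
      dil l (g M)                       ≈⟨ dil-cong[] l (f-≈[] M) ⟨
      dil l f                           ∎
      where
      open ≈[]-Reasoning M
      M≤ : M ≤ M * l
      M≤ = ℕ.m≤m*n M l

-- The filtered search behind `B` and the antidiagonal of partition lists enumerate the same
-- bipartitions. The sum of the first component determines its index, which keeps the antidiagonal
-- free of duplicates.
B-convolution : ∀ l m .{{_ : NonZero l}} .{{_ : NonZero m}} n → + B l m n ≡ (regular l ⊗ regular m) n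
B-convolution l m n = trans (cong +_ (Enumerates-length direct diagonal)) (length-antidiagonal Y X n)
  where
  X Y : ℕ → List (List ℕ)
  X i = partitions l i i
  Y j = partitions m j j
  direct : Enumerates (IsRegularBipartition l m n) (regularBipartitions l m n)
  direct = enumerates (regularBipartitions-unique l m n) (λ h → Equivalence.to (∈-regularBipartitions l m n) h) (λ h →
      Equivalence.from (∈-regularBipartitions l m n) h)
  diagonal : Enumerates (IsRegularBipartition l m n) (antidiagonal Y X n)
  diagonal = enumerates
    (antidiagonal-unique Y X n (λ i → unique (partitions-enumerates l i i)) (λ j → unique (partitions-enumerates m j j))
      (λ {_} {i} {j} p r → trans (sym (proj₂ (sound (partitions-enumerates l i i) p))) (proj₂ (sound (partitions-enumerates
          l j j) r))))
    (λ p∈ → glue (antidiagonal⁻ Y X n p∈))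
    (λ { {ps , qs} (p , r , refl) → antidiagonal⁺ Y X (sum ps) (sum qs)
         (covers (partitions-enumerates l (sum ps) (sum ps)) ((p , part≤sum ps) , refl))
         (covers (partitions-enumerates m (sum qs) (sum qs)) ((r , part≤sum qs) , refl)) })
    where
    glue : ∀ {p} → (∃₂ λ i j → i + j ≡ n × proj₁ p ∈ X i × proj₂ p ∈ Y j) → IsRegularBipartition l m n p
    glue (i , j , refl , p∈ , r∈) with sound (partitions-enumerates l i i) p∈ | sound (partitions-enumerates m j j) r∈
    ... | ((reg , _) , s) | ((reg′ , _) , s′) = reg , reg′ , cong₂ ℕ._+_ s s′

-- Reduction modulo 13

-- The coefficients are (-1)ʲ C(13, j)/13 for 1 ≤ j ≤ 12.
binomial₁₃ : Series → Series
binomial₁₃ v = const (ℤ.- + 1) ⊗ v ↑ 1 ⊕ const (+ 6) ⊗ v ↑ 2 ⊕ const (ℤ.- + 22) ⊗ v ↑ 3 ⊕ const (+ 55) ⊗ v ↑ 4 ⊕ const (ℤ.-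
    + 99) ⊗ v ↑ 5 ⊕ const (+ 132) ⊗ v ↑ 6 ⊕ const (ℤ.- + 132) ⊗ v ↑ 7 ⊕ const (+ 99) ⊗ v ↑ 8 ⊕ const (ℤ.- + 55) ⊗ v ↑ 9 ⊕
    const (+ 22) ⊗ v ↑ 10 ⊕ const (ℤ.- + 6) ⊗ v ↑ 11 ⊕ const (+ 1) ⊗ v ↑ 12

1-v^13 : ∀ v → (1s ⊕ ⊖ v) ↑ 13 ≈ (1s ⊕ ⊖ (v ↑ 13)) ⊕ const (+ 13) ⊗ binomial₁₃ v
1-v^13 = solve 1 (λ v → (con 1ℤ :+ :- v) :^ 13 := (con 1ℤ :+ :- (v :^ 13)) :+ con (+ 13) :* (con (ℤ.- + 1) :* v :^ 1 :+ con
    (+ 6) :* v :^ 2 :+ con (ℤ.- + 22) :* v :^ 3 :+ con (+ 55) :* v :^ 4 :+ con (ℤ.- + 99) :* v :^ 5 :+ con (+ 132) :* v :^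
    6 :+ con (ℤ.- + 132) :* v :^ 7 :+ con (+ 99) :* v :^ 8 :+ con (ℤ.- + 55) :* v :^ 9 :+ con (+ 22) :* v :^ 10 :+ con (ℤ.-
    + 6) :* v :^ 11 :+ con (+ 1) :* v :^ 12)) S.refl

frobenius-factor : ∀ k → dil 13 (1-q^ k) ≈ (1s ⊕ ⊖ ((q ↑ k) ↑ 13))
frobenius-factor k = S.trans (dil-1-q^ 13 k) (S.+-congˡ {x = 1s} (S.-‿cong (S.sym (^-assocʳ q k 13))))

frobenius-g : ∀ K → g K ↑ 13 ≋ dil 13 (g K)
frobenius-g zero = mk≋ 0s (S.trans (solve 0 (con 1ℤ :^ 13 := con 1ℤ :+ con (+ 13) :* con 0ℤ) S.refl) (S.+-congʳ (S.sym
    (dil-const 13 1ℤ))))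
frobenius-g (suc K) with frobenius-g K
... | mk≋ d e = mk≋ (binomial₁₃ p ⊗ dil 13 (g K) ⊕ u ⊗ d ⊕ const (+ 13) ⊗ binomial₁₃ p ⊗ d) (begin
  (1-q^ (suc K) ⊗ g K) ↑ 13
    ≈⟨ product (1-q^ (suc K)) (g K) ⟩
  1-q^ (suc K) ↑ 13 ⊗ g K ↑ 13
    ≈⟨ ⊗-cong (1-v^13 p) e ⟩
  (u ⊕ const (+ 13) ⊗ binomial₁₃ p) ⊗ (dil 13 (g K) ⊕ const (+ 13) ⊗ d)
    ≈⟨ expand u (binomial₁₃ p) (dil 13 (g K)) d ⟩
  u ⊗ dil 13 (g K) ⊕ const (+ 13) ⊗ (binomial₁₃ p ⊗ dil 13 (g K) ⊕ u ⊗ d ⊕ const (+ 13) ⊗ binomial₁₃ p ⊗ d)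
    ≈⟨ S.+-congʳ (S.sym (S.trans (dil-⊗ 13 (1-q^ (suc K)) (g K)) (S.*-congʳ (frobenius-factor (suc K))))) ⟩
  dil 13 (g (suc K)) ⊕ const (+ 13) ⊗ (binomial₁₃ p ⊗ dil 13 (g K) ⊕ u ⊗ d ⊕ const (+ 13) ⊗ binomial₁₃ p ⊗ d) ∎)
  where
  open ≈-Reasoning
  p = q ↑ suc K
  u = 1s ⊕ ⊖ (p ↑ 13)
  product : ∀ a b → (a ⊗ b) ↑ 13 ≈ a ↑ 13 ⊗ b ↑ 13
  product = solve 2 (λ a b → (a :* b) :^ 13 := a :^ 13 :* b :^ 13) S.refl
  expand : ∀ u h w d → (u ⊕ const (+ 13) ⊗ h) ⊗ (w ⊕ const (+ 13) ⊗ d) ≈ u ⊗ w ⊕ const (+ 13) ⊗ (h ⊗ w ⊕ u ⊗ d ⊕ const (+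
      13) ⊗ h ⊗ d)
  expand = solve 4 (λ u h w d → (u :+ con (+ 13) :* h) :* (w :+ con (+ 13) :* d) := u :* w :+ con (+ 13) :* (h :* w :+ u :*
      d :+ con (+ 13) :* h :* d)) S.refl

frobenius-f : f ↑ 13 ≋ dil 13 f
frobenius-f = mk≋ d (mk≈ λ n → begin
  (f ↑ 13) n                                  ≡⟨ agree (^-cong[] 13 (f-≈[] n)) n ℕ.≤-refl ⟩
  (g n ↑ 13) n                                ≡⟨ at (equation (frobenius-g n)) n ⟩
  dil 13 (g n) n ℤ.+ (const (+ 13) ⊗ quotient (frobenius-g n)) n
    ≡⟨ cong₂ ℤ._+_ (sym (agree (dil-cong[] 13 (f-≈[] n)) n ℕ.≤-refl))
         (trans (const-⊗ (+ 13) (quotient (frobenius-g n)) n) (sym (const-⊗ (+ 13) d n))) ⟩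
  dil 13 f n ℤ.+ (const (+ 13) ⊗ d) n         ∎)
  where
  open ≡-Reasoning
  -- A diagonal choice: at exponent n, f may be replaced by `g n` on both sides, so the quotient
  -- belonging to `g n` serves there.
  d : Series
  d n = quotient (frobenius-g n) n

natSeries : (ℕ → ℕ) → Series
natSeries β n = + β n

bip : Series
bip = natSeries (B 5 13)

bip-⊗-f² : bip ⊗ (f ⊗ f) ≈ f₅ ⊗ dil 13 f
bip-⊗-f² = begin
  bip ⊗ (f ⊗ f)                              ≈⟨ S.*-congʳ (mk≈ (B-convolution 5 13)) ⟩
  regular 5 ⊗ regular 13 ⊗ (f ⊗ f)         ≈⟨ lem (regular 5) (regular 13) f ⟩
  regular 5 ⊗ f ⊗ (regular 13 ⊗ f)         ≈⟨ ⊗-cong (regular-⊗-f 5) (regular-⊗-f 13) ⟩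
  f₅ ⊗ dil 13 f                            ∎
  where
  open ≈-Reasoning
  lem : ∀ r s f → r ⊗ s ⊗ (f ⊗ f) ≈ r ⊗ f ⊗ (s ⊗ f)
  lem = solve 3 (λ r s f → r :* s :* (f :* f) := r :* f :* (s :* f)) S.refl

v₀-⊗-f² : v₀ ⊗ (f ⊗ f) ≈ f₅ ⊗ f ↑ 13
v₀-⊗-f² = lem f f₅
  where
  lem : ∀ f h → f ↑ 11 ⊗ h ⊗ (f ⊗ f) ≈ h ⊗ f ↑ 13
  lem = solve 2 (λ f h → f :^ 11 :* h :* (f :* f) := h :* f :^ 13) S.refl

-- Multiplied by f², the two sides are f₅ f¹³ and f₅ f₁₃, congruent by Frobenius. The quotient must
-- then be divided by f² too, hence the f⁻¹ in `e`.
v₀-≋-bip : v₀ ≋ bip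
v₀-≋-bip = mk≋ e (⊗-cancelˡ f f-0 (⊗-cancelˡ f f-0 (begin
  f ⊗ (f ⊗ v₀)                              ≈⟨ swap f v₀ ⟩
  v₀ ⊗ (f ⊗ f)                              ≈⟨ v₀-⊗-f² ⟩
  f₅ ⊗ f ↑ 13                               ≈⟨ S.*-congˡ {x = f₅} (equation frobenius-f) ⟩
  f₅ ⊗ (dil 13 f ⊕ const (+ 13) ⊗ d)        ≈⟨ S.distribˡ f₅ (dil 13 f) (const (+ 13) ⊗ d) ⟩
  -- The solver treats f⁻¹ as an independent variable, so a multiple of 1 - (f f⁻¹)² is carried
  -- along and then seen to vanish.
  f₅ ⊗ dil 13 f ⊕ f₅ ⊗ (const (+ 13) ⊗ d)   ≈⟨ S.+-cong (S.sym bip-⊗-f²) (insert f₅ d f f⁻¹) ⟩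
  bip ⊗ (f ⊗ f) ⊕ (const (+ 13) ⊗ e ⊗ (f ⊗ f) ⊕ f₅ ⊗ (const (+ 13) ⊗ d) ⊗ (1s ⊕ ⊖ (f ⊗ f⁻¹ ⊗ (f ⊗ f⁻¹))))
    ≈⟨ S.+-congˡ {x = bip ⊗ (f ⊗ f)} (S.+-congˡ {x = const (+ 13) ⊗ e ⊗ (f ⊗ f)} (S.*-congˡ {x = f₅ ⊗ (const (+ 13) ⊗ d)}
         (S.+-congˡ {x = 1s} (S.-‿cong (⊗-cong f⊗f⁻¹ f⊗f⁻¹))))) ⟩
  bip ⊗ (f ⊗ f) ⊕ (const (+ 13) ⊗ e ⊗ (f ⊗ f) ⊕ f₅ ⊗ (const (+ 13) ⊗ d) ⊗ (1s ⊕ ⊖ (1s ⊗ 1s)))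
    ≈⟨ collect bip f (const (+ 13) ⊗ e) (f₅ ⊗ (const (+ 13) ⊗ d)) ⟩
  f ⊗ (f ⊗ (bip ⊕ const (+ 13) ⊗ e))          ∎)))
  where
  open ≈-Reasoning
  d = quotient frobenius-f
  e = f₅ ⊗ d ⊗ (f⁻¹ ⊗ f⁻¹)
  swap : ∀ f v → f ⊗ (f ⊗ v) ≈ v ⊗ (f ⊗ f)
  swap = solve 2 (λ f v → f :* (f :* v) := v :* (f :* f)) S.refl
  insert : ∀ h d f i → h ⊗ (const (+ 13) ⊗ d) ≈ const (+ 13) ⊗ (h ⊗ d ⊗ (i ⊗ i)) ⊗ (f ⊗ f) ⊕ h ⊗ (const (+ 13) ⊗ d) ⊗ (1s ⊕
      ⊖ (f ⊗ i ⊗ (f ⊗ i)))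
  insert = solve 4 (λ h d f i → h :* (con (+ 13) :* d) := con (+ 13) :* (h :* d :* (i :* i)) :* (f :* f) :+ h :* (con (+
      13) :* d) :* (con 1ℤ :+ :- (f :* i :* (f :* i)))) S.refl
  collect : ∀ bip f e h → bip ⊗ (f ⊗ f) ⊕ (e ⊗ (f ⊗ f) ⊕ h ⊗ (1s ⊕ ⊖ (1s ⊗ 1s))) ≈ f ⊗ (f ⊗ (bip ⊕ e))
  collect = solve 4 (λ bip f e h → bip :* (f :* f) :+ (e :* (f :* f) :+ h :* (con 1ℤ :+ :- (con 1ℤ :* con 1ℤ))) := f :* (f
      :* (bip :+ e))) S.refl

-- Abstract, since its iterates would otherwise unfold to towers of thousands of successors.
abstract
  ι : ℕ → ℕ
  ι n = 1 + (3 + n * 5) * 5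

  U₁₃-at : ∀ a n → U₁₃ a n ≡ a (ι n)
  U₁₃-at a n = refl

  -- In the variable 3n + 2 the index map of `U₁₃` is multiplication by 25; stated without division,
  -- it composes freely.
  ι-affine : ∀ n → 3 * ι n + 2 ≡ 25 * (3 * n + 2)
  ι-affine = lem
    where
    lem : ∀ n → 3 * (1 + (3 + n * 5) * 5) + 2 ≡ 25 * (3 * n + 2)
    lem = ℕ-Solver.solve-∀

U₁₃²-at : ∀ a n → U₁₃ (U₁₃ a) n ≡ a (ι (ι n))
U₁₃²-at a n = trans (U₁₃-at (U₁₃ a) n) (U₁₃-at a (ι n))

U₁₃³-at : ∀ a n → U₁₃ (U₁₃ (U₁₃ a)) n ≡ a (ι (ι (ι n)))
U₁₃³-at a n = trans (U₁₃-at (U₁₃ (U₁₃ a)) n) (U₁₃²-at a (ι n))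

≋-at : ∀ {s t} → s ≋ t → ∀ n → ∃ λ k → s n ≡ t n ℤ.+ + 13 ℤ.* k
≋-at {s} {t} (mk≋ d e) n = d n , trans (at e n) (cong (λ u → t n ℤ.+ u) (const-⊗ (+ 13) d n))

mod-13 : ∀ m n k → + m ≡ + n ℤ.+ + 13 ℤ.* k → m ≡ n [mod 13 ]
mod-13 m n (+ k) e = trans (cong (_% 13) (ℤ.+-injective (trans e (trans (cong (λ t → + n ℤ.+ t) (trans (sym (ℤ.pos-* 13 k))
    (cong +_ (ℕ.*-comm 13 k)))) (sym (ℤ.pos-+ n (k * 13)))))))
  ([m+kn]%n≡m%n n k 13)
-- For a negative quotient m and n exchange roles, so that a natural multiple of 13 is added to m.
mod-13 m n -[1+ k ] e = sym (trans (cong (_% 13) (ℤ.+-injective (trans n≡ (sym (ℤ.pos-+ m (suc k * 13)))))) ([m+kn]%n≡m%n m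
    (suc k) 13))
  where
  lem : ∀ n t → n ≡ n ℤ.+ + 13 ℤ.* ℤ.- t ℤ.+ t ℤ.* + 13
  lem = solve-∀
  n≡ : + n ≡ + m ℤ.+ + (suc k * 13)
  n≡ = trans (lem (+ n) (+ suc k)) (cong₂ ℤ._+_ (sym e) (sym (ℤ.pos-* (suc k) 13)))

mod-*ˡ : ∀ c m n → m ≡ n [mod 13 ] → c * m ≡ c * n [mod 13 ]
mod-*ˡ c m n e = trans (%-distribˡ-* c m 13) (trans (cong (λ t → (c % 13 * t) % 13) e) (sym (%-distribˡ-* c n 13)))

-- The factor q² f₅¹¹ lies in class 2, so the empty classes 3 and 4 of f become the empty classes 0
-- and 1 of `w₂`.
proj-w₂ : ∀ r → 3 ≤ r → r < 5 → proj ((2 + r) % 5) w₂ ≈ 0s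
proj-w₂ r 3≤r r<5 = S.trans (proj-cong ((2 + r) % 5) (swap (q ↑ 2) f (f₅ ↑ 11)))
  (S.trans (proj-⊗ 2 r f r<5 (onClass-⊗ (onClass-q^ 2) (onClass-f₅^ 11)))
  (S.trans (S.*-congˡ (proj-f-≥3 r 3≤r)) (S.zeroʳ (q ↑ 2 ⊗ f₅ ↑ 11))))
  where
  swap : ∀ a b c → a ⊗ b ⊗ c ≈ a ⊗ c ⊗ b
  swap = solve 3 (λ a b c → a :* b :* c := a :* c :* b) S.refl

w₂-vanish : ∀ N → N % 5 ≡ 0 ⊎ N % 5 ≡ 1 → w₂ N ≡ 0ℤ
w₂-vanish N (inj₁ e) = trans (sym (proj-hit {n = N} w₂ e)) (trans (at (proj-w₂ 3 ℕ.≤-refl (s≤s (s≤s (s≤s (s≤s z≤n))))) N)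
    (0s-at N))
w₂-vanish N (inj₂ e) = trans (sym (proj-hit {n = N} w₂ e)) (trans (at (proj-w₂ 4 (ℕ.m≤m+n 3 1) ℕ.≤-refl) N) (0s-at N))

U₁₃³-eigen : ∀ {s t} → t ≋ s → U₁₃ (U₁₃ (U₁₃ t)) ≋ const (+ 8) ⊗ t →
  ∀ n → ∃ λ k → s (ι (ι (ι n))) ≡ + 8 ℤ.* s n ℤ.+ + 13 ℤ.* k
U₁₃³-eigen {s} {t} t≋s e n with ≋-at t≋s (ι (ι (ι n))) | ≋-at e n | ≋-at t≋s n
... | k , p | k′ , p′ | k″ , p″ = + 8 ℤ.* k″ ℤ.+ k′ ℤ.- k ,
  lem (s (ι (ι (ι n)))) (t (ι (ι (ι n)))) k (t n) k′ (s n) k″ p (trans (sym (U₁₃³-at t n)) (trans p′ (cong (λ u → u ℤ.+ +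
      13 ℤ.* k′) (const-⊗ (+ 8) t n)))) p″
  where
  rearrange₁ : ∀ β k → β ≡ (β ℤ.+ + 13 ℤ.* k) ℤ.- + 13 ℤ.* k
  rearrange₁ = solve-∀
  rearrange₂ : ∀ γ k k′ k″ → + 8 ℤ.* (γ ℤ.+ + 13 ℤ.* k″) ℤ.+ + 13 ℤ.* k′ ℤ.- + 13 ℤ.* k ≡ + 8 ℤ.* γ ℤ.+ + 13 ℤ.* (+ 8 ℤ.*
      k″ ℤ.+ k′ ℤ.- k)
  rearrange₂ = solve-∀
  lem : ∀ β v k u k′ γ k″ → v ≡ β ℤ.+ + 13 ℤ.* k → v ≡ + 8 ℤ.* u ℤ.+ + 13 ℤ.* k′ → u ≡ γ ℤ.+ + 13 ℤ.* k″ →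
    β ≡ + 8 ℤ.* γ ℤ.+ + 13 ℤ.* (+ 8 ℤ.* k″ ℤ.+ k′ ℤ.- k)
  lem β v k u k′ γ k″ p p′ refl = trans (rearrange₁ β k) (trans (cong (λ t → t ℤ.- + 13 ℤ.* k) (trans (sym p) p′))
      (rearrange₂ γ k k′ k″))

U₁U₁₃²-vanish : ∀ {s t w} → t ≋ s → U 1 (U₁₃ (U₁₃ t)) ≋ const (+ 5) ⊗ w →
  ∀ n → w n ≡ 0ℤ → ∃ λ k → s (ι (ι (1 + n * 5))) ≡ 0ℤ ℤ.+ + 13 ℤ.* k
U₁U₁₃²-vanish {s} {t} {w} t≋s e n wn≡0 with ≋-at t≋s (ι (ι (1 + n * 5))) | ≋-at e n
... | k , p | k′ , p′ = k′ ℤ.- k ,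
  lem (s (ι (ι (1 + n * 5)))) (t (ι (ι (1 + n * 5)))) k k′ p
    (trans (sym (U₁₃²-at t (1 + n * 5))) (trans p′ (cong (λ u → u ℤ.+ + 13 ℤ.* k′)
      (trans (const-⊗ (+ 5) w n) (trans (cong (λ u → + 5 ℤ.* u) wn≡0) (ℤ.*-zeroʳ (+ 5)))))))
  where
  rearrange₁ : ∀ β k → β ≡ (β ℤ.+ + 13 ℤ.* k) ℤ.- + 13 ℤ.* k
  rearrange₁ = solve-∀
  rearrange₂ : ∀ k k′ → 0ℤ ℤ.+ + 13 ℤ.* k′ ℤ.- + 13 ℤ.* k ≡ 0ℤ ℤ.+ + 13 ℤ.* (k′ ℤ.- k)
  rearrange₂ = solve-∀
  lem : ∀ β v k k′ → v ≡ β ℤ.+ + 13 ℤ.* k → v ≡ 0ℤ ℤ.+ + 13 ℤ.* k′ → β ≡ 0ℤ ℤ.+ + 13 ℤ.* (k′ ℤ.- k)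
  lem β v k k′ p p′ = trans (rearrange₁ β k) (trans (cong (λ t → t ℤ.- + 13 ℤ.* k) (trans (sym p) p′)) (rearrange₂ k k′))

-- Abstracting β and the two series keeps the definition of `B` and the eta quotients out of the
-- index arithmetic.
module Iterate (β : ℕ → ℕ) {v w : Series} (v≋β : v ≋ natSeries β)
  (e₆ : U₁₃ (U₁₃ (U₁₃ v)) ≋ const (+ 8) ⊗ v)
  (e₅ : U 1 (U₁₃ (U₁₃ v)) ≋ const (+ 5) ⊗ w)
  (w-vanish : ∀ n → n % 5 ≡ 0 ⊎ n % 5 ≡ 1 → w n ≡ 0ℤ) where

  β-ι³ : ∀ n → β (ι (ι (ι n))) ≡ 8 * β n [mod 13 ]
  β-ι³ n with U₁₃³-eigen v≋β e₆ n
  ... | k , e = mod-13 (β (ι (ι (ι n)))) (8 * β n) k (trans e (cong (λ u → u ℤ.+ + 13 ℤ.* k) (sym (ℤ.pos-* 8 (β n)))))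

  β-vanish : ∀ n → n % 5 ≡ 0 ⊎ n % 5 ≡ 1 → β (ι (ι (1 + n * 5))) ≡ 0 [mod 13 ]
  β-vanish n h with U₁U₁₃²-vanish v≋β e₅ n (w-vanish n h)
  ... | k , e = mod-13 (β (ι (ι (1 + n * 5)))) 0 k e

  ι²-affine : ∀ n → 3 * ι (ι n) + 2 ≡ 625 * (3 * n + 2)
  ι²-affine n = trans (ι-affine (ι n)) (trans (cong (25 ℕ.*_) (ι-affine n)) (sym (ℕ.*-assoc 25 25 (3 * n + 2))))

  ι³-affine : ∀ n → 3 * ι (ι (ι n)) + 2 ≡ 15625 * (3 * n + 2)
  ι³-affine n = trans (ι-affine (ι (ι n))) (trans (cong (25 ℕ.*_) (ι²-affine n)) (sym (ℕ.*-assoc 25 625 (3 * n + 2))))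

  affine-injective : ∀ x y → 3 * x + 2 ≡ 3 * y + 2 → x ≡ y
  affine-injective x y e = ℕ.*-cancelˡ-≡ x y 3 (ℕ.+-cancelʳ-≡ 2 (3 * x) (3 * y) e)

  scaled : ∀ p n t → 3 * t + 2 ≡ 2 * p → 3 * (p * n + t) + 2 ≡ p * (3 * n + 2)
  scaled p n t e = trans (lem₁ p n t) (trans (cong (3 * (p * n) ℕ.+_) e) (lem₂ p n))
    where
    lem₁ : ∀ p n t → 3 * (p * n + t) + 2 ≡ 3 * (p * n) + (3 * t + 2)
    lem₁ = ℕ-Solver.solve-∀
    lem₂ : ∀ p n → 3 * (p * n) + 2 * p ≡ p * (3 * n + 2)
    lem₂ = ℕ-Solver.solve-∀

  -- The index x is given by its equation instead of a quotient by 3. Both congruences then apply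
  -- this lemma, with different n, after checking one linear identity.
  iterate : ∀ m n x → 3 * x + 2 ≡ 5 ^ (6 * m) * (3 * n + 2) → β x ≡ 8 ^ m * β n [mod 13 ]
  iterate zero    n x e = cong (_% 13) (trans (cong β (affine-injective x n (trans e (ℕ.*-identityˡ _)))) (sym
      (ℕ.*-identityˡ (β n))))
  iterate (suc m) n x e = trans (cong (λ t → β t % 13) x≡) (trans (β-ι³ x′)
    (trans (mod-*ˡ 8 (β x′) (8 ^ m * β n) (iterate m n x′ x′≡)) (cong (_% 13) (sym (ℕ.*-assoc 8 (8 ^ m) (β n))))))
    where
    p = 5 ^ (6 * m)
    x′ = p * n + (2 * p ∸ 2) / 3
    x′≡ : 3 * x′ + 2 ≡ p * (3 * n + 2)
    x′≡ = scaled p n ((2 * p ∸ 2) / 3) (exact₁ m)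
    x≡ : x ≡ ι (ι (ι x′))
    x≡ = affine-injective x (ι (ι (ι x′))) (trans e (trans (cong (ℕ._* (3 * n + 2)) (trans (cong (5 ℕ.^_) (ℕ.*-suc 6 m))
        (ℕ.^-distribˡ-+-* 5 6 (6 * m))))
      (trans (ℕ.*-assoc 15625 p (3 * n + 2)) (trans (cong (15625 ℕ.*_) (sym x′≡)) (sym (ι³-affine x′))))))

  first : ∀ n m → β (5 ^ (6 * m) * n + (2 * 5 ^ (6 * m) ∸ 2) / 3) ≡ 8 ^ m * β n [mod 13 ]
  first n m = iterate m n _ (scaled (5 ^ (6 * m)) n _ (exact₁ m))

  -- The index satisfies 3X + 2 = 5^(6m) (3Y + 2), where Y is an index reached after five steps. So
  -- the value is 8ᵐ times one that already vanishes modulo 13.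
  second : ∀ n m k → k ≡ 1 ⊎ k ≡ 5 → β (5 ^ (6 * m + 6) * n + ((3 * k + 1) * 5 ^ (6 * m + 5) ∸ 2) / 3) ≡ 0 [mod 13 ]
  second n m k h = trans (iterate m Y X X≡) (trans (mod-*ˡ (8 ^ m) (β Y) 0 (Y-vanish h)) (cong (_% 13) (ℕ.*-zeroʳ (8 ^ m))))
    where
    p = 5 ^ (6 * m)
    t = ((3 * k + 1) * 5 ^ (6 * m + 5) ∸ 2) / 3
    X = 5 ^ (6 * m + 6) * n + t
    -- Modulo 13 the coefficient at Y is 5 times that of `w₂` at M, and 3Y + 2 = 3125 (3M + 1). The
    -- choices k = 1 and k = 5 put M into the empty classes 1 and 0.
    M = 5 * n + k
    Y = ι (ι (1 + M * 5))
    residue : k ≡ 1 ⊎ k ≡ 5 → M % 5 ≡ 0 ⊎ M % 5 ≡ 1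
    residue (inj₁ refl) = inj₂ (trans (cong (_% 5) (lem n)) ([m+kn]%n≡m%n 1 n 5))
      where
      lem : ∀ n → 5 * n + 1 ≡ 1 + n * 5
      lem = ℕ-Solver.solve-∀
    residue (inj₂ refl) = inj₁ (trans (cong (_% 5) (lem n)) ([m+kn]%n≡m%n 0 (suc n) 5))
      where
      lem : ∀ n → 5 * n + 5 ≡ suc n * 5
      lem = ℕ-Solver.solve-∀
    Y-vanish : k ≡ 1 ⊎ k ≡ 5 → β Y ≡ 0 [mod 13 ]
    Y-vanish h = β-vanish M (residue h)
    X≡ : 3 * X + 2 ≡ p * (3 * Y + 2)
    X≡ = trans (lem₁ (5 ^ (6 * m + 6)) n t) (trans (cong₂ (λ u v → 3 * (u * n) + v)
        (ℕ.^-distribˡ-+-* 5 (6 * m) 6)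
        (trans (exact₂ m k) (cong ((3 * k + 1) ℕ.*_) (ℕ.^-distribˡ-+-* 5 (6 * m) 5))))
      (trans (lem₂ p n k 3125) (cong (p ℕ.*_) (sym Y≡))))
      where
      lem₁ : ∀ u n t → 3 * (u * n + t) + 2 ≡ 3 * (u * n) + (3 * t + 2)
      lem₁ = ℕ-Solver.solve-∀
      lem₂ : ∀ p n k c → 3 * (p * (c * 5) * n) + (3 * k + 1) * (p * c) ≡ p * (c * (3 * (5 * n + k) + 1))
      lem₂ = ℕ-Solver.solve-∀
      lem₃ : ∀ M → 3 * (1 + M * 5) + 2 ≡ 5 * (3 * M + 1)
      lem₃ = ℕ-Solver.solve-∀
      Y≡ : 3 * Y + 2 ≡ 3125 * (3 * M + 1)
      Y≡ = trans (ι²-affine (1 + M * 5)) (trans (cong (625 ℕ.*_) (lem₃ M)) (sym (ℕ.*-assoc 625 5 (3 * M + 1))))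

theorem1p4 : (∀ (n m : ℕ) →
    B 5 13 (5 ^ (6 * m) * n + (2 * 5 ^ (6 * m) ∸ 2) / 3) ≡ 8 ^ m * B 5 13 n [mod 13 ])
    × (∀ (n m k : ℕ) → k ≡ 1 ⊎ k ≡ 5 →
    B 5 13 (5 ^ (6 * m + 6) * n + ((3 * k + 1) * 5 ^ (6 * m + 5) ∸ 2) / 3) ≡ 0 [mod 13 ])
theorem1p4 = first , second
  where open Iterate (B 5 13) v₀-≋-bip s₆-≋ s₅-≋ w₂-vanish
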